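{- There exists $P_0$ such that for every real $P \ge P_0$ there is a graph $G$ with $\rho(G) \le P$ and $\chi_f(G) \ge e^{(\ln P)^2/5}$.
   Context: Graphs are finite and simple, and $\ln$ is the natural logarithm. For a graph $G$, $v(G)$ is its number of vertices and $\alpha(G)$ is the size of a largest independent set. The Hall ratio of $G$ is $\rho(G) := \max_{\emptyset\neq H\subseteq G} \frac{v(H)}{\alpha(H)}$, the maximum over all subgraphs $H$ of $G$ with at least one vertex. The fractional chromatic number $\chi_f(G)$ is the optimal value of the linear program: minimize $\sum_{I} x_I$ over nonnegative reals $x_I$ indexed by the independent sets $I$ of $G$, subject to $\sum_{I\ni v} x_I\ge 1$ for every vertex $v$. Equivalently, by LP duality, it is the maximum of $\sum_{v\in V(G)} y(v)$ over $y:V(G)\to[0,\infty)$ with $\sum_{v\in I} y(v)\le 1$ for every independent set $I$ of $G$. -}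

module Defs where

open import Data.Bool.Base as Bool using (Bool; false)
open import Data.Fin.Base using (Fin)
import Data.Fin.Properties as Fin
open import Data.Fin.Subset as Subset using (Subset; inside; outside; _∈_; _⊆_; Nonempty)
open import Data.Fin.Subset.Properties using (_∈?_)
import Data.Integer.Base as ℤ
import Data.Integer.Properties as ℤ
open import Data.List.Base using (List; []; _∷_; map; _++_; filter; foldr)
open import Data.Nat.Base as ℕ using (ℕ; zero; suc)
import Data.Nat.Properties as ℕ
open import Data.Product.Base using (Σ; Σ-syntax; ∃; ∃-syntax; _×_; _,_; proj₁; proj₂)
open import Data.Rational.Base as ℚ using (ℚ; 0ℚ; 1ℚ)
import Data.Rational.Properties as ℚ
import Data.Rational.Solver as ℚSolver
import Data.Rational.Unnormalised.Base as ℚᵘ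
import Data.Rational.Unnormalised.Properties as ℚᵘ
open import Data.Sum.Base using (inj₁; inj₂; [_,_]′)
open import Data.Vec.Base using ([]; _∷_)
open import Relation.Binary.PropositionalEquality
  using (_≡_; refl; sym; trans; cong; cong₂; subst; subst₂)
open import Relation.Nullary using (¬_; Dec; yes; no; ¬?)
open import Relation.Nullary.Decidable using (T?; _→-dec_)

Eventually : (ℕ → Set) → Set
Eventually P = ∃[ N ] ∀ n → N ℕ.≤ n → P n

-- Opaque because unfolding _/_ exposes gcd computations, which makes type checking very slow.
opaque
  ι : ℕ → ℚ
  ι n = ℤ.+ n ℚ./ 1

  recip : ℕ → ℚ
  recip k = ℤ.+ 1 ℚ./ suc k

module RationalLemmas where
  open import Data.Rational.Base
  open ℚSolver.+-*-Solver
  open ℚ.≤-Reasoning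

  toℚᵘ-/ : ∀ n d → toℚᵘ (n / suc d) ℚᵘ.≃ ℚᵘ.mkℚᵘ n d
  toℚᵘ-/ n d = ℚ.toℚᵘ-fromℚᵘ (ℚᵘ.mkℚᵘ n d)

  opaque
    unfolding ι recip

    ι-0 : ι 0 ≡ 0ℚ
    ι-0 = refl

    ι-2 : ι 2 ≡ 1ℚ + 1ℚ
    ι-2 = refl

    ι-suc : ∀ n → ι (suc n) ≡ ι n + 1ℚ
    ι-suc n = ℚ.toℚᵘ-injective (ℚᵘ.≃-trans (toℚᵘ-/ (ℤ.+ suc n) 0)
      (ℚᵘ.≃-sym (ℚᵘ.≃-trans (ℚ.toℚᵘ-homo-+ (ι n) 1ℚ)
        (ℚᵘ.≃-trans (ℚᵘ.+-cong (toℚᵘ-/ (ℤ.+ n) 0) (ℚᵘ.≃-refl {toℚᵘ 1ℚ}))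
          (ℚᵘ.*≡* lem)))))
      where
      lem : (ℤ.+ n ℤ.* ℤ.+ 1 ℤ.+ ℤ.+ 1 ℤ.* ℤ.+ 1) ℤ.* ℤ.+ 1 ≡ ℤ.+ suc n ℤ.* ℤ.+ 1
      lem = cong (ℤ._* ℤ.+ 1)
        (trans (cong (ℤ._+ ℤ.+ 1) (ℤ.*-identityʳ (ℤ.+ n))) (cong ℤ.+_ (ℕ.+-comm n 1)))

    recip-ι : ∀ k → recip k * ι (suc k) ≡ 1ℚ
    recip-ι k = ℚ.toℚᵘ-injective (ℚᵘ.≃-trans (ℚ.toℚᵘ-homo-* (recip k) (ι (suc k)))
      (ℚᵘ.≃-trans (ℚᵘ.*-cong (toℚᵘ-/ (ℤ.+ 1) k) (toℚᵘ-/ (ℤ.+ suc k) 0)) (ℚᵘ.*≡* lem)))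
      where
      lem : (ℤ.+ 1 ℤ.* ℤ.+ suc k) ℤ.* ℤ.+ 1 ≡ ℤ.+ 1 ℤ.* ℤ.+ (suc k ℕ.* 1)
      lem = trans (ℤ.*-identityʳ _) (cong (λ m → ℤ.+ 1 ℤ.* ℤ.+ m) (sym (ℕ.*-identityʳ (suc k))))

  0≤1 : 0ℚ ≤ 1ℚ
  0≤1 = ℚ.nonNegative⁻¹ 1ℚ

  opaque
    unfolding ι recip

    0<recip : ∀ k → 0ℚ < recip k
    0<recip k = ℚ.positive⁻¹ (recip k) {{ℚ.normalize-pos 1 (suc k)}}

    0≤ι : ∀ n → 0ℚ ≤ ι n
    0≤ι n = ℚ.nonNegative⁻¹ (ι n) {{ℚ.normalize-nonNeg n 1}}

    0<ι-suc : ∀ n → 0ℚ < ι (suc n)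
    0<ι-suc n = ℚ.positive⁻¹ (ι (suc n)) {{ℚ.normalize-pos (suc n) 1}}

  ι-mono′ : ∀ m k → ι m ≤ ι (k ℕ.+ m)
  ι-mono′ m zero    = ℚ.≤-refl
  ι-mono′ m (suc k) = begin
    ι m              ≤⟨ ι-mono′ m k ⟩
    ι (k ℕ.+ m)      ≡⟨ sym (ℚ.+-identityʳ (ι (k ℕ.+ m))) ⟩
    ι (k ℕ.+ m) + 0ℚ ≤⟨ ℚ.+-monoʳ-≤ (ι (k ℕ.+ m)) 0≤1 ⟩
    ι (k ℕ.+ m) + 1ℚ ≡⟨ sym (ι-suc (k ℕ.+ m)) ⟩
    ι (suc k ℕ.+ m)  ∎

  ι-mono : ∀ {m n} → m ℕ.≤ n → ι m ≤ ι n
  ι-mono {m} {n} m≤n = subst (λ j → ι m ≤ ι j) (ℕ.m∸n+n≡m m≤n) (ι-mono′ m (n ℕ.∸ m))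

  ι-+ : ∀ m n → ι (m ℕ.+ n) ≡ ι m + ι n
  ι-+ zero    n = sym (trans (cong (_+ ι n) ι-0) (ℚ.+-identityˡ (ι n)))
  ι-+ (suc m) n = begin-equality
    ι (suc m ℕ.+ n)   ≡⟨ ι-suc (m ℕ.+ n) ⟩
    ι (m ℕ.+ n) + 1ℚ  ≡⟨ cong (_+ 1ℚ) (ι-+ m n) ⟩
    ι m + ι n + 1ℚ    ≡⟨ solve 2 (λ a b → a :+ b :+ con 1ℚ := (a :+ con 1ℚ) :+ b) refl (ι m) (ι n) ⟩
    (ι m + 1ℚ) + ι n  ≡⟨ cong (_+ ι n) (sym (ι-suc m)) ⟩
    ι (suc m) + ι n   ∎

  *-monoʳ : ∀ {p q} r → 0ℚ ≤ r → p ≤ q → p * r ≤ q * r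
  *-monoʳ r 0≤r = ℚ.*-monoʳ-≤-nonNeg r {{nonNegative 0≤r}}

  *-monoˡ : ∀ {p q} r → 0ℚ ≤ r → p ≤ q → r * p ≤ r * q
  *-monoˡ r 0≤r = ℚ.*-monoˡ-≤-nonNeg r {{nonNegative 0≤r}}

  *-mono : ∀ {p q r s} → 0ℚ ≤ r → 0ℚ ≤ q → p ≤ q → r ≤ s → p * r ≤ q * s
  *-mono {q = q} {r = r} 0≤r 0≤q p≤q r≤s = ℚ.≤-trans (*-monoʳ r 0≤r p≤q) (*-monoˡ q 0≤q r≤s)

  0≤* : ∀ {p q} → 0ℚ ≤ p → 0ℚ ≤ q → 0ℚ ≤ p * q
  0≤* {p} {q} 0≤p 0≤q = subst (_≤ p * q) (ℚ.*-zeroˡ q) (*-monoʳ q 0≤q 0≤p)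

  0≤+ : ∀ {p q} → 0ℚ ≤ p → 0ℚ ≤ q → 0ℚ ≤ p + q
  0≤+ = ℚ.+-mono-≤

  0<* : ∀ {p q} → 0ℚ < p → 0ℚ < q → 0ℚ < p * q
  0<* {p} {q} 0<p 0<q = ℚ.positive⁻¹ (p * q) {{ℚ.pos*pos⇒pos p {{positive 0<p}} q {{positive 0<q}}}}

  p≤p+q : ∀ {p q} → 0ℚ ≤ q → p ≤ p + q
  p≤p+q {p} {q} 0≤q = subst (_≤ p + q) (ℚ.+-identityʳ p) (ℚ.+-monoʳ-≤ p 0≤q)

  ≤-from-diff : ∀ {p q} → 0ℚ ≤ q - p → p ≤ q
  ≤-from-diff {p} {q} h = subst (p ≤_)
    (solve 2 (λ p q → p :+ (q :- p) := q) refl p q) (p≤p+q {p} h)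

  ∣-∣≤ : ∀ {p e} → p ≤ e → - p ≤ e → ∣ p ∣ ≤ e
  ∣-∣≤ {p} h₁ h₂ with ℚ.∣p∣≡p∨∣p∣≡-p p
  ... | inj₁ eq = subst (_≤ _) (sym eq) h₁
  ... | inj₂ eq = subst (_≤ _) (sym eq) h₂

  p≤∣p∣ : ∀ p → p ≤ ∣ p ∣
  p≤∣p∣ p with ℚ.≤-total 0ℚ p
  ... | inj₁ 0≤p = ℚ.≤-reflexive (sym (ℚ.0≤p⇒∣p∣≡p 0≤p))
  ... | inj₂ p≤0 = ℚ.≤-trans p≤0 (ℚ.0≤∣p∣ p)

  ∣-∣-swap : ∀ p q → ∣ p - q ∣ ≡ ∣ q - p ∣
  ∣-∣-swap p q = trans (sym (ℚ.∣-p∣≡∣p∣ (p - q)))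
    (cong ∣_∣ (solve 2 (λ p q → :- (p :- q) := q :- p) refl p q))

  ∣-∣-triangle : ∀ p q r → ∣ p - r ∣ ≤ ∣ p - q ∣ + ∣ q - r ∣
  ∣-∣-triangle p q r = subst (λ s → ∣ s ∣ ≤ ∣ p - q ∣ + ∣ q - r ∣)
    (solve 3 (λ p q r → (p :- q) :+ (q :- r) := p :- r) refl p q r)
    (ℚ.∣p+q∣≤∣p∣+∣q∣ (p - q) (q - r))

  ∣p-p∣≡0 : ∀ p → ∣ p - p ∣ ≡ 0ℚ
  ∣p-p∣≡0 p = cong ∣_∣ (ℚ.+-inverseʳ p)

  opaque
    unfolding ι recip

    ∃ι≥ : ∀ p → ∃[ n ] p ≤ ι n
    ∃ι≥ (mkℚ (ℤ.+ n) d c) = n , ℚ.toℚᵘ-cancel-≤ (ℚᵘ.≤-respʳ-≃ (ℚᵘ.≃-sym (toℚᵘ-/ (ℤ.+ n) 0))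
      (ℚᵘ.*≤* (subst₂ ℤ._≤_ (ℤ.pos-* n 1) (ℤ.pos-* n (suc d))
        (ℤ.+≤+ (ℕ.*-monoʳ-≤ n (ℕ.s≤s ℕ.z≤n))))))
    ∃ι≥ p@(mkℚ ℤ.-[1+ n ] d c) = 0 , ℚ.<⇒≤ (ℚ.negative⁻¹ p)

  shrink : ∀ K {ε} → 0ℚ < ε → ∃[ δ ] 0ℚ < δ × ι K * δ ≤ ε
  shrink K {ε} 0<ε = recip K * ε , 0<* (0<recip K) 0<ε , (begin
    ι K * (recip K * ε)       ≤⟨ *-monoʳ _ (ℚ.<⇒≤ (0<* (0<recip K) 0<ε)) (ι-mono (ℕ.n≤1+n K)) ⟩
    ι (suc K) * (recip K * ε) ≡⟨ solve 3 (λ a b c → a :* (b :* c) := (b :* a) :* c) refl (ι (suc K)) (recip K) ε ⟩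
    recip K * ι (suc K) * ε   ≡⟨ cong (_* ε) (recip-ι K) ⟩
    1ℚ * ε                    ≡⟨ ℚ.*-identityˡ ε ⟩
    ε ∎)

  archimedean : ∀ K {ε} → 0ℚ < ε → ∃[ N ] K ≤ ε * ι N
  archimedean K {ε} 0<ε with ∃ι≥ ((1/ ε) {{>-nonZero 0<ε}} * K)
  ... | N , h = N , (begin
    K                  ≡⟨ sym (ℚ.*-identityˡ K) ⟩
    1ℚ * K             ≡⟨ cong (_* K) (sym (ℚ.*-inverseʳ ε {{ε≢0}})) ⟩
    ε * ε⁻¹ * K        ≡⟨ ℚ.*-assoc ε ε⁻¹ K ⟩
    ε * (ε⁻¹ * K)      ≤⟨ *-monoˡ ε (ℚ.<⇒≤ 0<ε) h ⟩
    ε * ι N            ∎)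
    where
    ε≢0 = >-nonZero 0<ε
    ε⁻¹ = (1/ ε) {{ε≢0}}

open RationalLemmas

-- Cauchy sequences of rationals; equality is _≃ᴿ_.
record ℝ : Set where
  field
    seq    : ℕ → ℚ
    cauchy : ∀ ε → 0ℚ ℚ.< ε →
             ∃[ N ] ∀ m n → N ℕ.≤ m → N ℕ.≤ n → ℚ.∣ seq m ℚ.- seq n ∣ ℚ.≤ ε

open ℝ public

infix 4 _≤ᴿ_ _≃ᴿ_

_≤ᴿ_ : ℝ → ℝ → Set
x ≤ᴿ y = ∀ ε → 0ℚ ℚ.< ε → Eventually λ n → seq x n ℚ.≤ seq y n ℚ.+ ε

_≃ᴿ_ : ℝ → ℝ → Set
x ≃ᴿ y = ∀ ε → 0ℚ ℚ.< ε → Eventually λ n → ℚ.∣ seq x n ℚ.- seq y n ∣ ℚ.≤ ε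

module RealLemmas where
  open import Data.Rational.Base
  open ℚSolver.+-*-Solver
  open ℚ.≤-Reasoning

  cauchy-ordered : (s : ℕ → ℚ) →
    (∀ ε → 0ℚ < ε → ∃[ N ] ∀ m n → N ℕ.≤ m → m ℕ.≤ n → ∣ s m - s n ∣ ≤ ε) →
    ∀ ε → 0ℚ < ε → ∃[ N ] ∀ m n → N ℕ.≤ m → N ℕ.≤ n → ∣ s m - s n ∣ ≤ ε
  cauchy-ordered s h ε 0<ε = let (N , f) = h ε 0<ε in N , λ m n N≤m N≤n →
    [ f m n N≤m , (λ n≤m → subst (_≤ ε) (∣-∣-swap (s n) (s m)) (f n m N≤n n≤m)) ]′ (ℕ.≤-total m n)

  bounded : ∀ x → ∃[ B ] Eventually λ n → ∣ seq x n ∣ ≤ ι B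
  bounded x =
    let (N , f) = cauchy x 1ℚ (ℚ.positive⁻¹ 1ℚ)
        (B , h) = ∃ι≥ (1ℚ + ∣ seq x N ∣)
    in B , N , λ n N≤n → begin
    ∣ seq x n ∣                         ≡⟨ cong ∣_∣ (solve 2 (λ a b → a := (a :- b) :+ b) refl (seq x n) (seq x N)) ⟩
    ∣ (seq x n - seq x N) + seq x N ∣   ≤⟨ ℚ.∣p+q∣≤∣p∣+∣q∣ (seq x n - seq x N) (seq x N) ⟩
    ∣ seq x n - seq x N ∣ + ∣ seq x N ∣ ≤⟨ ℚ.+-monoˡ-≤ ∣ seq x N ∣ (f n N N≤n ℕ.≤-refl) ⟩
    1ℚ + ∣ seq x N ∣                    ≤⟨ h ⟩
    ι B                                 ∎

  *-cauchy : ∀ x y → let s = λ n → seq x n * seq y n in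
    ∀ ε → 0ℚ < ε → ∃[ N ] ∀ m n → N ℕ.≤ m → N ℕ.≤ n → ∣ s m - s n ∣ ≤ ε
  *-cauchy x y ε 0<ε =
    let (B , N₁ , x≤B) = bounded x
        (C , N₂ , y≤C) = bounded y
        (δ , 0<δ , hδ) = shrink (B ℕ.+ C) 0<ε
        (N₃ , fx)      = cauchy x δ 0<δ
        (N₄ , fy)      = cauchy y δ 0<δ
        N = (N₁ ℕ.⊔ N₂) ℕ.⊔ (N₃ ℕ.⊔ N₄)
        N₁≤N = ℕ.≤-trans (ℕ.m≤m⊔n N₁ N₂) (ℕ.m≤m⊔n (N₁ ℕ.⊔ N₂) (N₃ ℕ.⊔ N₄))
        N₂≤N = ℕ.≤-trans (ℕ.m≤n⊔m N₁ N₂) (ℕ.m≤m⊔n (N₁ ℕ.⊔ N₂) (N₃ ℕ.⊔ N₄))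
        N₃≤N = ℕ.≤-trans (ℕ.m≤m⊔n N₃ N₄) (ℕ.m≤n⊔m (N₁ ℕ.⊔ N₂) (N₃ ℕ.⊔ N₄))
        N₄≤N = ℕ.≤-trans (ℕ.m≤n⊔m N₃ N₄) (ℕ.m≤n⊔m (N₁ ℕ.⊔ N₂) (N₃ ℕ.⊔ N₄))
    in N , λ m n N≤m N≤n → let a = seq x m; b = seq y m; c = seq x n; d = seq y n in begin
      ∣ a * b - c * d ∣             ≡⟨ cong ∣_∣ (solve 4 (λ a b c d →
                                        a :* b :- c :* d := a :* (b :- d) :+ (a :- c) :* d) refl a b c d) ⟩
      ∣ a * (b - d) + (a - c) * d ∣ ≤⟨ ℚ.∣p+q∣≤∣p∣+∣q∣ (a * (b - d)) ((a - c) * d) ⟩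
      ∣ a * (b - d) ∣ + ∣ (a - c) * d ∣ ≡⟨ cong₂ _+_ (ℚ.∣p*q∣≡∣p∣*∣q∣ a (b - d)) (ℚ.∣p*q∣≡∣p∣*∣q∣ (a - c) d) ⟩
      ∣ a ∣ * ∣ b - d ∣ + ∣ a - c ∣ * ∣ d ∣ ≤⟨ ℚ.+-mono-≤
        (*-mono (ℚ.0≤∣p∣ (b - d)) (0≤ι B) (x≤B m (ℕ.≤-trans N₁≤N N≤m)) (fy m n (ℕ.≤-trans N₄≤N N≤m) (ℕ.≤-trans N₄≤N N≤n)))
        (*-mono (ℚ.0≤∣p∣ d) (ℚ.<⇒≤ 0<δ) (fx m n (ℕ.≤-trans N₃≤N N≤m) (ℕ.≤-trans N₃≤N N≤n)) (y≤C n (ℕ.≤-trans N₂≤N N≤n))) ⟩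
      ι B * δ + δ * ι C             ≡⟨ solve 3 (λ p q r → p :* r :+ r :* q := (p :+ q) :* r) refl (ι B) (ι C) δ ⟩
      (ι B + ι C) * δ               ≡⟨ cong (_* δ) (sym (ι-+ B C)) ⟩
      ι (B ℕ.+ C) * δ               ≤⟨ hδ ⟩
      ε                             ∎

  +-cauchy : ∀ x y → let s = λ n → seq x n + seq y n in
    ∀ ε → 0ℚ < ε → ∃[ N ] ∀ m n → N ℕ.≤ m → N ℕ.≤ n → ∣ s m - s n ∣ ≤ ε
  +-cauchy x y ε 0<ε =
    let (δ , 0<δ , hδ) = shrink 2 0<ε
        (N₁ , fx)      = cauchy x δ 0<δ
        (N₂ , fy)      = cauchy y δ 0<δ
    in N₁ ℕ.⊔ N₂ , λ m n N≤m N≤n → let a = seq x m; b = seq y m; c = seq x n; d = seq y n in begin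
      ∣ (a + b) - (c + d) ∣     ≡⟨ cong ∣_∣ (solve 4 (λ a b c d →
                                    (a :+ b) :- (c :+ d) := (a :- c) :+ (b :- d)) refl a b c d) ⟩
      ∣ (a - c) + (b - d) ∣     ≤⟨ ℚ.∣p+q∣≤∣p∣+∣q∣ (a - c) (b - d) ⟩
      ∣ a - c ∣ + ∣ b - d ∣     ≤⟨ ℚ.+-mono-≤
        (fx m n (ℕ.≤-trans (ℕ.m≤m⊔n N₁ N₂) N≤m) (ℕ.≤-trans (ℕ.m≤m⊔n N₁ N₂) N≤n))
        (fy m n (ℕ.≤-trans (ℕ.m≤n⊔m N₁ N₂) N≤m) (ℕ.≤-trans (ℕ.m≤n⊔m N₁ N₂) N≤n)) ⟩
      δ + δ                     ≡⟨ solve 1 (λ δ → δ :+ δ := con (1ℚ + 1ℚ) :* δ) refl δ ⟩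
      (1ℚ + 1ℚ) * δ             ≡⟨ cong (_* δ) (sym ι-2) ⟩
      ι 2 * δ                   ≤⟨ hδ ⟩
      ε                         ∎

open RealLemmas

infixl 6 _+ᴿ_
infixl 7 _*ᴿ_

fromℚ : ℚ → ℝ
fromℚ q .seq    _     = q
fromℚ q .cauchy ε 0<ε = 0 , λ _ _ _ _ → subst (ℚ._≤ ε) (sym (∣p-p∣≡0 q)) (ℚ.<⇒≤ 0<ε)

_+ᴿ_ : ℝ → ℝ → ℝ
(x +ᴿ y) .seq n  = seq x n ℚ.+ seq y n
(x +ᴿ y) .cauchy = +-cauchy x y

_*ᴿ_ : ℝ → ℝ → ℝ
(x *ᴿ y) .seq n  = seq x n ℚ.* seq y n
(x *ᴿ y) .cauchy = *-cauchy x y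

expTerm : ℚ → ℕ → ℚ
expTerm q zero    = 1ℚ
expTerm q (suc k) = expTerm q k ℚ.* (q ℚ.* recip k)

-- expSum q n = Σ_{k < n} q ^ k / k !
expSum : ℚ → ℕ → ℚ
expSum q zero    = 0ℚ
expSum q (suc n) = expSum q n ℚ.+ expTerm q n

module ExpLemmas where
  open import Data.Rational.Base
  open ℚSolver.+-*-Solver
  open ℚ.≤-Reasoning

  step-ι : ∀ q k → expTerm q (suc k) * ι (suc k) ≡ expTerm q k * q
  step-ι q k = begin-equality
    t * (q * recip k) * ι (suc k)   ≡⟨ solve 4 (λ t q r i → t :* (q :* r) :* i := t :* q :* (r :* i)) refl t q (recip k) (ι (suc k)) ⟩
    t * q * (recip k * ι (suc k))   ≡⟨ cong (t * q *_) (recip-ι k) ⟩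
    t * q * 1ℚ                      ≡⟨ ℚ.*-identityʳ (t * q) ⟩
    t * q                           ∎
    where t = expTerm q k

  0≤recip : ∀ k → 0ℚ ≤ recip k
  0≤recip k = ℚ.<⇒≤ (0<recip k)

  0≤expTerm : ∀ {b} → 0ℚ ≤ b → ∀ k → 0ℚ ≤ expTerm b k
  0≤expTerm 0≤b zero    = 0≤1
  0≤expTerm 0≤b (suc k) = 0≤* (0≤expTerm 0≤b k) (0≤* 0≤b (0≤recip k))

  0≤expSum : ∀ {b} → 0ℚ ≤ b → ∀ n → 0ℚ ≤ expSum b n
  0≤expSum 0≤b zero    = ℚ.≤-refl
  0≤expSum 0≤b (suc n) = 0≤+ (0≤expSum 0≤b n) (0≤expTerm 0≤b n)

  expSum-mono′ : ∀ {b} → 0ℚ ≤ b → ∀ m k → expSum b m ≤ expSum b (k ℕ.+ m)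
  expSum-mono′ 0≤b m zero    = ℚ.≤-refl
  expSum-mono′ 0≤b m (suc k) = ℚ.≤-trans (expSum-mono′ 0≤b m k) (p≤p+q (0≤expTerm 0≤b (k ℕ.+ m)))

  expSum-mono : ∀ {b m n} → 0ℚ ≤ b → m ℕ.≤ n → expSum b m ≤ expSum b n
  expSum-mono {b} {m} {n} 0≤b m≤n =
    subst (λ j → expSum b m ≤ expSum b j) (ℕ.m∸n+n≡m m≤n) (expSum-mono′ 0≤b m (n ℕ.∸ m))

  ∣*∣≤ : ∀ {p q b c} → 0ℚ ≤ b → ∣ p ∣ ≤ b → ∣ q ∣ ≤ c → ∣ p * q ∣ ≤ b * c
  ∣*∣≤ {p} {q} 0≤b hp hq = subst (_≤ _) (sym (ℚ.∣p*q∣≡∣p∣*∣q∣ p q)) (*-mono (ℚ.0≤∣p∣ q) 0≤b hp hq)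

  ∣recip∣ : ∀ k → ∣ recip k ∣ ≤ recip k
  ∣recip∣ k = ℚ.≤-reflexive (ℚ.0≤p⇒∣p∣≡p (0≤recip k))

  ∣expTerm∣≤ : ∀ {q b} → 0ℚ ≤ b → ∣ q ∣ ≤ b → ∀ k → ∣ expTerm q k ∣ ≤ expTerm b k
  ∣expTerm∣≤ 0≤b h zero    = ℚ.≤-refl
  ∣expTerm∣≤ 0≤b h (suc k) = ∣*∣≤ (0≤expTerm 0≤b k) (∣expTerm∣≤ 0≤b h k) (∣*∣≤ 0≤b h (∣recip∣ k))

  -- The Lipschitz constant of expTerm _ k on [-b , b].
  dTerm : ℚ → ℕ → ℚ
  dTerm b zero    = 0ℚ
  dTerm b (suc k) = expTerm b k

  dTerm-ι : ∀ b k → dTerm b k * b ≡ expTerm b k * ι k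
  dTerm-ι b zero    = trans (ℚ.*-zeroˡ b) (sym (trans (cong (1ℚ *_) ι-0) (ℚ.*-zeroʳ 1ℚ)))
  dTerm-ι b (suc k) = sym (step-ι b k)

  0≤dTerm : ∀ {b} → 0ℚ ≤ b → ∀ k → 0ℚ ≤ dTerm b k
  0≤dTerm 0≤b zero    = ℚ.≤-refl
  0≤dTerm 0≤b (suc k) = 0≤expTerm 0≤b k

  expTerm-lip : ∀ {q r b} → 0ℚ ≤ b → ∣ q ∣ ≤ b → ∣ r ∣ ≤ b → ∀ k →
    ∣ expTerm q k - expTerm r k ∣ ≤ ∣ q - r ∣ * dTerm b k
  expTerm-lip {q} {r} 0≤b hq hr zero = ℚ.≤-reflexive (sym (ℚ.*-zeroʳ ∣ q - r ∣))
  expTerm-lip {q} {r} {b} 0≤b hq hr (suc k) = begin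
    ∣ t * (q * u) - s * (r * u) ∣
      ≡⟨ cong ∣_∣ (solve 5 (λ t s q r u →
           t :* (q :* u) :- s :* (r :* u) := ((t :- s) :* q :+ s :* (q :- r)) :* u) refl t s q r u) ⟩
    ∣ ((t - s) * q + s * (q - r)) * u ∣
      ≤⟨ ∣*∣≤ (0≤+ (0≤* (0≤* 0≤d (0≤dTerm 0≤b k)) 0≤b) (0≤* (0≤expTerm 0≤b k) 0≤d))
           (ℚ.≤-trans (ℚ.∣p+q∣≤∣p∣+∣q∣ ((t - s) * q) (s * (q - r)))
             (ℚ.+-mono-≤ (∣*∣≤ (0≤* 0≤d (0≤dTerm 0≤b k)) (expTerm-lip 0≤b hq hr k) hq)
                         (∣*∣≤ {s} {q - r} (0≤expTerm 0≤b k) (∣expTerm∣≤ 0≤b hr k) ℚ.≤-refl)))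
           (∣recip∣ k) ⟩
    (d * D * b + T * d) * u
      ≡⟨ solve 5 (λ d D b T u → (d :* D :* b :+ T :* d) :* u := d :* (D :* b :+ T) :* u) refl d D b T u ⟩
    d * (D * b + T) * u
      ≡⟨ cong (λ z → d * (z + T) * u) (dTerm-ι b k) ⟩
    d * (T * ι k + T) * u
      ≡⟨ solve 4 (λ d T i u → d :* (T :* i :+ T) :* u := d :* T :* (u :* (i :+ con 1ℚ))) refl d T (ι k) u ⟩
    d * T * (u * (ι k + 1ℚ))
      ≡⟨ cong (λ z → d * T * (u * z)) (sym (ι-suc k)) ⟩
    d * T * (u * ι (suc k))
      ≡⟨ cong (d * T *_) (recip-ι k) ⟩
    d * T * 1ℚ
      ≡⟨ ℚ.*-identityʳ (d * T) ⟩
    d * T ∎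
    where
    t = expTerm q k
    s = expTerm r k
    T = expTerm b k
    D = dTerm b k
    d = ∣ q - r ∣
    u = recip k
    0≤d : 0ℚ ≤ d
    0≤d = ℚ.0≤∣p∣ (q - r)

  dSum : ℚ → ℕ → ℚ
  dSum b zero    = 0ℚ
  dSum b (suc n) = expSum b n

  dSum-suc : ∀ b n → dSum b n + dTerm b n ≡ expSum b n
  dSum-suc b zero    = refl
  dSum-suc b (suc n) = refl

  dSum≤expSum : ∀ {b} → 0ℚ ≤ b → ∀ n → dSum b n ≤ expSum b n
  dSum≤expSum 0≤b zero    = ℚ.≤-refl
  dSum≤expSum 0≤b (suc n) = p≤p+q (0≤expTerm 0≤b n)

  expSum-lip′ : ∀ {q r b} → 0ℚ ≤ b → ∣ q ∣ ≤ b → ∣ r ∣ ≤ b → ∀ n →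
    ∣ expSum q n - expSum r n ∣ ≤ ∣ q - r ∣ * dSum b n
  expSum-lip′ {q} {r} 0≤b hq hr zero = ℚ.≤-reflexive (sym (ℚ.*-zeroʳ ∣ q - r ∣))
  expSum-lip′ {q} {r} {b} 0≤b hq hr (suc n) = begin
    ∣ (S + t) - (S′ + t′) ∣
      ≡⟨ cong ∣_∣ (solve 4 (λ a b c d → (a :+ b) :- (c :+ d) := (a :- c) :+ (b :- d)) refl S t S′ t′) ⟩
    ∣ (S - S′) + (t - t′) ∣
      ≤⟨ ℚ.∣p+q∣≤∣p∣+∣q∣ (S - S′) (t - t′) ⟩
    ∣ S - S′ ∣ + ∣ t - t′ ∣
      ≤⟨ ℚ.+-mono-≤ (expSum-lip′ 0≤b hq hr n) (expTerm-lip 0≤b hq hr n) ⟩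
    ∣ q - r ∣ * dSum b n + ∣ q - r ∣ * dTerm b n
      ≡⟨ sym (ℚ.*-distribˡ-+ ∣ q - r ∣ (dSum b n) (dTerm b n)) ⟩
    ∣ q - r ∣ * (dSum b n + dTerm b n)
      ≡⟨ cong (∣ q - r ∣ *_) (dSum-suc b n) ⟩
    ∣ q - r ∣ * expSum b n ∎
    where
    S  = expSum q n
    S′ = expSum r n
    t  = expTerm q n
    t′ = expTerm r n

  expSum-lip : ∀ {q r b} → 0ℚ ≤ b → ∣ q ∣ ≤ b → ∣ r ∣ ≤ b → ∀ n →
    ∣ expSum q n - expSum r n ∣ ≤ ∣ q - r ∣ * expSum b n
  expSum-lip {q} {r} 0≤b hq hr n =
    ℚ.≤-trans (expSum-lip′ 0≤b hq hr n) (*-monoˡ ∣ q - r ∣ (ℚ.0≤∣p∣ (q - r)) (dSum≤expSum 0≤b n))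

  expSum-tail′ : ∀ {q b} → 0ℚ ≤ b → ∣ q ∣ ≤ b → ∀ m k →
    ∣ expSum q m - expSum q (k ℕ.+ m) ∣ ≤ expSum b (k ℕ.+ m) - expSum b m
  expSum-tail′ {q} {b} 0≤b h m zero = ℚ.≤-reflexive
    (trans (∣p-p∣≡0 (expSum q m)) (sym (ℚ.+-inverseʳ (expSum b m))))
  expSum-tail′ {q} {b} 0≤b h m (suc k) = begin
    ∣ S - (S′ + t) ∣         ≡⟨ cong ∣_∣ (solve 3 (λ a b c → a :- (b :+ c) := (a :- b) :+ (:- c)) refl S S′ t) ⟩
    ∣ (S - S′) + (- t) ∣     ≤⟨ ℚ.∣p+q∣≤∣p∣+∣q∣ (S - S′) (- t) ⟩
    ∣ S - S′ ∣ + ∣ - t ∣     ≡⟨ cong (∣ S - S′ ∣ +_) (ℚ.∣-p∣≡∣p∣ t) ⟩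
    ∣ S - S′ ∣ + ∣ t ∣       ≤⟨ ℚ.+-mono-≤ (expSum-tail′ 0≤b h m k) (∣expTerm∣≤ 0≤b h (k ℕ.+ m)) ⟩
    (R′ - R) + expTerm b (k ℕ.+ m) ≡⟨ solve 3 (λ a b c → (a :- b) :+ c := (a :+ c) :- b) refl R′ R (expTerm b (k ℕ.+ m)) ⟩
    R′ + expTerm b (k ℕ.+ m) - R   ∎
    where
    S  = expSum q m
    S′ = expSum q (k ℕ.+ m)
    t  = expTerm q (k ℕ.+ m)
    R  = expSum b m
    R′ = expSum b (k ℕ.+ m)

  expSum-tail : ∀ {q b m n} → 0ℚ ≤ b → ∣ q ∣ ≤ b → m ℕ.≤ n →
    ∣ expSum q m - expSum q n ∣ ≤ expSum b n - expSum b m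
  expSum-tail {q} {b} {m} {n} 0≤b h m≤n =
    subst (λ j → ∣ expSum q m - expSum q j ∣ ≤ expSum b j - expSum b m)
      (ℕ.m∸n+n≡m m≤n) (expSum-tail′ 0≤b h m (n ℕ.∸ m))

  -- From index 2B on, consecutive terms of the series for exp B at least halve.
  halving : ∀ B k → B ℕ.+ B ℕ.≤ k → expTerm (ι B) (suc k) + expTerm (ι B) (suc k) ≤ expTerm (ι B) k
  halving B k 2B≤k = begin
    T * (b * u) + T * (b * u)   ≡⟨ solve 3 (λ T b u → T :* (b :* u) :+ T :* (b :* u) := T :* (u :* (b :+ b))) refl T b u ⟩
    T * (u * (b + b))           ≡⟨ cong (λ z → T * (u * z)) (sym (ι-+ B B)) ⟩
    T * (u * ι (B ℕ.+ B))       ≤⟨ *-monoˡ T (0≤expTerm (0≤ι B) k) (*-monoˡ u (0≤recip k) (ι-mono (ℕ.≤-trans 2B≤k (ℕ.n≤1+n k)))) ⟩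
    T * (u * ι (suc k))         ≡⟨ cong (T *_) (recip-ι k) ⟩
    T * 1ℚ                      ≡⟨ ℚ.*-identityʳ T ⟩
    T                           ∎
    where
    b = ι B
    T = expTerm b k
    u = recip k

  potential : ∀ B m k → B ℕ.+ B ℕ.≤ m → let t = expTerm (ι B) in
    expSum (ι B) (k ℕ.+ m) + (t (k ℕ.+ m) + t (k ℕ.+ m)) ≤ expSum (ι B) m + (t m + t m)
  potential B m zero    2B≤m = ℚ.≤-refl
  potential B m (suc k) 2B≤m = begin
    S + t + (t′ + t′)   ≤⟨ ℚ.+-monoʳ-≤ (S + t) (halving B (k ℕ.+ m) (ℕ.≤-trans 2B≤m (ℕ.m≤n+m m k))) ⟩
    S + t + t           ≡⟨ ℚ.+-assoc S t t ⟩
    S + (t + t)         ≤⟨ potential B m k 2B≤m ⟩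
    expSum (ι B) m + (expTerm (ι B) m + expTerm (ι B) m) ∎
    where
    S  = expSum (ι B) (k ℕ.+ m)
    t  = expTerm (ι B) (k ℕ.+ m)
    t′ = expTerm (ι B) (suc (k ℕ.+ m))

  expSum-upper : ∀ B {m n} → B ℕ.+ B ℕ.≤ m → m ℕ.≤ n → let t = expTerm (ι B) m in
    expSum (ι B) n ≤ expSum (ι B) m + (t + t)
  expSum-upper B {m} {n} 2B≤m m≤n = ℚ.≤-trans
    (p≤p+q (0≤+ (0≤expTerm (0≤ι B) n) (0≤expTerm (0≤ι B) n)))
    (subst (λ j → expSum (ι B) j + (expTerm (ι B) j + expTerm (ι B) j) ≤ expSum (ι B) m + (expTerm (ι B) m + expTerm (ι B) m))
      (ℕ.m∸n+n≡m m≤n) (potential B m (n ℕ.∸ m) 2B≤m))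

  expSum-bounded : ∀ B → ∃[ C ] ∀ n → expSum (ι B) n ≤ ι C
  expSum-bounded B with ∃ι≥ (expSum (ι B) (B ℕ.+ B) + (expTerm (ι B) (B ℕ.+ B) + expTerm (ι B) (B ℕ.+ B)))
  ... | C , h = C , f
    where
    f : ∀ n → expSum (ι B) n ≤ ι C
    f n with ℕ.≤-total (B ℕ.+ B) n
    ... | inj₁ 2B≤n = ℚ.≤-trans (expSum-upper B ℕ.≤-refl 2B≤n) h
    ... | inj₂ n≤2B = ℚ.≤-trans (expSum-mono (0≤ι B) n≤2B)
      (ℚ.≤-trans (p≤p+q (0≤+ (0≤expTerm (0≤ι B) (B ℕ.+ B)) (0≤expTerm (0≤ι B) (B ℕ.+ B)))) h)

  expTerm≤expSum : ∀ {b} → 0ℚ ≤ b → ∀ k → expTerm b k ≤ expSum b (suc k)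
  expTerm≤expSum {b} 0≤b k = subst (_≤ expSum b (suc k)) (ℚ.+-identityˡ (expTerm b k))
    (ℚ.+-monoˡ-≤ (expTerm b k) (0≤expSum 0≤b k))

  expTerm-small : ∀ B {δ} → 0ℚ < δ → Eventually λ m → expTerm (ι B) m + expTerm (ι B) m ≤ δ
  expTerm-small B {δ} 0<δ with expSum-bounded B
  ... | C , hC with archimedean (ι C * ι B + ι C * ι B) 0<δ
  ... | N , hN = suc N , f
    where
    f : ∀ m → suc N ℕ.≤ m → expTerm (ι B) m + expTerm (ι B) m ≤ δ
    f (suc k) (ℕ.s≤s N≤k) = ℚ.*-cancelʳ-≤-pos (ι (suc k)) {{positive (0<ι-suc k)}} (begin
      (t′ + t′) * ι (suc k)               ≡⟨ ℚ.*-distribʳ-+ (ι (suc k)) t′ t′ ⟩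
      t′ * ι (suc k) + t′ * ι (suc k)     ≡⟨ cong₂ _+_ (step-ι (ι B) k) (step-ι (ι B) k) ⟩
      t * ι B + t * ι B                   ≤⟨ ℚ.+-mono-≤ t*B≤ t*B≤ ⟩
      ι C * ι B + ι C * ι B               ≤⟨ hN ⟩
      δ * ι N                             ≤⟨ *-monoˡ δ (ℚ.<⇒≤ 0<δ) (ι-mono (ℕ.≤-trans N≤k (ℕ.n≤1+n k))) ⟩
      δ * ι (suc k)                       ∎)
      where
      t  = expTerm (ι B) k
      t′ = expTerm (ι B) (suc k)
      t*B≤ : t * ι B ≤ ι C * ι B
      t*B≤ = *-monoʳ (ι B) (0≤ι B) (ℚ.≤-trans (expTerm≤expSum (0≤ι B) k) (hC (suc k)))

  expSum-tail-small : ∀ B {δ} → 0ℚ < δ →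
    ∃[ N ] ∀ q m n → ∣ q ∣ ≤ ι B → N ℕ.≤ m → m ℕ.≤ n → ∣ expSum q m - expSum q n ∣ ≤ δ
  expSum-tail-small B {δ} 0<δ = let (N , h) = expTerm-small B 0<δ in
    N ℕ.⊔ (B ℕ.+ B) , λ q m n hq N≤m m≤n →
    let R = expSum (ι B) m; R′ = expSum (ι B) n; t = expTerm (ι B) m in begin
      ∣ expSum q m - expSum q n ∣   ≤⟨ expSum-tail (0≤ι B) hq m≤n ⟩
      R′ - R                        ≤⟨ ℚ.+-monoˡ-≤ (- R) (expSum-upper B (ℕ.≤-trans (ℕ.m≤n⊔m N (B ℕ.+ B)) N≤m) m≤n) ⟩
      R + (t + t) - R               ≡⟨ solve 2 (λ a b → a :+ b :- a := b) refl R (t + t) ⟩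
      t + t                         ≤⟨ h m (ℕ.≤-trans (ℕ.m≤m⊔n N (B ℕ.+ B)) N≤m) ⟩
      δ                             ∎

  exp-cauchy : ∀ x → let s = λ n → expSum (seq x n) n in
    ∀ ε → 0ℚ < ε → ∃[ N ] ∀ m n → N ℕ.≤ m → N ℕ.≤ n → ∣ s m - s n ∣ ≤ ε
  exp-cauchy x = cauchy-ordered (λ n → expSum (seq x n) n) h
    where
    h : ∀ ε → 0ℚ < ε → ∃[ N ] ∀ m n → N ℕ.≤ m → m ℕ.≤ n →
      ∣ expSum (seq x m) m - expSum (seq x n) n ∣ ≤ ε
    h ε 0<ε =
      let (B , N₁ , x≤B) = bounded x
          (C , hC)       = expSum-bounded B
          (δ , 0<δ , hδ) = shrink (suc C) 0<ε
          (N₂ , fx)      = cauchy x δ 0<δ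
          (N₃ , ft)      = expSum-tail-small B 0<δ
      in N₁ ℕ.⊔ (N₂ ℕ.⊔ N₃) , λ m n N≤m m≤n →
      let p = seq x m
          q = seq x n
          N₁≤m = ℕ.≤-trans (ℕ.m≤m⊔n N₁ (N₂ ℕ.⊔ N₃)) N≤m
          N₁≤n = ℕ.≤-trans N₁≤m m≤n
          N₂≤m = ℕ.≤-trans (ℕ.m≤m⊔n N₂ N₃) (ℕ.≤-trans (ℕ.m≤n⊔m N₁ (N₂ ℕ.⊔ N₃)) N≤m)
          N₃≤m = ℕ.≤-trans (ℕ.m≤n⊔m N₂ N₃) (ℕ.≤-trans (ℕ.m≤n⊔m N₁ (N₂ ℕ.⊔ N₃)) N≤m)
      in begin
        ∣ expSum p m - expSum q n ∣
          ≤⟨ ∣-∣-triangle (expSum p m) (expSum q m) (expSum q n) ⟩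
        ∣ expSum p m - expSum q m ∣ + ∣ expSum q m - expSum q n ∣
          ≤⟨ ℚ.+-mono-≤ (expSum-lip (0≤ι B) (x≤B m N₁≤m) (x≤B n N₁≤n) m)
                        (ft q m n (x≤B n N₁≤n) N₃≤m m≤n) ⟩
        ∣ p - q ∣ * expSum (ι B) m + δ
          ≤⟨ ℚ.+-monoˡ-≤ δ (*-mono (0≤expSum (0≤ι B) m) (ℚ.<⇒≤ 0<δ) (fx m n N₂≤m (ℕ.≤-trans N₂≤m m≤n)) (hC m)) ⟩
        δ * ι C + δ
          ≡⟨ solve 2 (λ d c → d :* c :+ d := (c :+ con 1ℚ) :* d) refl δ (ι C) ⟩
        (ι C + 1ℚ) * δ
          ≡⟨ cong (_* δ) (sym (ι-suc C)) ⟩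
        ι (suc C) * δ
          ≤⟨ hδ ⟩
        ε ∎

exp : ℝ → ℝ
exp x .seq n  = expSum (seq x n) n
exp x .cauchy = ExpLemmas.exp-cauchy x

-- ln is characterised as the inverse of exp; l is unique up to _≃ᴿ_.
_IsLnOf_ : ℝ → ℝ → Set
l IsLnOf x = exp l ≃ᴿ x

sumᴿ : List ℝ → ℝ
sumᴿ = foldr _+ᴿ_ (fromℚ 0ℚ)

IsMaximum : {A : Set} → (A → A → Set) → (A → Set) → A → Set
IsMaximum _≤_ P m = P m × (∀ x → P x → x ≤ m)

IsMinimum : {A : Set} → (A → A → Set) → (A → Set) → A → Set
IsMinimum _≤_ P m = P m × (∀ x → P x → m ≤ x)

record Graph : Set where
  field
    v          : ℕ
    adj        : Fin v → Fin v → Bool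
    adj-sym    : ∀ i j → adj i j ≡ adj j i
    adj-irrefl : ∀ i → adj i i ≡ false

-- Not necessarily induced.
record Subgraph (G : Graph) : Set where
  private module G = Graph G
  field
    vertices  : Subset G.v
    adj       : Fin G.v → Fin G.v → Bool
    adj-sym   : ∀ i j → adj i j ≡ adj j i
    adj⊆      : ∀ i j → Bool.T (adj i j) → Bool.T (G.adj i j)
    endpoints : ∀ i j → Bool.T (adj i j) → i ∈ vertices × j ∈ vertices

Independent : ∀ {n} → (Fin n → Fin n → Bool) → Subset n → Set
Independent adj I = ∀ i j → i ∈ I → j ∈ I → ¬ Bool.T (adj i j)

independent? : ∀ {n} (adj : Fin n → Fin n → Bool) (I : Subset n) → Dec (Independent adj I)
independent? adj I = Fin.all? λ i → Fin.all? λ j →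
  (i ∈? I) →-dec ((j ∈? I) →-dec ¬? (T? (adj i j)))

module _ {G : Graph} (H : Subgraph G) where
  open Subgraph H

  IsIndependenceNumber : ℕ → Set
  IsIndependenceNumber = IsMaximum ℕ._≤_ λ a →
    ∃[ I ] I ⊆ vertices × Independent adj I × Subset.∣ I ∣ ≡ a

  -- q = v(H) / α(H); the independence number of a nonempty graph is positive.
  IsRatio : ℚ → Set
  IsRatio q = ∃[ a ] IsIndependenceNumber (suc a) × q ≡ ℤ.+ Subset.∣ vertices ∣ ℚ./ suc a

IsHallRatio : Graph → ℚ → Set
IsHallRatio G = IsMaximum ℚ._≤_ λ q →
  Σ[ H ∈ Subgraph G ] Nonempty (Subgraph.vertices H) × IsRatio H q

allSubsets : ∀ n → List (Subset n)
allSubsets zero    = [] ∷ []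
allSubsets (suc n) = map (outside ∷_) (allSubsets n) ++ map (inside ∷_) (allSubsets n)

module _ (G : Graph) where
  open Graph G

  independentSets : List (Subset v)
  independentSets = filter (independent? adj) (allSubsets v)

  -- Only the values of x at independent sets matter.
  record IsFractionalColouring (x : Subset v → ℝ) : Set where
    field
      nonneg : ∀ I → Independent adj I → fromℚ 0ℚ ≤ᴿ x I
      covers : ∀ u → fromℚ 1ℚ ≤ᴿ sumᴿ (map x (filter (u ∈?_) independentSets))

  IsFractionalChromaticNumber : ℝ → Set
  IsFractionalChromaticNumber = IsMinimum _≤ᴿ_ λ t →
    Σ[ x ∈ (Subset v → ℝ) ] IsFractionalColouring x × t ≃ᴿ sumᴿ (map x independentSets)

-- The graph has vertex sets N_0 ⊂ … ⊂ N_k of sizes n_0 < … < n_k, and every vertex outside N_i picks M random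
-- neighbours in N_i.  With M large, an independent set cannot contain a proportion above 2/k of both N_i and N_j
-- for i < j, so the average over i of its proportion in N_i is at most 3/k, and by weak LP duality the fractional
-- chromatic number is at least k/3.  The ratios n_{q+1}/n_q decrease so quickly that n_{q+1}² exceeds n_q n_k by
-- a large factor; hence a set T of vertices outside N_q with |T| < 4 n_q spans fewer than 2|T| picks, by the union
-- bound.  A set S is large only compared with the N_i below some index q: it splits into few vertices of N_{q-1},
-- an independent part N_q ∖ N_{q-1}, and such a sparse set T, so it has an independent subset of size |S|/16.
-- Thus the Hall ratio is at most 16 while the fractional chromatic number is unbounded, and P₀ = 16 serves
-- whatever the real number exp((ln P)²/5) is.
module Submission where

open import Defs
open import Algebra.Bundles using (CommutativeRing)
import Algebra.Properties.CommutativeMonoid.Sum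
import Algebra.Properties.CommutativeSemiring.Exp
import Algebra.Properties.Semiring.Sum
open import Data.Bool.Base using (Bool; true; false; _∧_; _∨_; not; if_then_else_)
import Data.Bool.Properties as Bool
open import Data.Empty using (⊥)
open import Data.Fin.Base using (Fin; zero; suc; toℕ; fromℕ<)
import Data.Fin.Properties as Fin
open import Data.Fin.Subset using (Subset; ⁅_⁆; _⊆_; Nonempty; inside; outside)
import Data.Fin.Subset as Subset
open import Data.Fin.Subset.Properties using (_∈?_; _⊆?_; nonempty?; ∉⊥; ⊥⊆; x∈⁅x⁆; x∈⁅y⁆⇒x≡y)
import Data.Integer.Base as ℤ
import Data.Integer.Properties as ℤ
open import Data.List.Base using (List; []; _∷_; map; _++_; filter; concat; length; allFin)
open import Data.List.Membership.Propositional.Properties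
  using (∈-filter⁺; ∈-filter⁻; ∈-++⁺ˡ; ∈-++⁺ʳ; ∈-map⁺; ∈-map⁻; ∈-allFin)
open import Data.List.Relation.Binary.Disjoint.Propositional using (Disjoint)
open import Data.List.Relation.Unary.All as All using (All; []; _∷_)
import Data.List.Relation.Unary.All.Properties as All
open import Data.List.Relation.Unary.AllPairs using ([]; _∷_)
open import Data.List.Relation.Unary.Any using (here; there)
open import Data.List.Relation.Unary.Unique.Propositional using (Unique)
import Data.List.Relation.Unary.Unique.Propositional.Properties as Unique
open import Data.Nat.Base as ℕ using (ℕ; zero; suc; pred)
import Data.Nat.Properties as ℕ
open import Data.Nat.Tactic.RingSolver using (solve-∀)
open import Data.Product.Base using (Σ-syntax; ∃-syntax; _×_; _,_; proj₁; proj₂)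
open import Data.Rational.Base using (ℚ; _/_)
import Data.Rational.Properties as ℚ
import Data.Rational.Solver as ℚSolver
import Data.Rational.Unnormalised.Base as ℚᵘ
import Data.Rational.Unnormalised.Properties as ℚᵘ
open import Data.Sum.Base as Sum using (_⊎_; inj₁; inj₂)
open import Data.Vec.Base using (Vec; []; _∷_; lookup; tabulate)
import Data.Vec.Properties as Vec
open import Function.Base using (_∘_; flip; case_of_)
open import Function.Bundles using (module Equivalence)
open import Relation.Binary.Definitions using (DecidableEquality; Reflexive; Transitive; Total; Tri; tri<; tri≈; tri>)
open import Relation.Binary.PropositionalEquality hiding (J)
open import Relation.Nullary using (Dec; does; yes; no; contradiction; ¬_)
open import Relation.Nullary.Decidable using (_×-dec_; _→-dec_; dec-true; dec-false)
open import Relation.Unary using (Decidable)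

-- The constant 16 is 2 · 2 · 4: in the worse case only half of the set is the sparse part `T`, at
-- least half of `T` has fewer than four picks inside `T`, and these vertices need four colours. Two
-- picks per vertex is the threshold at which the union bound works. A set of t vertices makes 2t
-- picks into itself with probability at most about (t / n_{q+1})^(2t), up to a factor 2^(kMt). One
-- power t^t cancels against the number of such sets, at most (4 n_k / t)^t, and leaves a constant
-- times n_k t / n_{q+1}², to the power t. For t < 4 n_q this asks that n_{q+1}² exceed a constant
-- times n_q n_k. With n_i = c^(e_i) the condition is 2 e_{q+1} ≥ 1 + e_q + e_k, and e_i = 2^k -
-- 2^(k-i) solves it with equality. The fractional chromatic number has to be exhibited as an
-- attained minimum over real colourings, while the order on Cauchy sequences is not decidable.
-- Hence the linear program is solved over the rationals, by an elimination that tolerates errors: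
-- the terms of a real colouring are feasible only up to ε.

-- Finite sums and products of rationals.

module FiniteSums where
  open RationalLemmas
  open import Data.Rational.Base hiding (∣_∣)
  open import Data.List.Membership.Propositional using (_∈_)
  open ℚSolver.+-*-Solver using (solve; con; _:+_; _:*_; _:=_)
  open ℚ.≤-Reasoning
  open CommutativeRing ℚ.+-*-commutativeRing using (semiring; commutativeSemiring)
  open Algebra.Properties.Semiring.Sum semiring public
    using (sum; sum-cong-≗; ∑-distrib-+; ∑-comm; *-distribˡ-sum; sum-replicate-zero)
  open Algebra.Properties.CommutativeMonoid.Sum ℚ.*-1-commutativeMonoid public
    using () renaming (sum to prod; sum-cong-≗ to prod-cong-≗)
  open Algebra.Properties.CommutativeSemiring.Exp commutativeSemiring public
    using (_^_; ^-homo-*; ^-assocʳ; ^-distrib-*)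

  𝟙 : Bool → ℚ
  𝟙 b = if b then 1ℚ else 0ℚ

  0≤𝟙 : ∀ b → 0ℚ ≤ 𝟙 b
  0≤𝟙 false = ℚ.≤-refl
  0≤𝟙 true  = 0≤1

  sum-mono : ∀ {n} {f g : Fin n → ℚ} → (∀ i → f i ≤ g i) → sum f ≤ sum g
  sum-mono {zero}  h = ℚ.≤-refl
  sum-mono {suc n} h = ℚ.+-mono-≤ (h zero) (sum-mono (h ∘ suc))

  0≤sum : ∀ {n} {f : Fin n → ℚ} → (∀ i → 0ℚ ≤ f i) → 0ℚ ≤ sum f
  0≤sum {zero}  h = ℚ.≤-refl
  0≤sum {suc n} h = 0≤+ (h zero) (0≤sum (h ∘ suc))

  term≤sum : ∀ {n} {f : Fin n → ℚ} → (∀ i → 0ℚ ≤ f i) → ∀ i → f i ≤ sum f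
  term≤sum h zero    = p≤p+q (0≤sum (h ∘ suc))
  term≤sum {f = f} h (suc i) = ℚ.≤-trans (term≤sum (h ∘ suc) i)
    (subst (_≤ sum f) (ℚ.+-identityˡ _) (ℚ.+-monoˡ-≤ _ (h zero)))

  sum-const : ∀ n x → sum {n} (λ _ → x) ≡ ι n * x
  sum-const zero    x = sym (trans (cong (_* x) ι-0) (ℚ.*-zeroˡ x))
  sum-const (suc n) x = trans (cong (x +_) (sum-const n x))
    (trans (solve 2 (λ x i → x :+ i :* x := (i :+ con 1ℚ) :* x) refl x (ι n)) (cong (_* x) (sym (ι-suc n))))

  0≤prod : ∀ {n} {f : Fin n → ℚ} → (∀ i → 0ℚ ≤ f i) → 0ℚ ≤ prod f
  0≤prod {zero}  h = 0≤1
  0≤prod {suc n} h = 0≤* (h zero) (0≤prod (h ∘ suc))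

  prod-mono : ∀ {n} {f g : Fin n → ℚ} → (∀ i → 0ℚ ≤ f i) → (∀ i → f i ≤ g i) → prod f ≤ prod g
  prod-mono {zero}  0≤f h = ℚ.≤-refl
  prod-mono {suc n} 0≤f h = *-mono (0≤prod (0≤f ∘ suc)) (ℚ.≤-trans (0≤f zero) (h zero)) (h zero) (prod-mono (0≤f ∘ suc) (h ∘ suc))

  ∑ : ∀ {A : Set} → List A → (A → ℚ) → ℚ
  ∑ []       f = 0ℚ
  ∑ (x ∷ xs) f = f x + ∑ xs f

  module _ {A : Set} where

    ∑-cong : ∀ (xs : List A) {f g} → (∀ x → f x ≡ g x) → ∑ xs f ≡ ∑ xs g
    ∑-cong []       h = refl
    ∑-cong (x ∷ xs) h = cong₂ _+_ (h x) (∑-cong xs h)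

    ∑-mono : ∀ (xs : List A) {f g} → (∀ {x} → x ∈ xs → f x ≤ g x) → ∑ xs f ≤ ∑ xs g
    ∑-mono []       h = ℚ.≤-refl
    ∑-mono (x ∷ xs) h = ℚ.+-mono-≤ (h (here refl)) (∑-mono xs (h ∘ there))

    0≤∑ : ∀ (xs : List A) {f} → (∀ {x} → x ∈ xs → 0ℚ ≤ f x) → 0ℚ ≤ ∑ xs f
    0≤∑ []       h = ℚ.≤-refl
    0≤∑ (x ∷ xs) h = 0≤+ (h (here refl)) (0≤∑ xs (h ∘ there))

    term≤∑ : ∀ {xs : List A} {f} → (∀ {x} → x ∈ xs → 0ℚ ≤ f x) → ∀ {x} → x ∈ xs → f x ≤ ∑ xs f
    term≤∑ {y ∷ xs} h (here refl) = p≤p+q (0≤∑ xs (h ∘ there))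
    term≤∑ {y ∷ xs} {f} h (there x∈) = ℚ.≤-trans (term≤∑ (h ∘ there) x∈)
      (subst (_≤ f y + ∑ xs f) (ℚ.+-identityˡ _) (ℚ.+-monoˡ-≤ _ (h (here refl))))

    ∑-distrib-* : ∀ (xs : List A) c f → ∑ xs (λ x → c * f x) ≡ c * ∑ xs f
    ∑-distrib-* []       c f = sym (ℚ.*-zeroʳ c)
    ∑-distrib-* (x ∷ xs) c f = trans (cong (c * f x +_) (∑-distrib-* xs c f)) (sym (ℚ.*-distribˡ-+ c (f x) (∑ xs f)))

    ∑-++ : ∀ (xs ys : List A) f → ∑ (xs ++ ys) f ≡ ∑ xs f + ∑ ys f
    ∑-++ []       ys f = sym (ℚ.+-identityˡ _)
    ∑-++ (x ∷ xs) ys f = trans (cong (f x +_) (∑-++ xs ys f)) (sym (ℚ.+-assoc (f x) (∑ xs f) (∑ ys f)))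

    ∑-map : ∀ {B : Set} (g : B → A) xs f → ∑ (map g xs) f ≡ ∑ xs (f ∘ g)
    ∑-map g []       f = refl
    ∑-map g (x ∷ xs) f = cong (f (g x) +_) (∑-map g xs f)

    ∑-filter : ∀ {P : A → Set} (P? : Decidable P) xs f → ∑ (filter P? xs) f ≡ ∑ xs (λ x → 𝟙 (does (P? x)) * f x)
    ∑-filter P? []       f = refl
    ∑-filter P? (x ∷ xs) f with P? x
    ... | yes _ = cong₂ _+_ (sym (ℚ.*-identityˡ (f x))) (∑-filter P? xs f)
    ... | no _  = trans (∑-filter P? xs f) (trans (sym (ℚ.+-identityˡ _)) (cong (_+ _) (sym (ℚ.*-zeroˡ (f x)))))

    ∑-sum-comm : ∀ {n} (xs : List A) (f : A → Fin n → ℚ) →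
                 ∑ xs (λ x → sum (f x)) ≡ sum (λ i → ∑ xs (λ x → f x i))
    ∑-sum-comm {n} []       f = sym (sum-replicate-zero n)
    ∑-sum-comm     (x ∷ xs) f = trans (cong (sum (f x) +_) (∑-sum-comm xs f))
      (sym (∑-distrib-+ (f x) (λ i → ∑ xs (λ x → f x i))))

-- Linear programming over the rationals by Fourier-Motzkin elimination.

module FourierMotzkin where
  open RationalLemmas
  open import Data.Rational.Base hiding (∣_∣)
  open import Data.List.Membership.Propositional using (_∈_)
  open ℚSolver.+-*-Solver using (solve; con; _:+_; _:*_; :-_; _:-_; _:=_)
  open ℚ.≤-Reasoning
  open FiniteSums

  opaque
    -- Total, with the default value 0 at 0, so that bounds can be written down for every constraint
    -- before the sign of its coefficient is known.
    inv : ℚ → ℚ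
    inv q with q ℚ.≟ 0ℚ
    ... | yes _  = 0ℚ
    ... | no q≢0 = (1/ q) {{≢-nonZero q≢0}}

    *-inv : ∀ {q} → 0ℚ < q → q * inv q ≡ 1ℚ
    *-inv {q} 0<q with q ℚ.≟ 0ℚ
    ... | yes q≡0 = contradiction (sym q≡0) (ℚ.<⇒≢ 0<q)
    ... | no q≢0  = ℚ.*-inverseʳ q {{≢-nonZero q≢0}}

  0≤inv : ∀ {q} → 0ℚ < q → 0ℚ ≤ inv q
  0≤inv {q} 0<q = ℚ.≮⇒≥ λ inv<0 → ℚ.<⇒≢ (begin-strict
    1ℚ          ≡⟨ sym (*-inv 0<q) ⟩
    q * inv q   <⟨ ℚ.*-monoʳ-<-pos q {{positive 0<q}} inv<0 ⟩
    q * 0ℚ      ≡⟨ ℚ.*-zeroʳ q ⟩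
    0ℚ          ≤⟨ 0≤1 ⟩
    1ℚ          ∎) refl

  0≤-neg : ∀ {q} → q ≤ 0ℚ → 0ℚ ≤ - q
  0≤-neg = ℚ.neg-antimono-≤

  -- `- (v * inv a)` is the root of the increasing function `a * x + v` of `x`.
  lower-bound⇒ : ∀ {a x} v → 0ℚ < a → - (v * inv a) ≤ x → 0ℚ ≤ a * x + v
  lower-bound⇒ {a} {x} v 0<a h = begin
    0ℚ                      ≡⟨ solve 1 (λ v → con 0ℚ := :- (v :* con 1ℚ) :+ v) refl v ⟩
    - (v * 1ℚ) + v          ≡⟨ cong (λ u → - (v * u) + v) (sym (*-inv 0<a)) ⟩
    - (v * (a * inv a)) + v ≡⟨ solve 3 (λ a i v → :- (v :* (a :* i)) :+ v := a :* (:- (v :* i)) :+ v) refl a (inv a) v ⟩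
    a * - (v * inv a) + v   ≤⟨ ℚ.+-monoˡ-≤ v (*-monoˡ a (ℚ.<⇒≤ 0<a) h) ⟩
    a * x + v               ∎

  upper-bound⇒ : ∀ {a x} v → a < 0ℚ → x ≤ v * inv (- a) → 0ℚ ≤ a * x + v
  upper-bound⇒ {a} {x} v a<0 h = subst (0ℚ ≤_)
    (solve 3 (λ a x v → :- a :* :- x :+ v := a :* x :+ v) refl a x v)
    (lower-bound⇒ v (ℚ.neg-antimono-< a<0) (ℚ.neg-antimono-≤ h))

  -- The witness is the largest of the lower bounds and of the minimum of 0 and the upper bounds; 0
  -- is a default for two empty lists.
  between : ∀ {A : Set} (f g : A → ℚ) ps ns → All (λ p → All (λ n → f p ≤ g n) ns) ps →
            ∃[ x ] All (λ p → f p ≤ x) ps × All (λ n → x ≤ g n) ns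
  between f g []       []       h = 0ℚ , [] , []
  between f g []       (n ∷ ns) h with between f g [] ns []
  ... | x , _ , x≤ = x ⊓ g n , [] , ℚ.p⊓q≤q x (g n) ∷ All.map (ℚ.≤-trans (ℚ.p⊓q≤p x (g n))) x≤
  between f g (p ∷ ps) ns (h ∷ hs) with between f g ps ns hs
  ... | x , ≤x , x≤ = x ⊔ f p
    , ℚ.p≤q⊔p x (f p) ∷ All.map (λ q → ℚ.≤-trans q (ℚ.p≤p⊔q x (f p))) ≤x
    , All.zipWith (λ (a , b) → ℚ.⊔-lub a b) (x≤ , h)

  module LinearProgramming {K : Set} (_≟_ : DecidableEquality K) where

    infix 9 _[_↦_]

    -- The inequality 0 ≤ Σ_k coef k * X k + slope * t + const in the unknowns X and t.
    record Constraint : Set where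
      constructor constraint
      field
        coef  : K → ℚ
        slope : ℚ
        const : ℚ
    open Constraint

    value : List K → (K → ℚ) → ℚ → Constraint → ℚ
    value ks X t c = ∑ ks (λ k → coef c k * X k) + (slope c * t + const c)

    Sat : ℚ → List K → List Constraint → (K → ℚ) → ℚ → Set
    Sat ε ks cs X t = All (λ c → - ε ≤ value ks X t c) cs

    -- The entailment tolerates an error ε, so that it applies to the terms of Cauchy sequences, which satisfy
    -- real inequalities only approximately.
    infix 4 _⊩_⇒_⊩_

    record _⊩_⇒_⊩_ (ks : List K) (cs : List Constraint) (ks′ : List K) (cs′ : List Constraint) : Set where
      constructor entails
      field
        κ     : ℚ
        0≤κ   : 0ℚ ≤ κ
        sound : ∀ ε X t → 0ℚ ≤ ε → Sat ε ks cs X t → Sat (κ * ε) ks′ cs′ X t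

    ⇒-trans : ∀ {ks₁ ks₂ ks₃ cs₁ cs₂ cs₃} →
              ks₁ ⊩ cs₁ ⇒ ks₂ ⊩ cs₂ → ks₂ ⊩ cs₂ ⇒ ks₃ ⊩ cs₃ → ks₁ ⊩ cs₁ ⇒ ks₃ ⊩ cs₃
    ⇒-trans {ks₃ = ks₃} {cs₃ = cs₃} (entails κ 0≤κ f) (entails κ′ 0≤κ′ g) = entails (κ′ * κ) (0≤* 0≤κ′ 0≤κ) λ ε X t 0≤ε s →
      subst (λ e → Sat e ks₃ cs₃ X t) (sym (ℚ.*-assoc κ′ κ ε)) (g (κ * ε) X t (0≤* 0≤κ 0≤ε) (f ε X t 0≤ε s))

    weaken : ∀ {ε δ} ks X t {cs} → ε ≤ δ → Sat ε ks cs X t → Sat δ ks cs X t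
    weaken ks X t ε≤δ = All.map (ℚ.≤-trans (ℚ.neg-antimono-≤ ε≤δ))

    ⇒-∷ : ∀ {ks cs} ks′ {c cs′} → ks ⊩ cs ⇒ ks′ ⊩ (c ∷ []) → ks ⊩ cs ⇒ ks′ ⊩ cs′ → ks ⊩ cs ⇒ ks′ ⊩ (c ∷ cs′)
    ⇒-∷ ks′ (entails κ 0≤κ f) (entails κ′ 0≤κ′ g) = entails (κ ⊔ κ′) (ℚ.≤-trans 0≤κ (ℚ.p≤p⊔q κ κ′)) λ ε X t 0≤ε s →
      All.head (weaken ks′ X t (*-monoʳ ε 0≤ε (ℚ.p≤p⊔q κ κ′)) (f ε X t 0≤ε s)) ∷
      weaken ks′ X t (*-monoʳ ε 0≤ε (ℚ.p≤q⊔p κ κ′)) (g ε X t 0≤ε s)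

    ⇒-All : ∀ {ks cs ks′} cs′ → All (λ c → ks ⊩ cs ⇒ ks′ ⊩ (c ∷ [])) cs′ → ks ⊩ cs ⇒ ks′ ⊩ cs′
    ⇒-All []        []       = entails 0ℚ ℚ.≤-refl λ _ _ _ _ _ → []
    ⇒-All (c ∷ cs′) (h ∷ hs) = ⇒-∷ _ h (⇒-All cs′ hs)

    _[_↦_] : (K → ℚ) → K → ℚ → K → ℚ
    (X [ k ↦ x ]) j = if does (j ≟ k) then x else X j

    update-here : ∀ X k x → (X [ k ↦ x ]) k ≡ x
    update-here X k x with k ≟ k
    ... | yes _  = refl
    ... | no k≢k = contradiction refl k≢k

    ∑-update : ∀ (f : K → ℚ) X k x ks → All (k ≢_) ks →
               ∑ ks (λ j → f j * (X [ k ↦ x ]) j) ≡ ∑ ks (λ j → f j * X j)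
    ∑-update f X k x []       []       = refl
    ∑-update f X k x (j ∷ ks) (h ∷ hs) with j ≟ k
    ... | yes j≡k = contradiction (sym j≡k) h
    ... | no _    = cong (f j * X j +_) (∑-update f X k x ks hs)

    value-∷ : ∀ k ks X t c → value (k ∷ ks) X t c ≡ coef c k * X k + value ks X t c
    value-∷ k ks X t c = ℚ.+-assoc (coef c k * X k) (∑ ks (λ j → coef c j * X j)) (slope c * t + const c)

    value-update : ∀ {k ks} → All (k ≢_) ks → ∀ X x t c →
                   value (k ∷ ks) (X [ k ↦ x ]) t c ≡ coef c k * x + value ks X t c
    value-update {k} {ks} k∉ X x t c = trans (value-∷ k ks (X [ k ↦ x ]) t c) (cong₂ _+_
      (cong (coef c k *_) (update-here X k x))
      (cong (_+ (slope c * t + const c)) (∑-update (coef c) X k x ks k∉)))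

    -- The weights cancel the coefficient of `k`. They are positive when `p` bounds the unknown from
    -- below and `n` from above.
    combine : K → Constraint → Constraint → Constraint
    combine k p n = constraint (λ j → - coef n k * coef p j + coef p k * coef n j)
      (- coef n k * slope p + coef p k * slope n) (- coef n k * const p + coef p k * const n)

    ∑-combine : ∀ a b (f g X : K → ℚ) ks →
                ∑ ks (λ j → (a * f j + b * g j) * X j) ≡ a * ∑ ks (λ j → f j * X j) + b * ∑ ks (λ j → g j * X j)
    ∑-combine a b f g X []       = solve 2 (λ a b → con 0ℚ := a :* con 0ℚ :+ b :* con 0ℚ) refl a b
    ∑-combine a b f g X (k ∷ ks) = trans (cong ((a * f k + b * g k) * X k +_) (∑-combine a b f g X ks))
      (solve 7 (λ a b f g x F G → (a :* f :+ b :* g) :* x :+ (a :* F :+ b :* G) := a :* (f :* x :+ F) :+ b :* (g :* x :+ G))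
        refl a b (f k) (g k) (X k) (∑ ks (λ j → f j * X j)) (∑ ks (λ j → g j * X j)))

    value-combine : ∀ k ks X t p n →
                    value ks X t (combine k p n) ≡ - coef n k * value ks X t p + coef p k * value ks X t n
    value-combine k ks X t p n = trans (cong (_+ _) (∑-combine (- coef n k) (coef p k) (coef p) (coef n) X ks))
      (solve 9 (λ a b P N s s′ t c c′ →
          a :* P :+ b :* N :+ ((a :* s :+ b :* s′) :* t :+ (a :* c :+ b :* c′))
        := a :* (P :+ (s :* t :+ c)) :+ b :* (N :+ (s′ :* t :+ c′)))
        refl (- coef n k) (coef p k) (∑ ks (λ j → coef p j * X j)) (∑ ks (λ j → coef n j * X j))
             (slope p) (slope n) t (const p) (const n))

    value-combine-∷ : ∀ k ks X t p n → value ks X t (combine k p n) ≡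
                      - coef n k * value (k ∷ ks) X t p + coef p k * value (k ∷ ks) X t n
    value-combine-∷ k ks X t p n = trans (value-combine k ks X t p n) (sym (trans
      (cong₂ (λ u v → - coef n k * u + coef p k * v) (value-∷ k ks X t p) (value-∷ k ks X t n))
      (solve 5 (λ n p x V W → :- n :* (p :* x :+ V) :+ p :* (n :* x :+ W) := :- n :* V :+ p :* W)
        refl (coef n k) (coef p k) (X k) (value ks X t p) (value ks X t n))))

    zeros positives negatives : K → List Constraint → List Constraint
    zeros     k = filter (λ c → coef c k ℚ.≟ 0ℚ)
    positives k = filter (λ c → 0ℚ ℚ.<? coef c k)
    negatives k = filter (λ c → coef c k ℚ.<? 0ℚ)

    eliminate : K → List Constraint → List Constraint
    eliminate k cs = zeros k cs ++ concat (map (λ p → map (combine k p) (negatives k cs)) (positives k cs))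

    -- Every new inequality is a nonnegative combination of old ones, so an error `ε` grows at most
    -- by the total weight; finitely many inequalities have a common factor.
    eliminate-sound : ∀ k ks cs → (k ∷ ks) ⊩ cs ⇒ ks ⊩ eliminate k cs
    eliminate-sound k ks cs = ⇒-All (eliminate k cs) (All.++⁺ (All.tabulate zero-sound)
      (All.concat⁺ (All.map⁺ (All.tabulate λ p∈ → All.map⁺ (All.tabulate λ n∈ → pair-sound p∈ n∈)))))
      where
      zero-sound : ∀ {c} → c ∈ zeros k cs → (k ∷ ks) ⊩ cs ⇒ ks ⊩ (c ∷ [])
      zero-sound {c} c∈ with ∈-filter⁻ (λ c → coef c k ℚ.≟ 0ℚ) {xs = cs} c∈
      ... | c∈cs , eq = entails 1ℚ 0≤1 λ ε X t _ s → subst₂ _≤_ (cong -_ (sym (ℚ.*-identityˡ ε)))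
        (begin-equality
          value (k ∷ ks) X t c              ≡⟨ value-∷ k ks X t c ⟩
          coef c k * X k + value ks X t c   ≡⟨ cong (λ a → a * X k + value ks X t c) eq ⟩
          0ℚ * X k + value ks X t c         ≡⟨ solve 2 (λ x V → con 0ℚ :* x :+ V := V) refl (X k) (value ks X t c) ⟩
          value ks X t c                    ∎)
        (All.lookup s c∈cs) ∷ []
      pair-sound : ∀ {p n} → p ∈ positives k cs → n ∈ negatives k cs → (k ∷ ks) ⊩ cs ⇒ ks ⊩ (combine k p n ∷ [])
      pair-sound {p} {n} p∈ n∈
        with ∈-filter⁻ (λ c → 0ℚ ℚ.<? coef c k) {xs = cs} p∈ | ∈-filter⁻ (λ c → coef c k ℚ.<? 0ℚ) {xs = cs} n∈
      ... | p∈cs , 0<p | n∈cs , n<0 = entails (- coef n k + coef p k) (0≤+ 0≤-n (ℚ.<⇒≤ 0<p)) λ ε X t _ s → (begin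
        - ((- coef n k + coef p k) * ε)
          ≡⟨ solve 3 (λ a b e → :- ((a :+ b) :* e) := a :* (:- e) :+ b :* (:- e)) refl (- coef n k) (coef p k) ε ⟩
        - coef n k * (- ε) + coef p k * (- ε)
          ≤⟨ ℚ.+-mono-≤ (*-monoˡ (- coef n k) 0≤-n (All.lookup s p∈cs)) (*-monoˡ (coef p k) (ℚ.<⇒≤ 0<p) (All.lookup s n∈cs)) ⟩
        - coef n k * value (k ∷ ks) X t p + coef p k * value (k ∷ ks) X t n
          ≡⟨ sym (value-combine-∷ k ks X t p n) ⟩
        value ks X t (combine k p n) ∎) ∷ []
        where
        0≤-n : 0ℚ ≤ - coef n k
        0≤-n = 0≤-neg (ℚ.<⇒≤ n<0)

    -- Stated for error 0 because this direction produces the optimal solution, whereas soundness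
    -- compares it with approximate competitors. A value for `k` exists because each combined
    -- inequality says that one lower bound is at most one upper bound.
    eliminate-complete : ∀ {k ks} → All (k ≢_) ks → ∀ cs X t → Sat 0ℚ ks (eliminate k cs) X t →
                         ∃[ X′ ] Sat 0ℚ (k ∷ ks) cs X′ t
    eliminate-complete {k} {ks} k∉ cs X t s = X [ k ↦ x ] , All.tabulate λ {c} c∈ →
      subst (0ℚ ≤_) (sym (value-update k∉ X x t c)) (holds c c∈ (ℚ.<-cmp (coef c k) 0ℚ))
      where
      V = value ks X t
      bounds : ∀ {p n} → p ∈ positives k cs → n ∈ negatives k cs → 0ℚ ≤ V (combine k p n) →
               - (V p * inv (coef p k)) ≤ V n * inv (- coef n k)
      bounds {p} {n} p∈ n∈ h = ≤-from-diff (begin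
        0ℚ                                    ≤⟨ 0≤* (0≤* (0≤inv 0<p) (0≤inv 0<-n)) h ⟩
        i * j * V (combine k p n)             ≡⟨ cong (i * j *_) (value-combine k ks X t p n) ⟩
        i * j * (b * V p + a * V n)           ≡⟨ solve 6 (λ i j a b P N → i :* j :* (b :* P :+ a :* N)
                                                   := (b :* j) :* (i :* P) :+ (a :* i) :* (j :* N)) refl i j a b (V p) (V n) ⟩
        (b * j) * (i * V p) + (a * i) * (j * V n) ≡⟨ cong₂ (λ u v → u * (i * V p) + v * (j * V n)) (*-inv 0<-n) (*-inv 0<p) ⟩
        1ℚ * (i * V p) + 1ℚ * (j * V n)       ≡⟨ solve 4 (λ i j P N → con 1ℚ :* (i :* P) :+ con 1ℚ :* (j :* N)
                                                   := N :* j :- (:- (P :* i))) refl i j (V p) (V n) ⟩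
        V n * j - (- (V p * i))               ∎)
        where
        a = coef p k
        b = - coef n k
        i = inv a
        j = inv b
        0<p : 0ℚ < a
        0<p = proj₂ (∈-filter⁻ (λ c → 0ℚ ℚ.<? coef c k) {xs = cs} p∈)
        0<-n : 0ℚ < b
        0<-n = ℚ.neg-antimono-< (proj₂ (∈-filter⁻ (λ c → coef c k ℚ.<? 0ℚ) {xs = cs} n∈))
      s₀ = All.++⁻ˡ (zeros k cs) s
      s₁ = All.++⁻ʳ (zeros k cs) s
      solution = between (λ p → - (V p * inv (coef p k))) (λ n → V n * inv (- coef n k)) (positives k cs) (negatives k cs)
        (All.tabulate λ p∈ → All.tabulate λ n∈ →
          bounds p∈ n∈ (All.lookup (All.map⁻ (All.lookup (All.map⁻ (All.concat⁻ s₁)) p∈)) n∈))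
      x     = proj₁ solution
      lower = proj₁ (proj₂ solution)
      upper = proj₂ (proj₂ solution)
      holds : ∀ c → c ∈ cs → Tri (coef c k < 0ℚ) (coef c k ≡ 0ℚ) (0ℚ < coef c k) → 0ℚ ≤ coef c k * x + V c
      holds c c∈ (tri≈ _ eq _) = subst (0ℚ ≤_)
        (trans (solve 2 (λ x V → V := con 0ℚ :* x :+ V) refl x (V c)) (cong (λ a → a * x + V c) (sym eq)))
        (All.lookup s₀ (∈-filter⁺ (λ c → coef c k ℚ.≟ 0ℚ) c∈ eq))
      holds c c∈ (tri> _ _ 0<a) = lower-bound⇒ (V c) 0<a (All.lookup lower (∈-filter⁺ (λ c → 0ℚ ℚ.<? coef c k) c∈ 0<a))
      holds c c∈ (tri< a<0 _ _) = upper-bound⇒ (V c) a<0 (All.lookup upper (∈-filter⁺ (λ c → coef c k ℚ.<? 0ℚ) c∈ a<0))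

    -- The objective `t` is the one unknown that stays, so the result describes the attainable
    -- values of `t` by inequalities in `t` alone.
    project : ∀ ks → Unique ks → ∀ cs → ∃[ cs′ ]
              (∀ X t → Sat 0ℚ [] cs′ X t → ∃[ X′ ] Sat 0ℚ ks cs X′ t) × ks ⊩ cs ⇒ [] ⊩ cs′
    project []       []        cs = cs , (λ X t s → X , s) , entails 1ℚ 0≤1 λ ε X t _ →
      subst (λ e → Sat e [] cs X t) (sym (ℚ.*-identityˡ ε))
    project (k ∷ ks) (k∉ ∷ ks!) cs with project ks ks! (eliminate k cs)
    ... | cs′ , complete , sound = cs′
      , (λ X t s → let (X₁ , s₁) = complete X t s in eliminate-complete k∉ cs X₁ t s₁)
      , ⇒-trans (eliminate-sound k ks cs) sound

    -- The inequality 0 ≤ t. It bounds the objective from below even when no projected inequality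
    -- has positive slope.
    nonnegative : Constraint
    nonnegative = constraint (λ _ → 0ℚ) 1ℚ 0ℚ

    IsLowerBound : List Constraint → ℚ → ℚ → Set
    IsLowerBound cs t₀ κ = ∀ ε X t → 0ℚ ≤ ε → Sat ε [] (nonnegative ∷ cs) X t → t₀ ≤ t + κ * ε

    -- Only inequalities of positive slope bound `t` from below, so `t₀` is the maximum of 0 and
    -- their roots. An error `ε` moves a root by `ε` divided by the slope; `κ` is the maximum of 1
    -- and the reciprocal slopes.
    least : ∀ cs → ∃[ t₀ ] All (λ c → 0ℚ < slope c → 0ℚ ≤ slope c * t₀ + const c) cs ×
            ∃[ κ ] IsLowerBound cs t₀ κ
    least [] = 0ℚ , [] , 1ℚ , λ { ε X t _ (h ∷ []) → begin
      0ℚ                              ≡⟨ solve 1 (λ e → con 0ℚ := :- e :+ con 1ℚ :* e) refl ε ⟩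
      - ε + 1ℚ * ε                    ≤⟨ ℚ.+-monoˡ-≤ (1ℚ * ε) h ⟩
      0ℚ + (1ℚ * t + 0ℚ) + 1ℚ * ε     ≡⟨ solve 2 (λ t e → con 0ℚ :+ (con 1ℚ :* t :+ con 0ℚ) :+ con 1ℚ :* e := t :+ con 1ℚ :* e) refl t ε ⟩
      t + 1ℚ * ε                      ∎ }
    least (c ∷ cs) = extend (0ℚ ℚ.<? slope c) (least cs)
      where
      extend : Dec (0ℚ < slope c) →
        (∃[ t₀ ] All (λ c → 0ℚ < slope c → 0ℚ ≤ slope c * t₀ + const c) cs × ∃[ κ ] IsLowerBound cs t₀ κ) →
        ∃[ t₀ ] All (λ c → 0ℚ < slope c → 0ℚ ≤ slope c * t₀ + const c) (c ∷ cs) × ∃[ κ ] IsLowerBound (c ∷ cs) t₀ κ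
      extend (no ¬0<s) (t₀ , hs , κ , lb) =
        t₀ , (λ 0<s → contradiction 0<s ¬0<s) ∷ hs , κ , λ { ε X t 0≤ε (h₀ ∷ _ ∷ h) → lb ε X t 0≤ε (h₀ ∷ h) }
      extend (yes 0<s) (t₀ , hs , κ , lb) = t₀ ⊔ u
        , (λ _ → lower-bound⇒ (const c) 0<s (ℚ.p≤q⊔p t₀ u))
        ∷ All.map (λ {d} g 0<d → ℚ.≤-trans (g 0<d) (ℚ.+-monoˡ-≤ (const d) (*-monoˡ (slope d) (ℚ.<⇒≤ 0<d) (ℚ.p≤p⊔q t₀ u)))) hs
        , κ ⊔ i , λ { ε X t 0≤ε (h₀ ∷ h ∷ hs) → ℚ.⊔-lub
          (ℚ.≤-trans (lb ε X t 0≤ε (h₀ ∷ hs)) (ℚ.+-monoʳ-≤ t (*-monoʳ ε 0≤ε (ℚ.p≤p⊔q κ i))))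
          (ℚ.≤-trans (u≤ ε t h) (ℚ.+-monoʳ-≤ t (*-monoʳ ε 0≤ε (ℚ.p≤q⊔p κ i)))) }
        where
        i = inv (slope c)
        u = - (const c * i)
        u≤ : ∀ ε t → - ε ≤ 0ℚ + (slope c * t + const c) → u ≤ t + i * ε
        u≤ ε t h = begin
          - (const c * i)
            ≡⟨ solve 3 (λ k i e → :- (k :* i) := i :* (:- e) :+ (:- (k :* i) :+ i :* e)) refl (const c) i ε ⟩
          i * (- ε) + (- (const c * i) + i * ε)
            ≤⟨ ℚ.+-monoˡ-≤ (- (const c * i) + i * ε) (*-monoˡ i (0≤inv 0<s) h) ⟩
          i * (0ℚ + (slope c * t + const c)) + (- (const c * i) + i * ε)
            ≡⟨ solve 5 (λ i s t k e → i :* (con 0ℚ :+ (s :* t :+ k)) :+ (:- (k :* i) :+ i :* e) := s :* i :* t :+ i :* e)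
                 refl i (slope c) t (const c) ε ⟩
          slope c * i * t + i * ε
            ≡⟨ cong (λ a → a * t + i * ε) (*-inv 0<s) ⟩
          1ℚ * t + i * ε
            ≡⟨ cong (_+ i * ε) (ℚ.*-identityˡ t) ⟩
          t + i * ε ∎

    minimum : ∀ ks → Unique ks → ∀ cs X₀ t₀ → Sat 0ℚ ks cs X₀ t₀ → ks ⊩ cs ⇒ [] ⊩ (nonnegative ∷ []) →
              ∃[ X ] ∃[ t ] Sat 0ℚ ks cs X t ×
              ∃[ κ ] (∀ ε Y u → 0ℚ ≤ ε → Sat ε ks cs Y u → t ≤ u + κ * ε)
    minimum ks ks! cs X₀ t₀ s₀ bounded =
      let (X , s) = complete X₀ t (All.tabulate (λ {c} c∈ → holds c c∈))
      in X , t , s , κ * κ′ , λ ε Y u 0≤ε s → subst (λ z → t ≤ u + z) (sym (ℚ.*-assoc κ κ′ ε))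
           (lb (κ′ * ε) Y u (0≤* 0≤κ′ 0≤ε) (sound′ ε Y u 0≤ε s))
      where
      projection = project ks ks! cs
      cs′        = proj₁ projection
      complete   = proj₁ (proj₂ projection)
      open _⊩_⇒_⊩_ (⇒-∷ [] bounded (proj₂ (proj₂ projection))) renaming (κ to κ′; 0≤κ to 0≤κ′; sound to sound′)
      optimum = least cs′
      t  = proj₁ optimum
      κ  = proj₁ (proj₂ (proj₂ optimum))
      lb : IsLowerBound cs′ t κ
      lb = proj₂ (proj₂ (proj₂ optimum))
      s₀′ : Sat 0ℚ [] (nonnegative ∷ cs′) X₀ t₀
      s₀′ = subst (λ e → Sat e [] (nonnegative ∷ cs′) X₀ t₀) (ℚ.*-zeroʳ κ′) (sound′ 0ℚ X₀ t₀ ℚ.≤-refl s₀)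
      t≤t₀ : t ≤ t₀
      t≤t₀ = subst (t ≤_) (solve 2 (λ t k → t :+ k :* con 0ℚ := t) refl t₀ κ) (lb 0ℚ X₀ t₀ ℚ.≤-refl s₀′)
      holds : ∀ c → c ∈ cs′ → 0ℚ ≤ 0ℚ + (slope c * t + const c)
      holds c c∈ = subst (0ℚ ≤_) (sym (ℚ.+-identityˡ (slope c * t + const c))) (cases (0ℚ ℚ.<? slope c))
        where
        cases : Dec (0ℚ < slope c) → 0ℚ ≤ slope c * t + const c
        cases (yes 0<s) = All.lookup (proj₁ (proj₂ optimum)) c∈ 0<s
        -- An inequality of nonpositive slope holds at the feasible `t₀`, hence at the smaller `t`.
        cases (no ¬0<s) = ℚ.≤-trans
          (subst (0ℚ ≤_) (ℚ.+-identityˡ (slope c * t₀ + const c)) (All.lookup (All.tail s₀′) c∈))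
          (ℚ.+-monoˡ-≤ (const c) (ℚ.*-monoˡ-≤-nonPos (slope c) {{nonPositive (ℚ.≮⇒≥ ¬0<s)}} t≤t₀))

-- Existence of the fractional chromatic number, and weak duality.

module FractionalChromaticNumbers where
  open RationalLemmas
  open import Data.Bool.Base using (T)
  open import Data.Rational.Base
  open import Data.List.Membership.Propositional using (_∈_)
  open ℚSolver.+-*-Solver using (solve; con; _:+_; _:*_; :-_; _:-_; _:=_)
  open ℚ.≤-Reasoning
  open FiniteSums
  open FourierMotzkin

  ∈-allSubsets : ∀ {n} (S : Subset n) → S ∈ allSubsets n
  ∈-allSubsets []                    = here refl
  ∈-allSubsets {suc n} (false ∷ S) = ∈-++⁺ˡ (∈-map⁺ (outside ∷_) (∈-allSubsets S))
  ∈-allSubsets {suc n} (true  ∷ S) = ∈-++⁺ʳ (map (outside ∷_) (allSubsets n)) (∈-map⁺ (inside ∷_) (∈-allSubsets S))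

  allSubsets-unique : ∀ n → Unique (allSubsets n)
  allSubsets-unique zero    = [] ∷ []
  allSubsets-unique (suc n) = Unique.++⁺
    (Unique.map⁺ Vec.∷-injectiveʳ (allSubsets-unique n)) (Unique.map⁺ Vec.∷-injectiveʳ (allSubsets-unique n)) disjoint
    where
    disjoint : Disjoint (map (outside ∷_) (allSubsets n)) (map (inside ∷_) (allSubsets n))
    disjoint (p , q) with ∈-map⁻ (outside ∷_) p | ∈-map⁻ (inside ∷_) q
    ... | _ , _ , refl | _ , _ , ()

  Eventually-All : ∀ {A : Set} {P : A → ℕ → Set} xs → (∀ {x} → x ∈ xs → Eventually (P x)) →
                   Eventually λ n → All (λ x → P x n) xs
  Eventually-All []       h = 0 , λ _ _ → []
  Eventually-All (x ∷ xs) h with h (here refl) | Eventually-All xs (h ∘ there)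
  ... | N , f | N′ , g = N ℕ.⊔ N′ , λ n N≤n →
    f n (ℕ.≤-trans (ℕ.m≤m⊔n N N′) N≤n) ∷ g n (ℕ.≤-trans (ℕ.m≤n⊔m N N′) N≤n)

  seq-sumᴿ : ∀ {A : Set} (x : A → ℝ) xs n → seq (sumᴿ (map x xs)) n ≡ ∑ xs (λ a → seq (x a) n)
  seq-sumᴿ x []       n = refl
  seq-sumᴿ x (a ∷ as) n = cong (seq (x a) n +_) (seq-sumᴿ x as n)

  fromℚ-mono : ∀ {p q} → p ≤ q → fromℚ p ≤ᴿ fromℚ q
  fromℚ-mono p≤q ε 0<ε = 0 , λ _ _ → ℚ.≤-trans p≤q (p≤p+q (ℚ.<⇒≤ 0<ε))

  ∑-δ : ∀ {n} (f : Subset n → ℚ) {I xs} → Unique xs → I ∈ xs → ∑ xs (λ J → 𝟙 (does (Vec.≡-dec Bool._≟_ J I)) * f J) ≡ f I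
  ∑-δ f {I} {J ∷ xs} (J∉ ∷ xs!) (here refl) with Vec.≡-dec Bool._≟_ I I
  ... | no I≢I = contradiction refl I≢I
  ... | yes _  = trans (cong (1ℚ * f I +_) (zeros xs J∉)) (solve 1 (λ x → con 1ℚ :* x :+ con 0ℚ := x) refl (f I))
    where
    zeros : ∀ ys → All (I ≢_) ys → ∑ ys (λ J → 𝟙 (does (Vec.≡-dec Bool._≟_ J I)) * f J) ≡ 0ℚ
    zeros []       []       = refl
    zeros (y ∷ ys) (h ∷ hs) with Vec.≡-dec Bool._≟_ y I
    ... | yes eq = contradiction (sym eq) h
    ... | no _   = trans (cong (0ℚ * f y +_) (zeros ys hs)) (solve 1 (λ x → con 0ℚ :* x :+ con 0ℚ := con 0ℚ) refl (f y))
  ∑-δ f {I} {J ∷ xs} (J∉ ∷ xs!) (there I∈) with Vec.≡-dec Bool._≟_ J I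
  ... | yes refl = contradiction refl (All.lookup J∉ I∈)
  ... | no _     = trans (cong (0ℚ * f J +_) (∑-δ f xs! I∈)) (solve 2 (λ x y → con 0ℚ :* x :+ y := y) refl (f J) (f I))

  neg-∑≤ : ∀ {A : Set} (X : A → ℚ) ε xs → All (λ x → - ε ≤ X x) xs → ∑ xs (λ x → - 1ℚ * X x) ≤ ι (length xs) * ε
  neg-∑≤ X ε []       []       = ℚ.≤-reflexive (sym (trans (cong (_* ε) ι-0) (ℚ.*-zeroˡ ε)))
  neg-∑≤ X ε (x ∷ xs) (h ∷ hs) = begin
    - 1ℚ * X x + ∑ xs (λ x → - 1ℚ * X x) ≤⟨ ℚ.+-mono-≤ (subst₂ _≤_
         (solve 1 (λ x → :- x := con (- 1ℚ) :* x) refl (X x)) (solve 1 (λ e → :- (:- e) := e) refl ε)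
         (ℚ.neg-antimono-≤ h)) (neg-∑≤ X ε xs hs) ⟩
    ε + ι (length xs) * ε                ≡⟨ solve 2 (λ e i → e :+ i :* e := (i :+ con 1ℚ) :* e) refl ε (ι (length xs)) ⟩
    (ι (length xs) + 1ℚ) * ε             ≡⟨ cong (_* ε) (sym (ι-suc (length xs))) ⟩
    ι (length (x ∷ xs)) * ε              ∎

  module _ (G : Graph) where
    open Graph G
    open LinearProgramming {Subset v} (Vec.≡-dec Bool._≟_)

    private
      L : List (Subset v)
      L = independentSets G

    L-unique : Unique L
    L-unique = Unique.filter⁺ (independent? adj) (allSubsets-unique v)

    ∈L : ∀ {I} → Independent adj I → I ∈ L
    ∈L {I} ind = ∈-filter⁺ (independent? adj) (∈-allSubsets I) ind

    L-independent : ∀ {I} → I ∈ L → Independent adj I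
    L-independent I∈ = proj₂ (∈-filter⁻ (independent? adj) {xs = allSubsets v} I∈)

    ⁅⁆-independent : ∀ u → Independent adj ⁅ u ⁆
    ⁅⁆-independent u i j i∈ j∈ with x∈⁅y⁆⇒x≡y u i∈ | x∈⁅y⁆⇒x≡y u j∈
    ... | refl | refl = subst (λ b → ¬ T b) (sym (adj-irrefl u)) λ ()

    coverage : (Subset v → ℚ) → Fin v → ℚ
    coverage X u = ∑ L (λ I → 𝟙 (does (u ∈? I)) * X I)

    nonnegC : Subset v → Constraint
    nonnegC I = constraint (λ J → 𝟙 (does (Vec.≡-dec Bool._≟_ J I))) 0ℚ 0ℚ

    coverC : Fin v → Constraint
    coverC u = constraint (λ I → 𝟙 (does (u ∈? I))) 0ℚ (- 1ℚ)

    -- Bounding the cost by `t` turns the objective, a sum, into a single unknown, as the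
    -- elimination requires.
    costC : Constraint
    costC = constraint (λ _ → - 1ℚ) 1ℚ 0ℚ

    program : List Constraint
    program = costC ∷ map nonnegC L ++ map coverC (allFin v)

    value-nonnegC : ∀ X t {I} → I ∈ L → value L X t (nonnegC I) ≡ X I
    value-nonnegC X t {I} I∈ = trans (cong (_+ (0ℚ * t + 0ℚ)) (∑-δ X L-unique I∈))
      (solve 2 (λ x t → x :+ (con 0ℚ :* t :+ con 0ℚ) := x) refl (X I) t)

    value-coverC : ∀ X t u → value L X t (coverC u) ≡ coverage X u - 1ℚ
    value-coverC X t u = solve 2 (λ x t → x :+ (con 0ℚ :* t :+ con (- 1ℚ)) := x :- con 1ℚ) refl (coverage X u) t

    value-costC : ∀ X t → value L X t costC ≡ t - ∑ L X
    value-costC X t = trans (cong (_+ (1ℚ * t + 0ℚ)) (∑-distrib-* L (- 1ℚ) X))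
      (solve 2 (λ x t → con (- 1ℚ) :* x :+ (con 1ℚ :* t :+ con 0ℚ) := t :- x) refl (∑ L X) t)

    sat : ∀ {ε X t} → - ε ≤ t - ∑ L X → (∀ {I} → I ∈ L → - ε ≤ X I) → (∀ u → - ε ≤ coverage X u - 1ℚ) →
          Sat ε L program X t
    sat {ε} {X} {t} cost nn cov = subst (- ε ≤_) (sym (value-costC X t)) cost ∷ All.++⁺
      (All.map⁺ (All.tabulate λ I∈ → subst (- ε ≤_) (sym (value-nonnegC X t I∈)) (nn I∈)))
      (All.map⁺ (All.tabulate λ {u} _ → subst (- ε ≤_) (sym (value-coverC X t u)) (cov u)))

    sat-cost : ∀ {ε X t} → Sat ε L program X t → - ε ≤ t - ∑ L X
    sat-cost {ε} {X} {t} s = subst (- ε ≤_) (value-costC X t) (All.head s)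

    sat-nonneg : ∀ {ε X t} → Sat ε L program X t → ∀ {I} → I ∈ L → - ε ≤ X I
    sat-nonneg {ε} {X} {t} s I∈ = subst (- ε ≤_) (value-nonnegC X t I∈)
      (All.lookup (All.map⁻ (All.++⁻ˡ (map nonnegC L) (All.tail s))) I∈)

    sat-cover : ∀ {ε X t} → Sat ε L program X t → ∀ u → - ε ≤ coverage X u - 1ℚ
    sat-cover {ε} {X} {t} s u = subst (- ε ≤_) (value-coverC X t u)
      (All.lookup (All.map⁻ (All.++⁻ʳ (map nonnegC L) (All.tail s))) (∈-allFin u))

    -- The total weight is at least `- ε` for each independent set, and the cost constraint loses
    -- another `ε`.
    program-bounded : L ⊩ program ⇒ [] ⊩ (nonnegative ∷ [])
    program-bounded = entails κ (0≤ι (suc (length L))) λ ε X t 0≤ε s → (begin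
      - (ι (suc (length L)) * ε)            ≡⟨ cong (λ i → - (i * ε)) (ι-suc (length L)) ⟩
      - ((ι (length L) + 1ℚ) * ε)           ≡⟨ solve 2 (λ i e → :- ((i :+ con 1ℚ) :* e) := :- (i :* e) :+ (:- e)) refl (ι (length L)) ε ⟩
      - (ι (length L) * ε) + - ε            ≤⟨ ℚ.+-mono-≤
           (ℚ.neg-antimono-≤ (neg-∑≤ X ε L (All.tabulate (sat-nonneg {t = t} s)))) (sat-cost {X = X} s) ⟩
      - ∑ L (λ I → - 1ℚ * X I) + (t - ∑ L X) ≡⟨ cong (λ z → - z + (t - ∑ L X)) (∑-distrib-* L (- 1ℚ) X) ⟩
      - (- 1ℚ * ∑ L X) + (t - ∑ L X)        ≡⟨ solve 2 (λ x t → :- (con (- 1ℚ) :* x) :+ (t :- x) := con 0ℚ :+ (con 1ℚ :* t :+ con 0ℚ)) refl (∑ L X) t ⟩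
      0ℚ + (1ℚ * t + 0ℚ)                    ∎) ∷ []
      where κ = ι (suc (length L))

    -- With weight 1 on every independent set, each `u` is already covered by its singleton.
    program-feasible : Sat 0ℚ L program (λ _ → 1ℚ) (∑ L (λ _ → 1ℚ))
    program-feasible = sat {0ℚ} {X = λ _ → 1ℚ} (ℚ.≤-reflexive (sym (ℚ.+-inverseʳ (∑ L (λ _ → 1ℚ))))) (λ _ → 0≤1) λ u →
      subst (_≤ coverage (λ _ → 1ℚ) u - 1ℚ) (ℚ.+-inverseʳ 1ℚ) (ℚ.+-monoˡ-≤ (- 1ℚ) (begin
        1ℚ                            ≡⟨ sym (cong (λ b → 𝟙 b * 1ℚ) (dec-true (u ∈? ⁅ u ⁆) (x∈⁅x⁆ u))) ⟩
        𝟙 (does (u ∈? ⁅ u ⁆)) * 1ℚ    ≤⟨ term≤∑ (λ {I} _ → 0≤* (0≤𝟙 (does (u ∈? I))) 0≤1) (∈L (⁅⁆-independent u)) ⟩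
        coverage (λ _ → 1ℚ) u         ∎))

    seq-cover : ∀ (x : Subset v → ℝ) u n →
                seq (sumᴿ (map x (filter (u ∈?_) L))) n ≡ coverage (λ I → seq (x I) n) u
    seq-cover x u n = trans (seq-sumᴿ x (filter (u ∈?_) L) n) (∑-filter (u ∈?_) L (λ I → seq (x I) n))

    -- The rational optimum is also minimal among real colourings: far enough out, the terms of a
    -- real colouring satisfy the program up to `δ`, so their cost is at least the optimum minus
    -- `κ * δ`, and `δ` is arbitrary.
    fractionalChromaticNumber : ∃[ X ] (∀ {I} → I ∈ L → 0ℚ ≤ X I) × (∀ u → 1ℚ ≤ coverage X u) ×
                                IsFractionalChromaticNumber G (fromℚ (∑ L X))
    fractionalChromaticNumber = X , sat-nonneg {0ℚ} {t = t} s , covered , (fromℚ ∘ X , colouring , attained) , minimal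
      where
      optimum = minimum L L-unique program (λ _ → 1ℚ) (∑ L (λ _ → 1ℚ)) program-feasible program-bounded
      X : Subset v → ℚ
      X = proj₁ optimum
      t : ℚ
      t = proj₁ (proj₂ optimum)
      s : Sat 0ℚ L program X t
      s = proj₁ (proj₂ (proj₂ optimum))
      κ : ℚ
      κ = proj₁ (proj₂ (proj₂ (proj₂ optimum)))
      lower : ∀ ε Y u → 0ℚ ≤ ε → Sat ε L program Y u → t ≤ u + κ * ε
      lower = proj₂ (proj₂ (proj₂ (proj₂ optimum)))
      covered : ∀ u → 1ℚ ≤ coverage X u
      covered u = ≤-from-diff (sat-cover {0ℚ} {t = t} s u)
      colouring : IsFractionalColouring G (fromℚ ∘ X)
      colouring .IsFractionalColouring.nonneg I ind = fromℚ-mono (sat-nonneg {0ℚ} {t = t} s (∈L ind))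
      colouring .IsFractionalColouring.covers u ε 0<ε = 0 , λ n _ →
        subst (λ z → 1ℚ ≤ z + ε) (sym (seq-cover (fromℚ ∘ X) u n)) (ℚ.≤-trans (covered u) (p≤p+q (ℚ.<⇒≤ 0<ε)))
      attained : fromℚ (∑ L X) ≃ᴿ sumᴿ (map (fromℚ ∘ X) L)
      attained ε 0<ε = 0 , λ n _ → subst (λ z → ∣ ∑ L X - z ∣ ≤ ε) (sym (seq-sumᴿ (fromℚ ∘ X) L n))
        (subst (_≤ ε) (sym (∣p-p∣≡0 (∑ L X))) (ℚ.<⇒≤ 0<ε))
      minimal : ∀ r → Σ[ x ∈ (Subset v → ℝ) ] IsFractionalColouring G x × r ≃ᴿ sumᴿ (map x L) → fromℚ (∑ L X) ≤ᴿ r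
      minimal r (x , col , r≃) ε 0<ε =
        -- `κ` is rounded up because `shrink` scales by natural numbers.
        let (K , κ≤K)      = ∃ι≥ κ
            (δ , 0<δ , Kδ) = shrink K 0<ε
            (N₁ , h₁)      = r≃ δ 0<δ
            (N₂ , h₂)      = Eventually-All L (λ {I} I∈ → IsFractionalColouring.nonneg col I (L-independent I∈) δ 0<δ)
            (N₃ , h₃)      = Eventually-All (allFin v) (λ {u} _ → IsFractionalColouring.covers col u δ 0<δ)
        in N₁ ℕ.⊔ (N₂ ℕ.⊔ N₃) , λ n N≤n →
        let Y = λ I → seq (x I) n
            N₁≤n = ℕ.≤-trans (ℕ.m≤m⊔n N₁ (N₂ ℕ.⊔ N₃)) N≤n
            N₂≤n = ℕ.≤-trans (ℕ.m≤m⊔n N₂ N₃) (ℕ.≤-trans (ℕ.m≤n⊔m N₁ (N₂ ℕ.⊔ N₃)) N≤n)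
            N₃≤n = ℕ.≤-trans (ℕ.m≤n⊔m N₂ N₃) (ℕ.≤-trans (ℕ.m≤n⊔m N₁ (N₂ ℕ.⊔ N₃)) N≤n)
            cost : - δ ≤ seq r n - ∑ L Y
            cost = subst (λ z → - δ ≤ seq r n - z) (seq-sumᴿ x L n) (begin
              - δ                                   ≤⟨ ℚ.neg-antimono-≤ (ℚ.≤-trans (p≤∣p∣ _) (subst (_≤ δ) (∣-∣-swap (seq r n) (seq (sumᴿ (map x L)) n)) (h₁ n N₁≤n))) ⟩
              - (seq (sumᴿ (map x L)) n - seq r n)  ≡⟨ solve 2 (λ a b → :- (a :- b) := b :- a) refl (seq (sumᴿ (map x L)) n) (seq r n) ⟩
              seq r n - seq (sumᴿ (map x L)) n      ∎)
            cov : ∀ u → - δ ≤ coverage Y u - 1ℚ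
            cov u = subst (λ z → - δ ≤ z - 1ℚ) (seq-cover x u n) (shift 1ℚ (seq (sumᴿ (map x (filter (u ∈?_) L))) n) δ (All.lookup (h₃ n N₃≤n) (∈-allFin u)))
            nn : ∀ {I} → I ∈ L → - δ ≤ Y I
            nn {I} I∈ = subst (- δ ≤_) (solve 1 (λ a → a :- con 0ℚ := a) refl (Y I)) (shift 0ℚ (Y I) δ (All.lookup (h₂ n N₂≤n) I∈))
        in begin
          ∑ L X          ≤⟨ ≤-from-diff (sat-cost {0ℚ} {X} {t} s) ⟩
          t              ≤⟨ lower δ Y (seq r n) (ℚ.<⇒≤ 0<δ) (sat {X = Y} cost nn cov) ⟩
          seq r n + κ * δ ≤⟨ ℚ.+-monoʳ-≤ (seq r n) (ℚ.≤-trans (*-monoʳ δ (ℚ.<⇒≤ 0<δ) κ≤K) Kδ) ⟩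
          seq r n + ε    ∎
        where
        shift : ∀ p q e → p ≤ q + e → - e ≤ q - p
        shift p q e h = subst₂ _≤_ (solve 2 (λ p e → p :+ (:- p :- e) := :- e) refl p e)
          (solve 3 (λ p q e → q :+ e :+ (:- p :- e) := q :- p) refl p q e) (ℚ.+-monoˡ-≤ (- p - e) h)

    -- Double counting: every vertex is covered at least once, and exchanging the sums collects the
    -- weight of each independent set. The scale `c` spares a normalisation of `y`.
    weight≤ : ∀ {X} → (∀ {I} → I ∈ L → 0ℚ ≤ X I) → (∀ u → 1ℚ ≤ coverage X u) →
              ∀ c (y : Fin v → ℚ) → (∀ u → 0ℚ ≤ y u) →
              (∀ I → Independent adj I → sum (λ u → 𝟙 (does (u ∈? I)) * y u) ≤ c) → sum y ≤ c * ∑ L X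
    weight≤ {X} 0≤X covered c y 0≤y h = begin
      sum y                                                       ≤⟨ sum-mono (λ u → subst (_≤ y u * coverage X u) (ℚ.*-identityʳ (y u)) (*-monoˡ (y u) (0≤y u) (covered u))) ⟩
      sum (λ u → y u * coverage X u)                              ≡⟨ sum-cong-≗ (λ u → sym (∑-distrib-* L (y u) (λ I → 𝟙 (does (u ∈? I)) * X I))) ⟩
      sum (λ u → ∑ L (λ I → y u * (𝟙 (does (u ∈? I)) * X I)))     ≡⟨ sym (∑-sum-comm L (λ I u → y u * (𝟙 (does (u ∈? I)) * X I))) ⟩
      ∑ L (λ I → sum (λ u → y u * (𝟙 (does (u ∈? I)) * X I)))     ≡⟨ ∑-cong L (λ I → trans
                                                                       (sum-cong-≗ (λ u → solve 3 (λ y b x → y :* (b :* x) := x :* (b :* y)) refl (y u) (𝟙 (does (u ∈? I))) (X I)))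
                                                                       (sym (*-distribˡ-sum (X I) (λ u → 𝟙 (does (u ∈? I)) * y u)))) ⟩
      ∑ L (λ I → X I * sum (λ u → 𝟙 (does (u ∈? I)) * y u))       ≤⟨ ∑-mono L (λ {I} I∈ → *-monoˡ (X I) (0≤X I∈) (h I (L-independent I∈))) ⟩
      ∑ L (λ I → X I * c)                                         ≡⟨ ∑-cong L (λ I → ℚ.*-comm (X I) c) ⟩
      ∑ L (λ I → c * X I)                                         ≡⟨ ∑-distrib-* L c X ⟩
      c * ∑ L X                                                   ∎

-- Existence of the Hall ratio, and an upper bound for it.

module HallRatios where
  open RationalLemmas
  open import Data.Bool.Base using (T)
  open import Data.Fin.Subset using (_∈_; ∣_∣)
  open import Data.List.Membership.Propositional using () renaming (_∈_ to _∈ˡ_)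
  open import Data.Rational.Base using (_≤_)
  open FractionalChromaticNumbers

  maximiser : ∀ {A B : Set} {_≼_ : B → B → Set} → Reflexive _≼_ → Transitive _≼_ → Total _≼_ →
              (f : A → B) {x : A} {xs : List A} → x ∈ˡ xs → ∃[ m ] m ∈ˡ xs × (∀ {y} → y ∈ˡ xs → f y ≼ f m)
  maximiser {A} {B} {_≼_} ≼-refl ≼-trans total f {xs = x ∷ xs} _ = go x xs
    where
    go : ∀ x xs → ∃[ m ] m ∈ˡ (x ∷ xs) × (∀ {y} → y ∈ˡ (x ∷ xs) → f y ≼ f m)
    go x []       = x , here refl , λ { (here refl) → ≼-refl }
    go x (y ∷ ys) with go y ys
    ... | m , m∈ , max with total (f x) (f m)
    ... | inj₁ x≼m = m , there m∈ , λ { (here refl) → x≼m ; (there z∈) → max z∈ }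
    ... | inj₂ m≼x = x , here refl , λ { (here refl) → ≼-refl ; (there z∈) → ≼-trans (max z∈) m≼x }

  /-≤-/ : ∀ {m n a b} → m ℕ.* suc b ℕ.≤ n ℕ.* suc a → ℤ.+ m / suc a ≤ ℤ.+ n / suc b
  /-≤-/ {m} {n} {a} {b} h = ℚ.toℚᵘ-cancel-≤
    (ℚᵘ.≤-respˡ-≃ (ℚᵘ.≃-sym (toℚᵘ-/ (ℤ.+ m) a)) (ℚᵘ.≤-respʳ-≃ (ℚᵘ.≃-sym (toℚᵘ-/ (ℤ.+ n) b))
      (ℚᵘ.*≤* (subst₂ ℤ._≤_ (ℤ.pos-* m (suc b)) (ℤ.pos-* n (suc a)) (ℤ.+≤+ h)))))

  module _ (G : Graph) where
    open Graph G

    induced : Subset v → Subgraph G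
    induced S = record
      { vertices  = S
      ; adj       = λ i j → adj i j ∧ (does (i ∈? S) ∧ does (j ∈? S))
      ; adj-sym   = λ i j → cong₂ _∧_ (adj-sym i j) (Bool.∧-comm (does (i ∈? S)) (does (j ∈? S)))
      ; adj⊆      = λ i j → proj₁ ∘ Bool.T-∧ .to
      ; endpoints = λ i j → (λ (p , q) → witness (i ∈? S) p , witness (j ∈? S) q) ∘ Bool.T-∧ .to ∘ proj₂ ∘ Bool.T-∧ {adj i j} .to
      }
      where
      open Equivalence using (to)
      witness : ∀ {P : Set} (P? : Dec P) → T (does P?) → P
      witness (yes p) _ = p

    induced-independent : ∀ {S I} → Independent adj I → Independent (Subgraph.adj (induced S)) I
    induced-independent {S} ind i j i∈ j∈ = ind i j i∈ j∈ ∘ Subgraph.adj⊆ (induced S) i j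

    independent-induced : ∀ {S I} → I ⊆ S → Independent (Subgraph.adj (induced S)) I → Independent adj I
    independent-induced {S} I⊆S ind i j i∈ j∈ ij with ind i j i∈ j∈
    ... | ¬ij with i ∈? S | j ∈? S
    ... | yes _  | yes _  = ¬ij (subst T (sym (Bool.∧-identityʳ (adj i j))) ij)
    ... | no i∉S | _      = i∉S (I⊆S i∈)
    ... | yes _  | no j∉S = j∉S (I⊆S j∈)

    maximumIndependent : ∀ S → ∃[ I ] (I ⊆ S × Independent adj I) × (∀ {J} → J ⊆ S → Independent adj J → ∣ J ∣ ℕ.≤ ∣ I ∣)
    maximumIndependent S =
      let (I , I∈ , max) = maximiser ℕ.≤-refl ℕ.≤-trans ℕ.≤-total ∣_∣
                             (∈-filter⁺ good? (∈-allSubsets Subset.⊥) (⊥⊆ , λ i _ i∈ → contradiction i∈ ∉⊥))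
      in I , proj₂ (∈-filter⁻ good? {xs = allSubsets v} I∈) , λ {J} J⊆S ind → max (∈-filter⁺ good? (∈-allSubsets J) (J⊆S , ind))
      where good? = λ I → (I ⊆? S) ×-dec independent? adj I

    α : Subset v → ℕ
    α S = ∣ proj₁ (maximumIndependent S) ∣

    -- For nonempty `S` the denominator is `α S`; writing it as a successor makes it visibly
    -- nonzero.
    ratio : Subset v → ℚ
    ratio S = ℤ.+ ∣ S ∣ / suc (pred (α S))

    -- Deleting edges only enlarges the independence number, so among the subgraphs on a given
    -- vertex set the induced one has the largest ratio. The maximum is thus taken over the finitely
    -- many nonempty vertex sets, and the vertex argument provides one.
    hallRatio : ∀ C → Fin v →
                (∀ S → Nonempty S → ∃[ I ] I ⊆ S × Independent adj I × 0 ℕ.< ∣ I ∣ × ∣ S ∣ ℕ.≤ C ℕ.* ∣ I ∣) →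
                ∃[ ρ ] IsHallRatio G ρ × ρ ≤ ℤ.+ C / 1
    hallRatio C u large =
      let (S , S∈ , max) = maximiser ℚ.≤-refl ℚ.≤-trans ℚ.≤-total ratio (nonempties-∈ ⁅ u ⁆ (u , x∈⁅x⁆ u))
          ne             = proj₂ (∈-filter⁻ nonempty? {xs = allSubsets v} S∈)
      in ratio S , ((induced S , ne , pred (α S) , independenceNumber S ne , refl)
                   , λ { q (H , neH , a , isα , refl) → ℚ.≤-trans (ratio-max H neH isα) (max (nonempties-∈ (Subgraph.vertices H) neH)) })
                 , ratio≤ S ne
      where
      nonempties-∈ : ∀ S → Nonempty S → S ∈ˡ filter nonempty? (allSubsets v)
      nonempties-∈ S ne = ∈-filter⁺ nonempty? (∈-allSubsets S) ne
      0<α : ∀ S → Nonempty S → 0 ℕ.< α S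
      0<α S ne = let (I , I⊆S , ind , 0<I , _) = large S ne in
        ℕ.<-≤-trans 0<I (proj₂ (proj₂ (maximumIndependent S)) I⊆S ind)
      suc-pred-α : ∀ S → Nonempty S → suc (pred (α S)) ≡ α S
      suc-pred-α S ne = ℕ.suc-pred (α S) {{ℕ.>-nonZero (0<α S ne)}}
      independenceNumber : ∀ S → Nonempty S → IsIndependenceNumber {G} (induced S) (suc (pred (α S)))
      independenceNumber S ne = subst (IsIndependenceNumber {G} (induced S)) (sym (suc-pred-α S ne))
        (let (I , (I⊆S , ind) , max) = maximumIndependent S
         in (I , I⊆S , induced-independent {S} ind , refl)
          , λ { _ (J , J⊆S , indJ , refl) → max J⊆S (independent-induced J⊆S indJ) })
      ratio-max : ∀ H → Nonempty (Subgraph.vertices H) → ∀ {a} → IsIndependenceNumber {G} H (suc a) →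
                  ℤ.+ ∣ Subgraph.vertices H ∣ / suc a ≤ ratio (Subgraph.vertices H)
      ratio-max H ne {a} (_ , max) = /-≤-/ {m = ∣ S ∣} {n = ∣ S ∣} (ℕ.*-monoʳ-≤ ∣ S ∣ (subst (ℕ._≤ suc a) (sym (suc-pred-α S ne))
        (max (α S) (let (I , (I⊆S , ind) , _) = maximumIndependent S in
          I , I⊆S , (λ i j i∈ j∈ → ind i j i∈ j∈ ∘ Subgraph.adj⊆ H i j) , refl))))
        where S = Subgraph.vertices H
      ratio≤ : ∀ S → Nonempty S → ratio S ≤ ℤ.+ C / 1
      ratio≤ S ne = let (I , I⊆S , ind , _ , S≤CI) = large S ne in /-≤-/ {m = ∣ S ∣} {n = C} (begin
        ∣ S ∣ ℕ.* 1             ≡⟨ ℕ.*-identityʳ ∣ S ∣ ⟩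
        ∣ S ∣                   ≤⟨ S≤CI ⟩
        C ℕ.* ∣ I ∣             ≤⟨ ℕ.*-monoʳ-≤ C (proj₂ (proj₂ (maximumIndependent S)) I⊆S ind) ⟩
        C ℕ.* α S               ≡⟨ cong (C ℕ.*_) (sym (suc-pred-α S ne)) ⟩
        C ℕ.* suc (pred (α S))  ∎)
        where open ℕ.≤-Reasoning

-- Expectations over finite product spaces.

module Averages where
  open RationalLemmas
  open import Data.Rational.Base hiding (∣_∣)
  open ℚSolver.+-*-Solver using (solve; _:*_; _:=_)
  open ℚ.≤-Reasoning
  open FiniteSums
  open HallRatios

  -- The field attain is the method of conditional expectations: it replaces probability by search.
  record Average (A : Set) : Set₁ where
    field
      E      : (A → ℚ) → ℚ
      E-cong : ∀ {f g} → (∀ a → f a ≡ g a) → E f ≡ E g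
      E-+    : ∀ f g → E (λ a → f a + g a) ≡ E f + E g
      E-*    : ∀ c f → E (λ a → c * f a) ≡ c * E f
      attain : ∀ f → ∃[ a ] f a ≤ E f

    E-0 : E (λ _ → 0ℚ) ≡ 0ℚ
    E-0 = trans (E-cong (λ _ → sym (ℚ.*-zeroˡ 0ℚ))) (trans (E-* 0ℚ (λ _ → 0ℚ)) (ℚ.*-zeroˡ (E (λ _ → 0ℚ))))

    E-sum : ∀ {n} (f : Fin n → A → ℚ) → E (λ a → sum (λ i → f i a)) ≡ sum (λ i → E (f i))
    E-sum {zero}  f = E-0
    E-sum {suc n} f = trans (E-+ (f zero) (λ a → sum (λ i → f (suc i) a))) (cong (E (f zero) +_) (E-sum (f ∘ suc)))

    E-∑ : ∀ {B : Set} (xs : List B) (f : B → A → ℚ) → E (λ a → ∑ xs (λ x → f x a)) ≡ ∑ xs (λ x → E (f x))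
    E-∑ []       f = E-0
    E-∑ (x ∷ xs) f = trans (E-+ (f x) (λ a → ∑ xs (λ y → f y a))) (cong (E (f x) +_) (E-∑ xs f))

  open Average

  uniform : ∀ {n} (P : Fin n → Bool) → Fin n → ∀ m → sum (λ u → 𝟙 (P u)) ≡ ι (suc m) → Average (Fin n)
  uniform {n} P u₀ m total = record
    { E      = E′
    ; E-cong = λ h → cong (recip m *_) (sum-cong-≗ (λ u → cong (𝟙 (P u) *_) (h u)))
    ; E-+    = λ f g → trans (cong (recip m *_) (trans (sum-cong-≗ (λ u → ℚ.*-distribˡ-+ (𝟙 (P u)) (f u) (g u)))
                 (∑-distrib-+ (λ u → 𝟙 (P u) * f u) (λ u → 𝟙 (P u) * g u))))
                 (ℚ.*-distribˡ-+ (recip m) (sum (λ u → 𝟙 (P u) * f u)) (sum (λ u → 𝟙 (P u) * g u)))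
    ; E-*    = E′-*
    ; attain = attain′
    }
    where
    E′ : (Fin n → ℚ) → ℚ
    E′ f = recip m * sum (λ u → 𝟙 (P u) * f u)
    E′-* : ∀ c f → E′ (λ u → c * f u) ≡ c * E′ f
    E′-* c f = begin-equality
      recip m * sum (λ u → 𝟙 (P u) * (c * f u)) ≡⟨ cong (recip m *_) (trans
           (sum-cong-≗ (λ u → solve 3 (λ p c f → p :* (c :* f) := c :* (p :* f)) refl (𝟙 (P u)) c (f u)))
           (sym (*-distribˡ-sum c (λ u → 𝟙 (P u) * f u)))) ⟩
      recip m * (c * sum (λ u → 𝟙 (P u) * f u)) ≡⟨ solve 3 (λ r c s → r :* (c :* s) := c :* (r :* s)) refl (recip m) c (sum (λ u → 𝟙 (P u) * f u)) ⟩
      c * E′ f                                  ∎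
    attain′ : ∀ f → ∃[ u ] f u ≤ E′ f
    -- The minimum is over all of `Fin n`, and it is at most the average over `P` even if it is
    -- attained outside `P`.
    attain′ f with maximiser {_≼_ = flip _≤_} ℚ.≤-refl (flip ℚ.≤-trans) (λ p q → Sum.swap (ℚ.≤-total p q)) f (∈-allFin u₀)
    ... | u , _ , min = u , (begin
      f u                                    ≡⟨ sym (ℚ.*-identityʳ (f u)) ⟩
      f u * 1ℚ                               ≡⟨ cong (f u *_) (sym (recip-ι m)) ⟩
      f u * (recip m * ι (suc m))            ≡⟨ cong (λ z → f u * (recip m * z)) (sym total) ⟩
      f u * (recip m * sum (λ w → 𝟙 (P w)))  ≡⟨ solve 3 (λ x r s → x :* (r :* s) := r :* (x :* s)) refl (f u) (recip m) (sum (λ w → 𝟙 (P w))) ⟩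
      recip m * (f u * sum (λ w → 𝟙 (P w)))  ≡⟨ cong (recip m *_) (*-distribˡ-sum (f u) (λ w → 𝟙 (P w))) ⟩
      recip m * sum (λ w → f u * 𝟙 (P w))    ≤⟨ *-monoˡ (recip m) (ℚ.<⇒≤ (0<recip m)) (sum-mono (λ w →
           subst (_≤ 𝟙 (P w) * f w) (ℚ.*-comm (𝟙 (P w)) (f u)) (*-monoˡ (𝟙 (P w)) (0≤𝟙 (P w)) (min (∈-allFin w))))) ⟩
      E′ f                                   ∎)

  E-uniform-mono : ∀ {n} (P : Fin n → Bool) u₀ m total {f g} → (∀ u → P u ≡ true → f u ≤ g u) →
                   E (uniform P u₀ m total) f ≤ E (uniform P u₀ m total) g
  E-uniform-mono P u₀ m total {f} {g} h = *-monoˡ (recip m) (ℚ.<⇒≤ (0<recip m)) (sum-mono λ u → on (P u) (h u))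
    where
    on : ∀ b {x y} → (b ≡ true → x ≤ y) → 𝟙 b * x ≤ 𝟙 b * y
    on false {x} {y} h = ℚ.≤-reflexive (trans (ℚ.*-zeroˡ x) (sym (ℚ.*-zeroˡ y)))
    on true          h = *-monoˡ 1ℚ 0≤1 (h refl)

  E-uniform-const : ∀ {n} (P : Fin n → Bool) u₀ m total c → E (uniform P u₀ m total) (λ _ → c) ≡ c
  E-uniform-const P u₀ m total c = begin-equality
    recip m * sum (λ u → 𝟙 (P u) * c)  ≡⟨ cong (recip m *_) (trans (sum-cong-≗ (λ u → ℚ.*-comm (𝟙 (P u)) c)) (sym (*-distribˡ-sum c (λ u → 𝟙 (P u))))) ⟩
    recip m * (c * sum (λ u → 𝟙 (P u))) ≡⟨ cong (λ z → recip m * (c * z)) total ⟩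
    recip m * (c * ι (suc m))          ≡⟨ solve 3 (λ r c s → r :* (c :* s) := c :* (r :* s)) refl (recip m) c (ι (suc m)) ⟩
    c * (recip m * ι (suc m))          ≡⟨ cong (c *_) (recip-ι m) ⟩
    c * 1ℚ                             ≡⟨ ℚ.*-identityʳ c ⟩
    c                                  ∎

  product : ∀ {A m} → (Fin m → Average A) → Average (Vec A m)
  product {A} {zero} as = record
    { E      = λ F → F []
    ; E-cong = λ h → h []
    ; E-+    = λ f g → refl
    ; E-*    = λ c f → refl
    ; attain = λ F → [] , ℚ.≤-refl
    }
  product {A} {suc m} as = record
    { E      = λ F → E a (λ x → E w (λ xs → F (x ∷ xs)))
    ; E-cong = λ h → E-cong a λ x → E-cong w λ xs → h (x ∷ xs)
    ; E-+    = λ f g → trans (E-cong a λ x → E-+ w (λ xs → f (x ∷ xs)) (λ xs → g (x ∷ xs)))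
                 (E-+ a (λ x → E w (λ xs → f (x ∷ xs))) (λ x → E w (λ xs → g (x ∷ xs))))
    ; E-*    = λ c f → trans (E-cong a λ x → E-* w c (λ xs → f (x ∷ xs))) (E-* a c (λ x → E w (λ xs → f (x ∷ xs))))
    ; attain = λ F → let (x , h)  = attain a (λ x → E w (λ xs → F (x ∷ xs)))
                         (xs , g) = attain w (λ xs → F (x ∷ xs))
                     in x ∷ xs , ℚ.≤-trans g h
    }
    where
    a = as zero
    w = product (as ∘ suc)

  -- Independence of the coordinates.
  E-product : ∀ {A m} (as : Fin m → Average A) (g : Fin m → A → ℚ) →
              E (product as) (λ xs → prod (λ i → g i (lookup xs i))) ≡ prod (λ i → E (as i) (g i))
  E-product {m = zero}  as g = refl
  E-product {m = suc m} as g = begin-equality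
    E a (λ x → E w (λ xs → g zero x * G xs))  ≡⟨ E-cong a (λ x → trans (E-* w (g zero x) G) (ℚ.*-comm (g zero x) (E w G))) ⟩
    E a (λ x → E w G * g zero x)              ≡⟨ E-* a (E w G) (g zero) ⟩
    E w G * E a (g zero)                      ≡⟨ ℚ.*-comm (E w G) (E a (g zero)) ⟩
    E a (g zero) * E w G                      ≡⟨ cong (E a (g zero) *_) (E-product (as ∘ suc) (g ∘ suc)) ⟩
    E a (g zero) * prod (λ i → E (as (suc i)) (g (suc i))) ∎
    where
    a = as zero
    w = product (as ∘ suc)
    G = λ xs → prod (λ i → g (suc i) (lookup xs i))

-- Counting elements of finite sets.

module Counting where
  open import Data.Nat.Base
  open import Data.Nat.Properties
  open import Data.Fin.Subset using (∣_∣)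
  open Algebra.Properties.Semiring.Sum +-*-semiring public
    using () renaming (sum to sumℕ; sum-cong-≗ to sumℕ-cong; ∑-distrib-+ to sumℕ-distrib-+; ∑-comm to sumℕ-comm;
                       *-distribˡ-sum to *-distribˡ-sumℕ; sum-replicate-zero to sumℕ-zero)

  ♯ : Bool → ℕ
  ♯ b = if b then 1 else 0

  count : ∀ {n} → (Fin n → Bool) → ℕ
  count P = sumℕ (λ i → ♯ (P i))

  sumℕ-const : ∀ n c → sumℕ {n} (λ _ → c) ≡ n * c
  sumℕ-const zero    c = refl
  sumℕ-const (suc n) c = cong (c +_) (sumℕ-const n c)

  sumℕ-mono : ∀ {n} {f g : Fin n → ℕ} → (∀ i → f i ≤ g i) → sumℕ f ≤ sumℕ g
  sumℕ-mono {zero}  h = z≤n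
  sumℕ-mono {suc n} h = +-mono-≤ (h zero) (sumℕ-mono (h ∘ suc))

  term≤sumℕ : ∀ {n} (f : Fin n → ℕ) i → f i ≤ sumℕ f
  term≤sumℕ f zero    = m≤m+n (f zero) _
  term≤sumℕ f (suc i) = ≤-trans (term≤sumℕ (f ∘ suc) i) (m≤n+m _ (f zero))

  ♯-mono : ∀ {a b} → (a ≡ true → b ≡ true) → ♯ a ≤ ♯ b
  ♯-mono {false}        h = z≤n
  ♯-mono {true} {true}  h = ≤-refl
  ♯-mono {true} {false} h with () ← h refl

  ♯-split : ∀ a b → ♯ a ≡ ♯ (a ∧ b) + ♯ (a ∧ not b)
  ♯-split false b     = refl
  ♯-split true  false = refl
  ♯-split true  true  = refl

  count-mono : ∀ {n} {P R : Fin n → Bool} → (∀ i → P i ≡ true → R i ≡ true) → count P ≤ count R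
  count-mono h = sumℕ-mono λ i → ♯-mono (h i)

  count-split : ∀ {n} (P R : Fin n → Bool) → count P ≡ count (λ i → P i ∧ R i) + count (λ i → P i ∧ not (R i))
  count-split P R = trans (sumℕ-cong (λ i → ♯-split (P i) (R i)))
    (sumℕ-distrib-+ (λ i → ♯ (P i ∧ R i)) (λ i → ♯ (P i ∧ not (R i))))

  count-none : ∀ n → count {n} (λ _ → false) ≡ 0
  count-none n = sumℕ-zero n

  count-≡ : ∀ {n} (j : Fin n) → count (λ i → does (j Fin.≟ i)) ≡ 1
  count-≡ {suc n} zero    = cong suc (count-none n)
  count-≡ {suc n} (suc j) = count-≡ j

  count-below : ∀ {n m} → m ≤ n → count {n} (λ u → toℕ u <ᵇ m) ≡ m
  count-below {n}     z≤n     = count-none n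
  count-below {suc n} (s≤s h) = cong suc (count-below h)

  count-below-≤ : ∀ n m → count {n} (λ u → toℕ u <ᵇ m) ≤ m
  count-below-≤ zero    m       = z≤n
  count-below-≤ (suc n) zero    = ≤-reflexive (count-none n)
  count-below-≤ (suc n) (suc m) = s≤s (count-below-≤ n m)

  count≤n : ∀ {n} (P : Fin n → Bool) → count P ≤ n
  count≤n {zero}  P = z≤n
  count≤n {suc n} P = +-mono-≤ (♯≤1 (P zero)) (count≤n (P ∘ suc))
    where
    ♯≤1 : ∀ b → ♯ b ≤ 1
    ♯≤1 false = z≤n
    ♯≤1 true  = ≤-refl

  count>0⇒∃ : ∀ {n} (P : Fin n → Bool) → 0 < count P → ∃[ i ] P i ≡ true
  count>0⇒∃ {suc n} P 0<c with P zero in eq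
  ... | true  = zero , eq
  ... | false = let (i , h) = count>0⇒∃ (P ∘ suc) 0<c in suc i , h

  -- Pigeonhole: `n` positive entries would sum to at least `n`. It provides the free colour in the
  -- greedy colouring.
  sumℕ<n⇒∃0 : ∀ {n} (f : Fin n → ℕ) → sumℕ f < n → ∃[ i ] f i ≡ 0
  sumℕ<n⇒∃0 {suc n} f h with f zero in eq
  ... | zero  = zero , eq
  ... | suc m = let (i , e) = sumℕ<n⇒∃0 (f ∘ suc) (≤-<-trans (m≤n+m _ m) (s≤s⁻¹ h)) in suc i , e

  sumℕ≤n*max : ∀ {n} (f : Fin (suc n) → ℕ) → ∃[ i ] sumℕ f ≤ suc n * f i
  sumℕ≤n*max {zero}  f = zero , ≤-refl
  sumℕ≤n*max {suc n} f with sumℕ≤n*max (f ∘ suc)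
  ... | j , h with ≤-total (f zero) (f (suc j))
  ... | inj₁ le = suc j , +-mono-≤ le h
  ... | inj₂ ge = zero , +-monoʳ-≤ (f zero) (≤-trans h (*-monoʳ-≤ (suc n) ge))

  ∣∣≡count : ∀ {n} (S : Subset n) → ∣ S ∣ ≡ count (lookup S)
  ∣∣≡count []          = refl
  ∣∣≡count (false ∷ S) = ∣∣≡count S
  ∣∣≡count (true  ∷ S) = cong suc (∣∣≡count S)

-- Estimates for powers and binomial coefficients; the exponents of the layer sizes.

module NaturalPowers where
  open import Data.Nat.Base
  open import Data.Nat.Properties
  open import Data.Nat.Combinatorics using (_C_; nCk+nC[k+1]≡[n+1]C[k+1]; k>n⇒nCk≡0)
  open ≤-Reasoning

  -- Discrete mean value theorem: together with `bernoulli-upper` it encloses the increment of the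
  -- power `suc t` between the derivatives at `n` and `suc n`.
  bernoulli-lower : ∀ n t → n ^ suc t + suc t * n ^ t ≤ suc n ^ suc t
  bernoulli-lower n zero    = ≤-reflexive (lemma n)
    where
    lemma : ∀ n → n * 1 + 1 * 1 ≡ suc n * 1
    lemma = solve-∀
  bernoulli-lower n (suc t) = begin
    n * (n * n ^ t) + suc (suc t) * (n * n ^ t)                    ≤⟨ m≤m+n _ (suc t * n ^ t) ⟩
    n * (n * n ^ t) + suc (suc t) * (n * n ^ t) + suc t * n ^ t    ≡⟨ lemma n t (n ^ t) ⟩
    suc n * (n * n ^ t + suc t * n ^ t)                            ≤⟨ *-monoʳ-≤ (suc n) (bernoulli-lower n t) ⟩
    suc n * suc n ^ suc t                                          ∎
    where
    lemma : ∀ n t x → n * (n * x) + suc (suc t) * (n * x) + suc t * x ≡ suc n * (n * x + suc t * x)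
    lemma = solve-∀

  bernoulli-upper : ∀ n t → suc n ^ suc t ≤ n ^ suc t + suc t * suc n ^ t
  bernoulli-upper n zero    = ≤-reflexive (lemma n)
    where
    lemma : ∀ n → suc n * 1 ≡ n * 1 + 1 * 1
    lemma = solve-∀
  bernoulli-upper n (suc t) = begin
    suc n * suc n ^ suc t                                    ≤⟨ *-monoʳ-≤ (suc n) (bernoulli-upper n t) ⟩
    suc n * (n ^ suc t + suc t * suc n ^ t)                  ≡⟨ lemma n t (n ^ suc t) (suc n ^ t) ⟩
    n * n ^ suc t + (n ^ suc t + suc t * suc n ^ suc t)      ≤⟨ +-monoʳ-≤ (n * n ^ suc t) (+-monoˡ-≤ (suc t * suc n ^ suc t) (^-monoˡ-≤ (suc t) (n≤1+n n))) ⟩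
    n * n ^ suc t + suc (suc t) * suc n ^ suc t              ∎
    where
    lemma : ∀ n t x y → suc n * (x + suc t * y) ≡ n * x + (x + suc t * (suc n * y))
    lemma = solve-∀

  -- The bound (1 - 1/(n+1))^(n+1) ≤ 1/2 without division.
  2n^[1+n]≤[1+n]^[1+n] : ∀ n → 2 * n ^ suc n ≤ suc n ^ suc n
  2n^[1+n]≤[1+n]^[1+n] n = begin
    2 * n ^ suc n                ≡⟨ cong (n ^ suc n +_) (+-identityʳ (n ^ suc n)) ⟩
    n ^ suc n + n * n ^ n        ≤⟨ +-monoʳ-≤ (n ^ suc n) (*-monoˡ-≤ (n ^ n) (n≤1+n n)) ⟩
    n ^ suc n + suc n * n ^ n    ≤⟨ bernoulli-lower n n ⟩
    suc n ^ suc n                ∎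

  nC0≡1 : ∀ n → n C 0 ≡ 1
  nC0≡1 n = refl

  pascal : ∀ n t → suc n C suc t ≡ n C t + n C suc t
  pascal n t = sym (nCk+nC[k+1]≡[n+1]C[k+1] n t)

  C≤2^ : ∀ n t → n C t ≤ 2 ^ n
  C≤2^ n       zero    = ≤-trans (≤-reflexive (nC0≡1 n)) (m^n>0 2 n)
  C≤2^ zero    (suc t) = ≤-trans (≤-reflexive (k>n⇒nCk≡0 {0} {suc t} (s≤s z≤n))) z≤n
  C≤2^ (suc n) (suc t) = begin
    suc n C suc t          ≡⟨ pascal n t ⟩
    n C t + n C suc t      ≤⟨ +-mono-≤ (C≤2^ n t) (C≤2^ n (suc t)) ⟩
    2 ^ n + 2 ^ n          ≡⟨ cong (2 ^ n +_) (sym (+-identityʳ (2 ^ n))) ⟩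
    2 ^ suc n              ∎

  -- By Pascal's rule the left side grows with `n` by `suc t` times its value at `t`, and
  -- `bernoulli-lower` says that the right side grows at least as fast.
  C*!≤^ : ∀ n t → (n C t) * t ! ≤ n ^ t
  C*!≤^ n       zero    = ≤-reflexive (trans (*-identityʳ (n C 0)) (nC0≡1 n))
  C*!≤^ zero    (suc t) = ≤-trans (≤-reflexive (cong (_* suc t !) (k>n⇒nCk≡0 {0} {suc t} (s≤s z≤n)))) z≤n
  C*!≤^ (suc n) (suc t) = begin
    (suc n C suc t) * (suc t * t !)                          ≡⟨ cong (_* (suc t * t !)) (pascal n t) ⟩
    (n C t + n C suc t) * (suc t * t !)                      ≡⟨ lemma (n C t) (n C suc t) (t !) t ⟩
    (n C suc t) * (suc t * t !) + suc t * ((n C t) * t !)    ≤⟨ +-mono-≤ (C*!≤^ n (suc t)) (*-monoʳ-≤ (suc t) (C*!≤^ n t)) ⟩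
    n ^ suc t + suc t * n ^ t                                ≤⟨ bernoulli-lower n t ⟩
    suc n ^ suc t                                            ∎
    where
    lemma : ∀ a b f t → (a + b) * (suc t * f) ≡ b * (suc t * f) + suc t * (a * f)
    lemma = solve-∀

  ^≤C*! : ∀ n t → n ^ t ≤ ((n + t) C t) * t !
  ^≤C*! n       zero    = ≤-reflexive (sym (trans (*-identityʳ ((n + 0) C 0)) (nC0≡1 (n + 0))))
  ^≤C*! zero    (suc t) = z≤n
  ^≤C*! (suc n) (suc t) = begin
    suc n ^ suc t                                                            ≤⟨ bernoulli-upper n t ⟩
    n ^ suc t + suc t * suc n ^ t                                            ≤⟨ +-mono-≤ (^≤C*! n (suc t)) (*-monoʳ-≤ (suc t) (^≤C*! (suc n) t)) ⟩
    ((n + suc t) C suc t) * (suc t * t !) + suc t * (((suc n + t) C t) * t !) ≡⟨ cong (λ m → ((n + suc t) C suc t) * (suc t * t !) + suc t * ((m C t) * t !)) (sym (+-suc n t)) ⟩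
    ((n + suc t) C suc t) * (suc t * t !) + suc t * (((n + suc t) C t) * t !) ≡⟨ lemma ((n + suc t) C t) ((n + suc t) C suc t) (t !) t ⟩
    ((n + suc t) C t + (n + suc t) C suc t) * (suc t * t !)                  ≡⟨ cong (_* (suc t * t !)) (sym (pascal (n + suc t) t)) ⟩
    (suc (n + suc t) C suc t) * (suc t * t !)                                ∎
    where
    lemma : ∀ a b f t → b * (suc t * f) + suc t * (a * f) ≡ (a + b) * (suc t * f)
    lemma = solve-∀

  -- Stirling's lower bound for the factorial with 4 in place of e, from the trivial bound 4^n for
  -- the central binomial coefficient.
  n^n≤4^n*n! : ∀ n → n ^ n ≤ 4 ^ n * n !
  n^n≤4^n*n! n = begin
    n ^ n                  ≤⟨ ^≤C*! n n ⟩
    ((n + n) C n) * n !    ≤⟨ *-monoˡ-≤ (n !) (C≤2^ (n + n) n) ⟩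
    2 ^ (n + n) * n !      ≡⟨ cong (λ m → 2 ^ (n + m) * n !) (sym (+-identityʳ n)) ⟩
    2 ^ (2 * n) * n !      ≡⟨ cong (_* n !) (sym (^-*-assoc 2 2 n)) ⟩
    4 ^ n * n !            ∎

  -- The bound (4n/t)^t for the binomial coefficient, without division. The factor t^t is later
  -- supplied by the probability that `T` has many hits.
  C*t^t≤4^t*n^t : ∀ n t → (n C t) * t ^ t ≤ 4 ^ t * n ^ t
  C*t^t≤4^t*n^t n t = begin
    (n C t) * t ^ t            ≤⟨ *-monoʳ-≤ (n C t) (n^n≤4^n*n! t) ⟩
    (n C t) * (4 ^ t * t !)    ≡⟨ lemma (n C t) (4 ^ t) (t !) ⟩
    4 ^ t * ((n C t) * t !)    ≤⟨ *-monoʳ-≤ (4 ^ t) (C*!≤^ n t) ⟩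
    4 ^ t * n ^ t              ∎
    where
    lemma : ∀ a b c → a * (b * c) ≡ b * (a * c)
    lemma = solve-∀

  n≤2^n : ∀ n → n ≤ 2 ^ n
  n≤2^n zero    = z≤n
  n≤2^n (suc n) = begin
    suc n            ≤⟨ +-mono-≤ (m^n>0 2 n) (n≤2^n n) ⟩
    2 ^ n + 2 ^ n    ≡⟨ cong (2 ^ n +_) (sym (+-identityʳ (2 ^ n))) ⟩
    2 ^ suc n        ∎

  -- The exponent at i is at least 2 ^ k - 2 ^ (k - i), with equality for i ≤ k.
  module Exponents (k : ℕ) where
    exponent : ℕ → ℕ
    exponent zero    = 0
    exponent (suc i) = exponent i + 2 ^ (k ∸ suc i)

    1+exponent≤ : ∀ i → suc (exponent i) ≤ exponent (suc i)
    1+exponent≤ i = begin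
      1 + exponent i                 ≡⟨ +-comm 1 (exponent i) ⟩
      exponent i + 1                 ≤⟨ +-monoʳ-≤ (exponent i) (m^n>0 2 (k ∸ suc i)) ⟩
      exponent i + 2 ^ (k ∸ suc i)   ∎

    double : ∀ a x → a + x + x ≡ a + 2 * x
    double = solve-∀

    exponent-lower : ∀ i → 2 ^ k ≤ exponent i + 2 ^ (k ∸ i)
    exponent-lower zero    = ≤-refl
    exponent-lower (suc i) = begin
      2 ^ k                                              ≤⟨ exponent-lower i ⟩
      exponent i + 2 ^ (k ∸ i)                           ≤⟨ +-monoʳ-≤ (exponent i) (^-monoʳ-≤ 2 (m≤n+m∸n (k ∸ i) 1)) ⟩
      exponent i + 2 ^ suc (k ∸ i ∸ 1)                   ≡⟨ cong (λ z → exponent i + 2 ^ suc z) (trans (∸-+-assoc k i 1) (cong (k ∸_) (+-comm i 1))) ⟩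
      exponent i + 2 * 2 ^ (k ∸ suc i)                   ≡⟨ sym (double (exponent i) (2 ^ (k ∸ suc i))) ⟩
      exponent i + 2 ^ (k ∸ suc i) + 2 ^ (k ∸ suc i)     ∎

    exponent-upper : ∀ i → i ≤ k → exponent i + 2 ^ (k ∸ i) ≤ 2 ^ k
    exponent-upper zero    _   = ≤-refl
    exponent-upper (suc i) i<k = begin
      exponent i + 2 ^ (k ∸ suc i) + 2 ^ (k ∸ suc i)     ≡⟨ double (exponent i) (2 ^ (k ∸ suc i)) ⟩
      exponent i + 2 ^ suc (k ∸ suc i)                   ≡⟨ cong (λ z → exponent i + 2 ^ z) (sym (+-∸-assoc 1 i<k)) ⟩
      exponent i + 2 ^ (k ∸ i)                           ≤⟨ exponent-upper i (<⇒≤ i<k) ⟩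
      2 ^ k                                              ∎

    -- An equality for `i < k`: twice 2^k - 2^(k-i-1) exceeds the sum of 2^k - 2^(k-i) and 2^k - 1
    -- by exactly 1. Beyond `k` the exponent grows by 1 at each index, which still suffices.
    exponent-growth : ∀ i → 1 + (exponent i + exponent k) ≤ exponent (suc i) + exponent (suc i)
    exponent-growth i = begin
      1 + (exponent i + exponent k)                                   ≡⟨ rearrange (exponent i) (exponent k) ⟩
      exponent i + (exponent k + 2 ^ 0)                               ≡⟨ cong (λ z → exponent i + (exponent k + 2 ^ z)) (sym (n∸n≡0 k)) ⟩
      exponent i + (exponent k + 2 ^ (k ∸ k))                         ≤⟨ +-monoʳ-≤ (exponent i) (≤-trans (exponent-upper k ≤-refl) (exponent-lower (suc i))) ⟩
      exponent i + (exponent (suc i) + 2 ^ (k ∸ suc i))               ≡⟨ exchange (exponent i) (exponent (suc i)) (2 ^ (k ∸ suc i)) ⟩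
      exponent (suc i) + (exponent i + 2 ^ (k ∸ suc i))               ∎
      where
      rearrange : ∀ a b → 1 + (a + b) ≡ a + (b + 1)
      rearrange = solve-∀
      exchange : ∀ a b c → a + (b + c) ≡ b + (a + c)
      exchange = solve-∀

    exponent-mono : ∀ {i j} → i ≤ j → exponent i ≤ exponent j
    exponent-mono {j = j} z≤n = z≤n
    exponent-mono {suc i} {suc j} (s≤s i≤j) = +-mono-≤′ (m≤n⇒m<n∨m≡n i≤j)
      where
      +-mono-≤′ : i < j ⊎ i ≡ j → exponent (suc i) ≤ exponent (suc j)
      +-mono-≤′ (inj₁ i<j)  = ≤-trans (exponent-mono i<j) (<⇒≤ (1+exponent≤ j))
      +-mono-≤′ (inj₂ refl) = ≤-refl

-- Powers of rationals, and sums over all subsets.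

module RationalPowers where
  open RationalLemmas
  open import Data.Nat.Combinatorics using (_C_; k>n⇒nCk≡0)
  open import Data.Fin.Subset using (∣_∣)
  open import Data.Rational.Base hiding (∣_∣)
  open ℚSolver.+-*-Solver using (solve; con; _:+_; _:*_; _:=_)
  open ℚ.≤-Reasoning
  open FiniteSums
  open Counting
  open NaturalPowers

  ι-1 : ι 1 ≡ 1ℚ
  ι-1 = trans (ι-suc 0) (trans (cong (_+ 1ℚ) ι-0) (ℚ.+-identityˡ 1ℚ))

  ι-♯ : ∀ b → ι (♯ b) ≡ 𝟙 b
  ι-♯ false = ι-0
  ι-♯ true  = ι-1

  ι-sumℕ : ∀ {n} (f : Fin n → ℕ) → ι (sumℕ f) ≡ sum (ι ∘ f)
  ι-sumℕ {zero}  f = ι-0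
  ι-sumℕ {suc n} f = trans (ι-+ (f zero) (sumℕ (f ∘ suc))) (cong (ι (f zero) +_) (ι-sumℕ (f ∘ suc)))

  ι-count : ∀ {n} (P : Fin n → Bool) → ι (count P) ≡ sum (𝟙 ∘ P)
  ι-count P = trans (ι-sumℕ (♯ ∘ P)) (sum-cong-≗ (ι-♯ ∘ P))

  ι-* : ∀ m n → ι (m ℕ.* n) ≡ ι m * ι n
  ι-* zero    n = trans ι-0 (trans (sym (ℚ.*-zeroˡ (ι n))) (cong (_* ι n) (sym ι-0)))
  ι-* (suc m) n = begin-equality
    ι (n ℕ.+ m ℕ.* n)   ≡⟨ ι-+ n (m ℕ.* n) ⟩
    ι n + ι (m ℕ.* n)   ≡⟨ cong (ι n +_) (ι-* m n) ⟩
    ι n + ι m * ι n     ≡⟨ solve 2 (λ m n → n :+ m :* n := (m :+ con 1ℚ) :* n) refl (ι m) (ι n) ⟩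
    (ι m + 1ℚ) * ι n    ≡⟨ cong (_* ι n) (sym (ι-suc m)) ⟩
    ι (suc m) * ι n     ∎

  𝟙-∧ : ∀ a b → 𝟙 (a ∧ b) ≡ 𝟙 a * 𝟙 b
  𝟙-∧ false b = sym (ℚ.*-zeroˡ (𝟙 b))
  𝟙-∧ true  b = sym (ℚ.*-identityˡ (𝟙 b))

  0≤^ : ∀ {x} → 0ℚ ≤ x → ∀ n → 0ℚ ≤ x ^ n
  0≤^ 0≤x zero    = 0≤1
  0≤^ 0≤x (suc n) = 0≤* 0≤x (0≤^ 0≤x n)

  ^-monoˡ : ∀ {x y} → 0ℚ ≤ x → x ≤ y → ∀ n → x ^ n ≤ y ^ n
  ^-monoˡ 0≤x x≤y zero    = ℚ.≤-refl
  ^-monoˡ 0≤x x≤y (suc n) = *-mono (0≤^ 0≤x n) (ℚ.≤-trans 0≤x x≤y) x≤y (^-monoˡ 0≤x x≤y n)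

  1^n≡1 : ∀ n → 1ℚ ^ n ≡ 1ℚ
  1^n≡1 zero    = refl
  1^n≡1 (suc n) = trans (ℚ.*-identityˡ (1ℚ ^ n)) (1^n≡1 n)

  1≤^ : ∀ {x} → 1ℚ ≤ x → ∀ n → 1ℚ ≤ x ^ n
  1≤^ {x} 1≤x n = subst (_≤ x ^ n) (1^n≡1 n) (^-monoˡ 0≤1 1≤x n)

  ^≤1 : ∀ {x} → 0ℚ ≤ x → x ≤ 1ℚ → ∀ n → x ^ n ≤ 1ℚ
  ^≤1 {x} 0≤x x≤1 n = subst (x ^ n ≤_) (1^n≡1 n) (^-monoˡ 0≤x x≤1 n)

  ^-split : ∀ x {m n} → m ℕ.≤ n → x ^ n ≡ x ^ (n ℕ.∸ m) * x ^ m
  ^-split x {m} {n} m≤n = trans (cong (x ^_) (sym (ℕ.m∸n+n≡m m≤n))) (^-homo-* x (n ℕ.∸ m) m)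

  ^-monoʳ : ∀ {x m n} → 1ℚ ≤ x → m ℕ.≤ n → x ^ m ≤ x ^ n
  ^-monoʳ {x} {m} {n} 1≤x m≤n = subst₂ _≤_ (ℚ.*-identityˡ (x ^ m)) (sym (^-split x m≤n))
    (*-monoʳ (x ^ m) (0≤^ (ℚ.≤-trans 0≤1 1≤x) m) (1≤^ 1≤x (n ℕ.∸ m)))

  ^-antimonoʳ : ∀ {x m n} → 0ℚ ≤ x → x ≤ 1ℚ → m ℕ.≤ n → x ^ n ≤ x ^ m
  ^-antimonoʳ {x} {m} {n} 0≤x x≤1 m≤n = subst₂ _≤_ (sym (^-split x m≤n)) (ℚ.*-identityˡ (x ^ m))
    (*-monoʳ (x ^ m) (0≤^ 0≤x m) (^≤1 0≤x x≤1 (n ℕ.∸ m)))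

  ι-^ : ∀ m n → ι (m ℕ.^ n) ≡ ι m ^ n
  ι-^ m zero    = ι-1
  ι-^ m (suc n) = trans (ι-* m (m ℕ.^ n)) (cong (ι m *_) (ι-^ m n))

  prod-^ : ∀ {n} x (f : Fin n → ℕ) → prod (λ i → x ^ f i) ≡ x ^ sumℕ f
  prod-^ {zero}  x f = refl
  prod-^ {suc n} x f = trans (cong (x ^ f zero *_) (prod-^ x (f ∘ suc))) (sym (^-homo-* x (f zero) (sumℕ (f ∘ suc))))

  prod-1 : ∀ n → prod {n} (λ _ → 1ℚ) ≡ 1ℚ
  prod-1 n = trans (prod-^ {n} 1ℚ (λ _ → 0)) (1^n≡1 (sumℕ {n} (λ _ → 0)))

  ∑-allSubsets : ∀ n (f : Subset (suc n) → ℚ) →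
                 ∑ (allSubsets (suc n)) f ≡ ∑ (allSubsets n) (f ∘ (outside ∷_)) + ∑ (allSubsets n) (f ∘ (inside ∷_))
  ∑-allSubsets n f = trans (∑-++ (map (outside ∷_) (allSubsets n)) (map (inside ∷_) (allSubsets n)) f)
    (cong₂ _+_ (∑-map (outside ∷_) (allSubsets n) f) (∑-map (inside ∷_) (allSubsets n) f))

  -- Expansion of the product: a subset chooses one summand from every factor.
  ∑-prod : ∀ n (h : Fin n → Bool → ℚ) →
           ∑ (allSubsets n) (λ S → prod (λ u → h u (lookup S u))) ≡ prod (λ u → h u false + h u true)
  ∑-prod zero    h = ℚ.+-identityʳ 1ℚ
  ∑-prod (suc n) h = begin-equality
    ∑ (allSubsets (suc n)) (λ S → prod (λ u → h u (lookup S u)))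
      ≡⟨ ∑-allSubsets n (λ S → prod (λ u → h u (lookup S u))) ⟩
    ∑ (allSubsets n) (λ S → h zero false * P S) + ∑ (allSubsets n) (λ S → h zero true * P S)
      ≡⟨ cong₂ _+_ (∑-distrib-* (allSubsets n) (h zero false) P) (∑-distrib-* (allSubsets n) (h zero true) P) ⟩
    h zero false * ∑ (allSubsets n) P + h zero true * ∑ (allSubsets n) P
      ≡⟨ sym (ℚ.*-distribʳ-+ (∑ (allSubsets n) P) (h zero false) (h zero true)) ⟩
    (h zero false + h zero true) * ∑ (allSubsets n) P
      ≡⟨ cong ((h zero false + h zero true) *_) (∑-prod n (h ∘ suc)) ⟩
    prod (λ u → h u false + h u true) ∎
    where
    P : Subset n → ℚ
    P S = prod (λ u → h (suc u) (lookup S u))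

  -- Pascal's rule, according to whether the first element is chosen. The upper limit `m` is free
  -- because the two halves need different ranges; terms beyond `n` vanish.
  ∑-by-size : ∀ n m (w : ℕ → ℚ) → n ℕ.< m →
              ∑ (allSubsets n) (λ S → w ∣ S ∣) ≡ sum {m} (λ t → ι (n C toℕ t) * w (toℕ t))
  ∑-by-size zero (suc m) w _ = cong₂ _+_ (sym (trans (cong (_* w 0) (trans (cong ι (nC0≡1 0)) ι-1)) (ℚ.*-identityˡ (w 0))))
    (sym (trans (sum-cong-≗ {m} (λ t → trans (cong (_* w (suc (toℕ t))) (trans (cong ι (k>n⇒nCk≡0 {0} {suc (toℕ t)} (ℕ.s≤s ℕ.z≤n))) ι-0))
      (ℚ.*-zeroˡ (w (suc (toℕ t)))))) (sum-replicate-zero m)))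
  ∑-by-size (suc n) (suc m) w (ℕ.s≤s n<m) = begin-equality
    ∑ (allSubsets (suc n)) (λ S → w ∣ S ∣)
      ≡⟨ ∑-allSubsets n (λ S → w ∣ S ∣) ⟩
    ∑ (allSubsets n) (λ S → w ∣ S ∣) + ∑ (allSubsets n) (λ S → w (suc ∣ S ∣))
      ≡⟨ cong₂ _+_ (∑-by-size n (suc m) w (ℕ.m≤n⇒m≤1+n n<m)) (∑-by-size n m (w ∘ suc) n<m) ⟩
    ι (n C 0) * w 0 + sum {m} B + sum {m} A
      ≡⟨ solve 3 (λ x b a → x :+ b :+ a := x :+ (a :+ b)) refl (ι (n C 0) * w 0) (sum {m} B) (sum {m} A) ⟩
    ι (n C 0) * w 0 + (sum {m} A + sum {m} B)
      ≡⟨ cong₂ _+_ (cong (λ c → ι c * w 0) (trans (nC0≡1 n) (sym (nC0≡1 (suc n))))) (sym (∑-distrib-+ A B)) ⟩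
    ι (suc n C 0) * w 0 + sum {m} (λ t → A t + B t)
      ≡⟨ cong (ι (suc n C 0) * w 0 +_) (sum-cong-≗ {m} λ t → trans
           (sym (ℚ.*-distribʳ-+ (w (suc (toℕ t))) (ι (n C toℕ t)) (ι (n C suc (toℕ t)))))
           (cong (_* w (suc (toℕ t))) (trans (sym (ι-+ (n C toℕ t) (n C suc (toℕ t)))) (cong ι (sym (pascal n (toℕ t))))))) ⟩
    ι (suc n C 0) * w 0 + sum {m} (λ t → ι (suc n C suc (toℕ t)) * w (suc (toℕ t))) ∎
    where
    A B : Fin m → ℚ
    A t = ι (n C toℕ t) * w (suc (toℕ t))
    B t = ι (n C suc (toℕ t)) * w (suc (toℕ t))

  geometric : ∀ {x} → 0ℚ ≤ x → x + x ≤ 1ℚ → ∀ m → sum {m} (λ t → x ^ suc (toℕ t)) ≤ x + x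
  geometric {x} 0≤x 2x≤1 zero    = 0≤+ 0≤x 0≤x
  geometric {x} 0≤x 2x≤1 (suc m) = begin
    x ^ 1 + sum {m} (λ t → x * x ^ suc (toℕ t))  ≡⟨ cong₂ _+_ (ℚ.*-identityʳ x) (sym (*-distribˡ-sum {m} x (λ t → x ^ suc (toℕ t)))) ⟩
    x + x * sum {m} (λ t → x ^ suc (toℕ t))      ≤⟨ ℚ.+-monoʳ-≤ x (*-monoˡ x 0≤x (geometric 0≤x 2x≤1 m)) ⟩
    x + x * (x + x)                                  ≤⟨ ℚ.+-monoʳ-≤ x (*-monoˡ x 0≤x 2x≤1) ⟩
    x + x * 1ℚ                                       ≡⟨ cong (x +_) (ℚ.*-identityʳ x) ⟩
    x + x                                            ∎

-- Layered graphs, and large independent sets in sparse ones.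

module LayeredGraphs where
  open import Data.Fin.Subset using (_∈_)
  open import Data.Nat.Base
  open import Data.Nat.Properties
  open ≤-Reasoning
  open Counting

  ∧-true : ∀ {a b} → a ∧ b ≡ true → a ≡ true × b ≡ true
  ∧-true {true} {true} refl = refl , refl

  ∧-intro : ∀ {a b} → a ≡ true → b ≡ true → a ∧ b ≡ true
  ∧-intro refl refl = refl

  <⇒<ᵇ≡true : ∀ {m n} → m < n → (m <ᵇ n) ≡ true
  <⇒<ᵇ≡true h = Bool.T-≡ .Equivalence.to (<⇒<ᵇ h)

  <ᵇ≡true⇒< : ∀ m n → (m <ᵇ n) ≡ true → m < n
  <ᵇ≡true⇒< m n h = <ᵇ⇒< m n (Bool.T-≡ .Equivalence.from h)

  ≥⇒not<ᵇ : ∀ {m n} → n ≤ m → not (m <ᵇ n) ≡ true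
  ≥⇒not<ᵇ {m} {n} h = cong not (dec-false (m <? n) (≤⇒≯ h))

  not<ᵇ⇒≥ : ∀ m n → not (m <ᵇ n) ≡ true → n ≤ m
  not<ᵇ⇒≥ m n h = ≮⇒≥ λ m<n → case trans (sym h) (cong not (<⇒<ᵇ≡true m<n)) of λ ()

  does-true : ∀ {P : Set} (P? : Dec P) → does P? ≡ true → P
  does-true (yes p) _ = p

  -- The vertices below n 0, n 1, …, n k form an increasing chain of sets. Every vertex outside the i-th set
  -- picks M vertices of that set, its neighbours.
  module Layers (k M : ℕ) (n : ℕ → ℕ) (n-mono : ∀ {i j} → i ≤ j → n i ≤ n j) where

    Q : ℕ
    Q = n k

    Picks : Set
    Picks = Vec (Vec (Vec (Fin Q) M) k) Q

    pick : Picks → Fin Q → Fin k → Fin M → Fin Q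
    pick ω v i r = lookup (lookup (lookup ω v) i) r

    -- A pick is an arbitrary element of `Fin Q`, since the search behind `attain` may leave the
    -- layer. The bound on `u` discards such picks.
    Arc : Picks → Fin Q → Fin Q → Set
    Arc ω v u = ∃[ i ] ∃[ r ] toℕ u < n (toℕ i) × n (toℕ i) ≤ toℕ v × pick ω v i r ≡ u

    arc? : ∀ ω v u → Dec (Arc ω v u)
    arc? ω v u = Fin.any? λ i → Fin.any? λ r →
      (toℕ u <? n (toℕ i)) ×-dec (n (toℕ i) ≤? toℕ v) ×-dec (pick ω v i r Fin.≟ u)

    arc-decreases : ∀ {ω v u} → Arc ω v u → toℕ u < toℕ v
    arc-decreases (i , r , u<n , n≤v , _) = <-≤-trans u<n n≤v

    graph : Picks → Graph
    graph ω = record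
      { v          = Q
      ; adj        = λ u v → does (arc? ω u v) ∨ does (arc? ω v u)
      ; adj-sym    = λ u v → Bool.∨-comm (does (arc? ω u v)) (does (arc? ω v u))
      ; adj-irrefl = λ u → let ¬uu = dec-false (arc? ω u u) (λ a → <-irrefl refl (arc-decreases {ω} a)) in cong₂ _∨_ ¬uu ¬uu
      }

    ArcFree : Picks → (Fin Q → Bool) → Set
    ArcFree ω I = ∀ u v → I u ≡ true → I v ≡ true → ¬ Arc ω v u

    arcFree⇒independent : ∀ {ω I} → ArcFree ω I → Independent (Graph.adj (graph ω)) (tabulate I)
    arcFree⇒independent {ω} {I} free u v u∈ v∈ uv with Bool.T-∨ {does (arc? ω u v)} .Equivalence.to uv
    ... | inj₁ a = free v u (in-I v∈) (in-I u∈) (does-true (arc? ω u v) (Bool.T-≡ .Equivalence.to a))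
      where
      in-I : ∀ {u} → u ∈ tabulate I → I u ≡ true
      in-I {u} u∈ = trans (sym (Vec.lookup∘tabulate I u)) (Vec.[]=⇒lookup u∈)
    ... | inj₂ a = free u v (in-I u∈) (in-I v∈) (does-true (arc? ω v u) (Bool.T-≡ .Equivalence.to a))
      where
      in-I : ∀ {u} → u ∈ tabulate I → I u ≡ true
      in-I {u} u∈ = trans (sym (Vec.lookup∘tabulate I u)) (Vec.[]=⇒lookup u∈)

    independent⇒arcFree : ∀ {ω I} → Independent (Graph.adj (graph ω)) I → ArcFree ω (lookup I)
    independent⇒arcFree {ω} {I} ind u v u∈ v∈ a = ind u v (Vec.lookup⇒[]= u I u∈) (Vec.lookup⇒[]= v I v∈)
      (Bool.T-∨ {does (arc? ω u v)} .Equivalence.from (inj₂ (Bool.T-≡ .Equivalence.from (dec-true (arc? ω v u) a))))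

    below : ℕ → Fin Q → Bool
    below i u = toℕ u <ᵇ n i

    -- Picks are counted with multiplicity, instead of arcs: `hits` then is a sum of functions of
    -- single picks, which are independent.
    hit : Picks → (Fin Q → Bool) → Fin Q → Fin k → Fin M → Bool
    hit ω T v i r = T v ∧ (not (below (toℕ i) v) ∧ (below (toℕ i) (pick ω v i r) ∧ T (pick ω v i r)))

    degree : Picks → (Fin Q → Bool) → Fin Q → ℕ
    degree ω T v = sumℕ λ i → sumℕ λ r → ♯ (hit ω T v i r)

    hits : Picks → (Fin Q → Bool) → ℕ
    hits ω T = sumℕ (degree ω T)

    Sparse : Picks → Set
    Sparse ω = ∀ q → q < k → ∀ T → (∀ u → T u ≡ true → n q ≤ toℕ u) →
               0 < count T → count T < 4 * n q → hits ω T < 2 * count T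

    -- A pick has only one value, so different out-neighbours of `v` in `T` use up different picks.
    arcs≤degree : ∀ ω T v → T v ≡ true → count (λ u → T u ∧ does (arc? ω v u)) ≤ degree ω T v
    arcs≤degree ω T v Tv = begin
      count (λ u → T u ∧ does (arc? ω v u))                ≤⟨ sumℕ-mono pointwise ⟩
      sumℕ (λ u → sumℕ λ i → sumℕ λ r → ♯ (term u i r))    ≡⟨ sumℕ-comm (λ u i → sumℕ λ r → ♯ (term u i r)) ⟩
      sumℕ (λ i → sumℕ λ u → sumℕ λ r → ♯ (term u i r))    ≡⟨ sumℕ-cong (λ i → sumℕ-comm (λ u r → ♯ (term u i r))) ⟩
      sumℕ (λ i → sumℕ λ r → count λ u → term u i r)       ≤⟨ sumℕ-mono (λ i → sumℕ-mono (λ r → single (hit ω T v i r) (pick ω v i r))) ⟩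
      degree ω T v                                         ∎
      where
      term : Fin Q → Fin k → Fin M → Bool
      term u i r = hit ω T v i r ∧ does (pick ω v i r Fin.≟ u)
      single : ∀ b (p : Fin Q) → count (λ u → b ∧ does (p Fin.≟ u)) ≤ ♯ b
      single false p = ≤-reflexive (count-none Q)
      single true  p = ≤-reflexive (count-≡ p)
      pointwise : ∀ u → ♯ (T u ∧ does (arc? ω v u)) ≤ sumℕ λ i → sumℕ λ r → ♯ (term u i r)
      pointwise u with T u in Tu | arc? ω v u
      ... | false | _    = z≤n
      ... | true  | no _ = z≤n
      ... | true  | yes (i , r , u<n , n≤v , refl) = begin
        1                                    ≡⟨ cong ♯ (sym (∧-intro (∧-intro Tv (∧-intro (≥⇒not<ᵇ n≤v) (∧-intro (<⇒<ᵇ≡true u<n) Tu)))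
                                                                (dec-true (pick ω v i r Fin.≟ u) refl))) ⟩
        ♯ (term u i r)                       ≤⟨ term≤sumℕ (λ r → ♯ (term u i r)) r ⟩
        sumℕ (λ r → ♯ (term u i r))          ≤⟨ term≤sumℕ (λ i → sumℕ λ r → ♯ (term u i r)) i ⟩
        sumℕ (λ i → sumℕ λ r → ♯ (term u i r)) ∎

    -- Greedy colouring in increasing order.
    fourColouring : ∀ ω (T : Fin Q → Bool) → (∀ v → T v ≡ true → count (λ u → T u ∧ does (arc? ω v u)) < 4) →
                    ∃[ c ] (∀ u v → T u ≡ true → T v ≡ true → Arc ω v u → c u ≢ c v)
    fourColouring ω T few =
      let (c , proper) = colour Q in c , λ u v Tu Tv → proper u v (Fin.toℕ<n v) Tu Tv
      where
      Proper : ℕ → (Fin Q → Fin 4) → Set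
      Proper m c = ∀ u v → toℕ v < m → T u ≡ true → T v ≡ true → Arc ω v u → c u ≢ c v
      colour : ∀ m → ∃[ c ] Proper m c
      colour zero    = (λ _ → zero) , λ _ _ ()
      colour (suc m) = extend (colour m) (m <? Q)
        where
        extend : ∃[ c ] Proper m c → Dec (m < Q) → ∃[ c ] Proper (suc m) c
        extend (c , proper) (no m≮Q) = c , λ u v _ → proper u v (<-≤-trans (Fin.toℕ<n v) (≮⇒≥ m≮Q))
        extend (c , proper) (yes m<Q) = choose (T v₀) refl
          where
          v₀ = fromℕ< m<Q
          toℕ-v₀ : toℕ v₀ ≡ m
          toℕ-v₀ = Fin.toℕ-fromℕ< m<Q
          older : ∀ v → toℕ v < suc m → v ≢ v₀ → toℕ v < m
          older v v<1+m v≢v₀ = ≤∧≢⇒< (s≤s⁻¹ v<1+m) λ e → v≢v₀ (Fin.toℕ-injective (trans e (sym toℕ-v₀)))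
          choose : ∀ b → T v₀ ≡ b → ∃[ c ] Proper (suc m) c
          choose false Tv₀ = c , λ u v v<1+m Tu Tv → proper u v (older v v<1+m λ { refl → case trans (sym Tv) Tv₀ of λ () }) Tu Tv
          choose true  Tv₀ = (λ w → if does (w Fin.≟ v₀) then col else c w) , proper′
            where
            neighbour : Fin Q → Bool
            neighbour u = T u ∧ does (arc? ω v₀ u)
            used : Fin 4 → ℕ
            used j = count λ u → neighbour u ∧ does (c u Fin.≟ j)
            single : ∀ b (p : Fin 4) → count (λ j → b ∧ does (p Fin.≟ j)) ≤ ♯ b
            single false p = ≤-reflexive (count-none 4)
            single true  p = ≤-reflexive (count-≡ p)
            total : sumℕ used < 4
            total = begin-strict
              sumℕ used                                                ≡⟨ sumℕ-comm (λ j u → ♯ (neighbour u ∧ does (c u Fin.≟ j))) ⟩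
              sumℕ (λ u → count λ j → neighbour u ∧ does (c u Fin.≟ j)) ≤⟨ sumℕ-mono (λ u → single (neighbour u) (c u)) ⟩
              count neighbour                                          <⟨ few v₀ Tv₀ ⟩
              4                                                        ∎
            col = proj₁ (sumℕ<n⇒∃0 used total)
            unused : ∀ u → T u ≡ true → Arc ω v₀ u → c u ≢ col
            unused u Tu a cu≡col = case n≤0⇒n≡0 (begin
              1                                        ≡⟨ cong ♯ (sym (∧-intro (∧-intro Tu (dec-true (arc? ω v₀ u) a)) (dec-true (c u Fin.≟ col) cu≡col))) ⟩
              ♯ (neighbour u ∧ does (c u Fin.≟ col))   ≤⟨ term≤sumℕ (λ u → ♯ (neighbour u ∧ does (c u Fin.≟ col))) u ⟩
              used col                                 ≡⟨ proj₂ (sumℕ<n⇒∃0 used total) ⟩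
              0                                        ∎) of λ ()
            proper′ : Proper (suc m) (λ w → if does (w Fin.≟ v₀) then col else c w)
            proper′ u v v<1+m Tu Tv a = cases (u Fin.≟ v₀) (v Fin.≟ v₀)
              where
              cases : (d : Dec (u ≡ v₀)) (e : Dec (v ≡ v₀)) → (if does d then col else c u) ≢ (if does e then col else c v)
              cases (yes u≡v₀) (yes v≡v₀) = contradiction (arc-decreases {ω} a) (<-irrefl (cong toℕ (trans u≡v₀ (sym v≡v₀))))
              -- Arcs lead to smaller vertices, so no vertex coloured earlier has an arc to `v₀`.
              cases (yes u≡v₀) (no v≢v₀)  = contradiction (arc-decreases {ω} a)
                (<⇒≯ (subst (toℕ v <_) (sym (trans (cong toℕ u≡v₀) toℕ-v₀)) (older v v<1+m v≢v₀)))
              cases (no _)     (yes v≡v₀) = unused u Tu (subst (λ w → Arc ω w u) v≡v₀ a)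
              cases (no _)     (no v≢v₀)  = proper u v (older v v<1+m v≢v₀) Tu Tv a

    -- At most half of the vertices of T have four or more picks in T; the others are 4-colourable.
    sparse⇒large : ∀ ω T → hits ω T < 2 * count T →
                   ∃[ I ] (∀ u → I u ≡ true → T u ≡ true) × ArcFree ω I × count T ≤ 8 * count I
    sparse⇒large ω T few = I , (λ u Iu → proj₁ (∧-true (proj₁ (∧-true Iu)))) , free , (begin
        count T                  ≤⟨ half ⟩
        2 * count low            ≤⟨ *-monoʳ-≤ 2 (≤-trans low≤ (proj₂ biggest)) ⟩
        2 * (4 * count I)        ≡⟨ sym (*-assoc 2 4 (count I)) ⟩
        8 * count I              ∎)
      where
      low high : Fin Q → Bool
      low  v = T v ∧ (degree ω T v <ᵇ 4)
      high v = T v ∧ not (degree ω T v <ᵇ 4)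
      4high≤hits : 4 * count high ≤ hits ω T
      4high≤hits = ≤-trans (≤-reflexive (*-distribˡ-sumℕ 4 (λ v → ♯ (high v)))) (sumℕ-mono λ v → pointwise (T v) (degree ω T v))
        where
        pointwise : ∀ b d → 4 * ♯ (b ∧ not (d <ᵇ 4)) ≤ d
        pointwise false d = z≤n
        pointwise true  d with d <ᵇ 4 in eq
        ... | true  = z≤n
        ... | false = not<ᵇ⇒≥ d 4 (cong not eq)
      half : count T ≤ 2 * count low
      half = +-cancelʳ-≤ (count T) (count T) (2 * count low) (begin
        count T + count T                       ≡⟨ cong (λ z → z + z) split ⟩
        count low + count high + (count low + count high) ≡⟨ rearrange (count low) (count high) ⟩
        2 * count low + 2 * count high          ≤⟨ +-monoʳ-≤ (2 * count low) 2high≤ ⟩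
        2 * count low + count T                 ∎)
        where
        split = count-split T (λ v → degree ω T v <ᵇ 4)
        rearrange : ∀ a b → a + b + (a + b) ≡ 2 * a + 2 * b
        rearrange = solve-∀
        2high≤ : 2 * count high ≤ count T
        2high≤ = *-cancelˡ-≤ 2 (≤-trans (≤-reflexive (sym (*-assoc 2 2 (count high)))) (≤-trans 4high≤hits (<⇒≤ few)))
      low-degree : ∀ v → low v ≡ true → count (λ u → low u ∧ does (arc? ω v u)) < 4
      low-degree v lv = let (Tv , dv) = ∧-true lv in ≤-<-trans
        (≤-trans (count-mono {P = λ u → low u ∧ does (arc? ω v u)} {R = λ u → T u ∧ does (arc? ω v u)} λ u h → let (lu , a) = ∧-true {low u} h in ∧-intro {T u} (proj₁ (∧-true {T u} lu)) a) (arcs≤degree ω T v Tv))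
        (<ᵇ≡true⇒< (degree ω T v) 4 dv)
      colouring = fourColouring ω low low-degree
      c = proj₁ colouring
      class : Fin 4 → Fin Q → Bool
      class j v = low v ∧ does (c v Fin.≟ j)
      biggest = sumℕ≤n*max (count ∘ class)
      I = class (proj₁ biggest)
      low≤ : count low ≤ sumℕ (count ∘ class)
      low≤ = begin
        count low                                  ≤⟨ sumℕ-mono (λ v → single (low v) (c v)) ⟩
        sumℕ (λ v → count λ j → class j v)         ≡⟨ sumℕ-comm (λ v j → ♯ (class j v)) ⟩
        sumℕ (λ j → count (class j))               ∎
        where
        single : ∀ b (p : Fin 4) → ♯ b ≤ count (λ j → b ∧ does (p Fin.≟ j))
        single false p = z≤n
        single true  p = ≤-reflexive (sym (count-≡ p))
      free : ArcFree ω I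
      free u v Iu Iv a = let (lu , cu) = ∧-true Iu; (lv , cv) = ∧-true Iv in
        proj₂ colouring u v lu lv a (trans (does-true (c u Fin.≟ _) cu) (sym (does-true (c v Fin.≟ _) cv)))

    -- The final alternative says that no layer ends strictly between `m` and `n q`. An arc between
    -- vertices in [m , n q) would need a layer that contains one of them but not the other.
    threshold : ∀ s j → s < 4 * n j →
                ∃[ q ] ∃[ m ] s < 4 * n q × 4 * m ≤ s × (∀ i → n i ≤ m ⊎ n q ≤ n i)
    threshold s zero    h = zero , zero , h , z≤n , λ i → inj₂ (n-mono z≤n)
    threshold s (suc j) h with s <? 4 * n j
    ... | yes s<4nⱼ = threshold s j s<4nⱼ
    ... | no s≮4nⱼ  = suc j , n j , h , ≮⇒≥ s≮4nⱼ , separated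
      where
      separated : ∀ i → n i ≤ n j ⊎ n (suc j) ≤ n i
      separated i with i ≤? j
      ... | yes i≤j = inj₁ (n-mono i≤j)
      ... | no i≰j  = inj₂ (n-mono (≰⇒> i≰j))

    -- With q minimal such that |S| < 4 n_q and m = n_{q-1} (or 0), at most a quarter of S lies below m, and
    -- S ∩ [m , n_q) contains no arc.
    large-arcFree : ∀ ω → Sparse ω → ∀ S → 0 < count S →
                    ∃[ I ] (∀ u → I u ≡ true → S u ≡ true) × ArcFree ω I × count S ≤ 16 * count I
    large-arcFree ω sparse S 0<s =
      let (q , m , s<4n , 4m≤s , separated) = threshold (count S) k
            (≤-<-trans (count≤n S) (m<n*m (≤-trans 0<s (count≤n S))))
      in split q m s<4n 4m≤s separated
      where
      m<n*m : ∀ {m} → 0 < m → m < 4 * m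
      m<n*m {m} 0<m = m<m+n m (≤-trans 0<m (m≤m+n m _))
      split : ∀ q m → count S < 4 * n q → 4 * m ≤ count S → (∀ i → n i ≤ m ⊎ n q ≤ n i) →
              ∃[ I ] (∀ u → I u ≡ true → S u ≡ true) × ArcFree ω I × count S ≤ 16 * count I
      split q m s<4n 4m≤s separated with count S ≤? 2 * count (λ u → S u ∧ not (below q u))
      ... | yes s≤2t = let (I , I⊆T , free , t≤8I) = sparse⇒large ω T (sparse q q<k T T-above 0<t (≤-<-trans t≤s s<4n)) in
          I , (λ u Iu → proj₁ (∧-true {S u} (I⊆T u Iu))) , free , (begin
            count S              ≤⟨ s≤2t ⟩
            2 * count T          ≤⟨ *-monoʳ-≤ 2 t≤8I ⟩
            2 * (8 * count I)    ≡⟨ sym (*-assoc 2 8 (count I)) ⟩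
            16 * count I         ∎)
        where
        T : Fin Q → Bool
        T u = S u ∧ not (below q u)
        T-above : ∀ u → T u ≡ true → n q ≤ toℕ u
        T-above u Tu = not<ᵇ⇒≥ (toℕ u) (n q) (proj₂ (∧-true {S u} Tu))
        t≤s : count T ≤ count S
        t≤s = count-mono {P = T} λ u Tu → proj₁ (∧-true {S u} Tu)
        0<t : 0 < count T
        0<t = *-cancelˡ-< 2 0 (count T) (<-≤-trans 0<s s≤2t)
        q<k : q < k
        -- `T` is nonempty and lies above `n q`, while every vertex lies below `n k`.
        q<k = let (u , Tu) = count>0⇒∃ T 0<t in
          ≰⇒> λ k≤q → <-irrefl refl (<-≤-trans (Fin.toℕ<n u) (≤-trans (n-mono k≤q) (T-above u Tu)))
      ... | no s≰2t = I , (λ u Iu → proj₁ (∧-true {S u} (proj₁ (∧-true {S u ∧ below q u} Iu)))) , free , s≤16I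
        where
        inner outer low : Fin Q → Bool
        inner u = S u ∧ below q u
        outer u = S u ∧ not (below q u)
        low   u = inner u ∧ (toℕ u <ᵇ m)
        I : Fin Q → Bool
        I u = inner u ∧ not (toℕ u <ᵇ m)
        free : ArcFree ω I
        free u v Iu Iv (i , r , u<n , n≤v , _) with separated (toℕ i)
        ... | inj₁ n≤m = <⇒≱ u<n (≤-trans n≤m (not<ᵇ⇒≥ (toℕ u) m (proj₂ (∧-true {inner u} Iu))))
        ... | inj₂ n≤n = <⇒≱ (<ᵇ≡true⇒< (toℕ v) (n q) (proj₂ (∧-true {S v} (proj₁ (∧-true {inner v} Iv))))) (≤-trans n≤n n≤v)
        low≤m : count low ≤ m
        low≤m = ≤-trans (count-mono {P = low} λ u h → proj₂ (∧-true {inner u} h)) (count-below-≤ Q m)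
        s≤16I : count S ≤ 16 * count I
        s≤16I = begin
          count S        ≤⟨ +-cancelˡ-≤ (3 * count S) (count S) (4 * count I) bound ⟩
          4 * count I    ≤⟨ *-monoˡ-≤ (count I) {4} {16} (m≤m+n 4 12) ⟩
          16 * count I   ∎
          where
          rearrange : ∀ l i o → 4 * (l + i + o) ≡ 4 * l + 2 * (2 * o) + 4 * i
          rearrange = solve-∀
          -- At most a quarter of `S` is in `low` and at most half in `outer`, which leaves a
          -- quarter for `I`.
          bound : 3 * count S + count S ≤ 3 * count S + 4 * count I
          bound = begin
            3 * count S + count S                                ≡⟨ +-comm (3 * count S) (count S) ⟩
            4 * count S                                          ≡⟨ cong (4 *_) (trans (count-split S (below q)) (cong (_+ count outer) (count-split inner (λ u → toℕ u <ᵇ m)))) ⟩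
            4 * (count low + count I + count outer)              ≡⟨ rearrange (count low) (count I) (count outer) ⟩
            4 * count low + 2 * (2 * count outer) + 4 * count I  ≤⟨ +-monoˡ-≤ (4 * count I) (+-mono-≤ (≤-trans (*-monoʳ-≤ 4 low≤m) 4m≤s) (*-monoʳ-≤ 2 (<⇒≤ (≰⇒> s≰2t)))) ⟩
            count S + 2 * count S + 4 * count I                  ∎

-- A dual solution that bounds the fractional chromatic number from below.

module LowerBounds where
  open RationalLemmas
  open import Data.Rational.Base hiding (∣_∣)
  open ℚSolver.+-*-Solver using (solve; con; _:+_; _:*_; _:=_)
  open ℚ.≤-Reasoning
  open FiniteSums
  open Counting
  open RationalPowers
  open LayeredGraphs
  open FractionalChromaticNumbers

  does-∈? : ∀ {n} (u : Fin n) (I : Subset n) → does (u ∈? I) ≡ lookup I u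
  does-∈? u I with u ∈? I | lookup I u in eq
  ... | yes u∈ | b     = trans (sym (Vec.[]=⇒lookup u∈)) eq
  ... | no u∉  | true  = contradiction (Vec.lookup⇒[]= u I eq) u∉
  ... | no _   | false = refl

  module LayersLowerBound (k M : ℕ) (n : ℕ → ℕ) (n-mono : ∀ {i j} → i ℕ.≤ j → n i ℕ.≤ n j) (n-pos : ∀ i → 0 ℕ.< n i) where
    open Layers k M n n-mono

    Heavy : (Fin Q → Bool) → Fin k → Set
    Heavy I i = 2 ℕ.* n (toℕ i) ℕ.≤ k ℕ.* count (λ u → I u ∧ below (toℕ i) u)

    heavy? : ∀ I i → Dec (Heavy I i)
    heavy? I i = 2 ℕ.* n (toℕ i) ℕ.≤? k ℕ.* count (λ u → I u ∧ below (toℕ i) u)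

    Spread : Picks → Set
    Spread ω = ∀ i j → toℕ i ℕ.< toℕ j → ∀ I → ArcFree ω I → Heavy I i → Heavy I j → ⊥

    suc-pred-n : ∀ i → suc (pred (n i)) ≡ n i
    suc-pred-n i = ℕ.suc-pred (n i) {{ℕ.>-nonZero (n-pos i)}}

    -- The reciprocal of the layer size; `pred` undoes the shift by one in `recip`.
    r : Fin k → ℚ
    r i = recip (pred (n (toℕ i)))

    r-n : ∀ i → r i * ι (n (toℕ i)) ≡ 1ℚ
    r-n i = trans (cong (λ z → r i * ι z) (sym (suc-pred-n (toℕ i)))) (recip-ι (pred (n (toℕ i))))

    0≤r : ∀ i → 0ℚ ≤ r i
    0≤r i = ℚ.<⇒≤ (0<recip (pred (n (toℕ i))))

    ι-below : ∀ (i : Fin k) → sum (λ u → 𝟙 (below (toℕ i) u)) ≡ ι (n (toℕ i))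
    ι-below i = trans (sym (ι-count (below (toℕ i)))) (cong ι (count-below (n-mono (Fin.toℕ≤n i))))

    density : (Fin Q → Bool) → Fin k → ℚ
    density I i = r i * ι (count (λ u → I u ∧ below (toℕ i) u))

    density≤1 : ∀ I i → density I i ≤ 1ℚ
    density≤1 I i = begin
      r i * ι (count (λ u → I u ∧ below (toℕ i) u)) ≤⟨ *-monoˡ (r i) (0≤r i) (ι-mono (ℕ.≤-trans
                                                         (count-mono {P = λ u → I u ∧ below (toℕ i) u} λ u h → proj₂ (∧-true {I u} h))
                                                         (count-below-≤ Q (n (toℕ i))))) ⟩
      r i * ι (n (toℕ i))                           ≡⟨ r-n i ⟩
      1ℚ                                            ∎

    light : ∀ I i → ¬ Heavy I i → ι k * density I i ≤ ι 2
    light I i ¬heavy = begin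
      ι k * (r i * ι c)            ≡⟨ solve 3 (λ k r c → k :* (r :* c) := r :* (k :* c)) refl (ι k) (r i) (ι c) ⟩
      r i * (ι k * ι c)            ≡⟨ cong (r i *_) (sym (ι-* k c)) ⟩
      r i * ι (k ℕ.* c)            ≤⟨ *-monoˡ (r i) (0≤r i) (ι-mono (ℕ.<⇒≤ (ℕ.≰⇒> ¬heavy))) ⟩
      r i * ι (2 ℕ.* n (toℕ i))    ≡⟨ cong (r i *_) (ι-* 2 (n (toℕ i))) ⟩
      r i * (ι 2 * ι (n (toℕ i)))  ≡⟨ solve 3 (λ r t n → r :* (t :* n) := (r :* n) :* t) refl (r i) (ι 2) (ι (n (toℕ i))) ⟩
      r i * ι (n (toℕ i)) * ι 2    ≡⟨ trans (cong (_* ι 2) (r-n i)) (ℚ.*-identityˡ (ι 2)) ⟩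
      ι 2                          ∎
      where c = count (λ u → I u ∧ below (toℕ i) u)

    -- At most one i is heavy for an arc-free set.
    density-sum : ∀ ω → Spread ω → 0 ℕ.< k → ∀ I → ArcFree ω I → sum (density I) ≤ ι 3
    density-sum ω spread 0<k I free = ℚ.*-cancelˡ-≤-pos (ι k) {{positive ι-k-pos}} (scaled (Fin.any? (heavy? I)))
      where
      ι-k-pos : 0ℚ < ι k
      ι-k-pos = subst (λ z → 0ℚ < ι z) (ℕ.suc-pred k {{ℕ.>-nonZero 0<k}}) (0<ι-suc (pred k))
      scaled : Dec (∃[ i ] Heavy I i) → ι k * sum (density I) ≤ ι k * ι 3
      scaled (no none) = begin
        ι k * sum (density I)            ≡⟨ *-distribˡ-sum (ι k) (density I) ⟩
        sum (λ i → ι k * density I i)    ≤⟨ sum-mono (λ i → light I i (λ h → none (i , h))) ⟩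
        sum {k} (λ _ → ι 2)              ≡⟨ sum-const k (ι 2) ⟩
        ι k * ι 2                        ≤⟨ *-monoˡ (ι k) (0≤ι k) (ι-mono (ℕ.n≤1+n 2)) ⟩
        ι k * ι 3                        ∎
      scaled (yes (i₀ , heavy)) = begin
        ι k * sum (density I)                                ≡⟨ *-distribˡ-sum (ι k) (density I) ⟩
        sum (λ i → ι k * density I i)                        ≤⟨ sum-mono (λ i → pointwise i (i₀ Fin.≟ i)) ⟩
        -- After scaling by `k`, a light layer contributes at most 2 and the heavy one at most `k`:
        -- in total 2k + k.
        sum (λ i → ι 2 + ι k * 𝟙 (does (i₀ Fin.≟ i)))        ≡⟨ ∑-distrib-+ (λ _ → ι 2) (λ i → ι k * 𝟙 (does (i₀ Fin.≟ i))) ⟩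
        sum {k} (λ _ → ι 2) + sum (λ i → ι k * 𝟙 (does (i₀ Fin.≟ i)))
                                                             ≡⟨ cong₂ _+_ (sum-const k (ι 2)) (sym (*-distribˡ-sum (ι k) (λ i → 𝟙 (does (i₀ Fin.≟ i))))) ⟩
        ι k * ι 2 + ι k * sum (λ i → 𝟙 (does (i₀ Fin.≟ i)))  ≡⟨ cong (λ z → ι k * ι 2 + ι k * z)
                                                                  (trans (sym (ι-count (λ i → does (i₀ Fin.≟ i)))) (trans (cong ι (count-≡ i₀)) ι-1)) ⟩
        ι k * ι 2 + ι k * 1ℚ                                 ≡⟨ sym (ℚ.*-distribˡ-+ (ι k) (ι 2) 1ℚ) ⟩
        ι k * (ι 2 + 1ℚ)                                     ≡⟨ cong (ι k *_) (sym (ι-suc 2)) ⟩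
        ι k * ι 3                                            ∎
        where
        pointwise : ∀ i → (d : Dec (i₀ ≡ i)) → ι k * density I i ≤ ι 2 + ι k * 𝟙 (does d)
        pointwise i (yes _) = begin
          ι k * density I i   ≤⟨ *-monoˡ (ι k) (0≤ι k) (density≤1 I i) ⟩
          ι k * 1ℚ            ≡⟨ sym (ℚ.+-identityˡ (ι k * 1ℚ)) ⟩
          0ℚ + ι k * 1ℚ       ≤⟨ ℚ.+-monoˡ-≤ (ι k * 1ℚ) (0≤ι 2) ⟩
          ι 2 + ι k * 1ℚ      ∎
        pointwise i (no i₀≢i) = begin
          ι k * density I i   ≤⟨ light I i ¬heavy ⟩
          ι 2                 ≡⟨ solve 2 (λ t k → t := t :+ k :* con 0ℚ) refl (ι 2) (ι k) ⟩
          ι 2 + ι k * 0ℚ      ∎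
          where
          ¬heavy : ¬ Heavy I i
          ¬heavy h with ℕ.<-cmp (toℕ i₀) (toℕ i)
          ... | tri< lt _ _ = spread i₀ i lt I free heavy h
          ... | tri≈ _ eq _ = i₀≢i (Fin.toℕ-injective eq)
          ... | tri> _ _ gt = spread i i₀ gt I free h heavy

    -- The dual solution, before scaling: the sum of the uniform probability distributions on the
    -- `k` layers.
    weight : Fin Q → ℚ
    weight u = sum (λ i → r i * 𝟙 (below (toℕ i) u))

    sum-weight : sum weight ≡ ι k
    sum-weight = begin-equality
      sum (λ u → sum (λ i → r i * 𝟙 (below (toℕ i) u)))  ≡⟨ ∑-comm (λ u i → r i * 𝟙 (below (toℕ i) u)) ⟩
      sum (λ i → sum (λ u → r i * 𝟙 (below (toℕ i) u)))  ≡⟨ sum-cong-≗ (λ i → trans (sym (*-distribˡ-sum (r i) (λ u → 𝟙 (below (toℕ i) u))))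
                                                              (trans (cong (r i *_) (ι-below i)) (r-n i))) ⟩
      sum {k} (λ _ → 1ℚ)                                 ≡⟨ trans (sum-const k 1ℚ) (ℚ.*-identityʳ (ι k)) ⟩
      ι k                                                ∎

    weight-of : ∀ I → sum (λ u → 𝟙 (I u) * weight u) ≡ sum (density I)
    weight-of I = begin-equality
      sum (λ u → 𝟙 (I u) * weight u)
        ≡⟨ sum-cong-≗ (λ u → *-distribˡ-sum (𝟙 (I u)) (λ i → r i * 𝟙 (below (toℕ i) u))) ⟩
      sum (λ u → sum (λ i → 𝟙 (I u) * (r i * 𝟙 (below (toℕ i) u))))
        ≡⟨ ∑-comm (λ u i → 𝟙 (I u) * (r i * 𝟙 (below (toℕ i) u))) ⟩
      sum (λ i → sum (λ u → 𝟙 (I u) * (r i * 𝟙 (below (toℕ i) u))))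
        ≡⟨ sum-cong-≗ (λ i → trans (sum-cong-≗ (λ u → trans
             (solve 3 (λ a r b → a :* (r :* b) := r :* (a :* b)) refl (𝟙 (I u)) (r i) (𝟙 (below (toℕ i) u)))
             (cong (r i *_) (sym (𝟙-∧ (I u) (below (toℕ i) u))))))
             (trans (sym (*-distribˡ-sum (r i) (λ u → 𝟙 (I u ∧ below (toℕ i) u)))) (cong (r i *_) (sym (ι-count (λ u → I u ∧ below (toℕ i) u)))))) ⟩
      sum (density I) ∎

    k≤3χ : ∀ ω → Spread ω → 0 ℕ.< k →
           ∃[ χ ] IsFractionalChromaticNumber (graph ω) (fromℚ χ) × ι k ≤ ι 3 * χ
    k≤3χ ω spread 0<k =
      let (X , 0≤X , covered , isχ) = fractionalChromaticNumber (graph ω)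
      in ∑ (independentSets (graph ω)) X , isχ , subst (_≤ ι 3 * ∑ (independentSets (graph ω)) X) sum-weight
        (weight≤ (graph ω) 0≤X covered (ι 3) weight (λ u → 0≤sum (λ i → 0≤* (0≤r i) (0≤𝟙 (below (toℕ i) u)))) λ I ind →
          subst (_≤ ι 3) (sym (trans (sum-cong-≗ (λ u → cong (λ b → 𝟙 b * weight u) (does-∈? u I))) (weight-of (lookup I))))
            (density-sum ω spread 0<k (lookup I) (independent⇒arcFree {ω} ind)))

-- Random picks and the two union bounds.

module Randomness where
  open RationalLemmas
  open import Data.Nat.Combinatorics using (_C_)
  open import Data.Fin.Subset using (∣_∣)
  open import Data.Rational.Base hiding (∣_∣)
  open ℚSolver.+-*-Solver using (solve; con; _:+_; _:*_; :-_; _:-_; _:=_)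
  open ℚ.≤-Reasoning
  open FiniteSums
  open Counting
  open NaturalPowers
  open RationalPowers
  open LayeredGraphs
  open FractionalChromaticNumbers
  open LowerBounds
  open Averages
  open Average

  module Sampling (k M m : ℕ) (k-pos : 0 ℕ.< k) (M≡ : M ≡ k ℕ.* (k ℕ.* suc m))
    (n : ℕ → ℕ) (n-mono : ∀ {i j} → i ℕ.≤ j → n i ℕ.≤ n j) (n-pos : ∀ i → 0 ℕ.< n i) where

    open Layers k M n n-mono
    open LayersLowerBound k M n n-mono n-pos

    unif-total : ∀ (i : Fin k) → sum (λ u → 𝟙 (below (toℕ i) u)) ≡ ι (suc (pred (n (toℕ i))))
    unif-total i = trans (ι-below i) (cong ι (sym (suc-pred-n (toℕ i))))

    unif : Fin k → Average (Fin Q)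
    unif i = uniform (below (toℕ i)) (fromℕ< (n-pos k)) (pred (n (toℕ i))) (unif-total i)

    picks : Average Picks
    picks = product λ v → product λ i → product {m = M} λ r → unif i

    -- Both union bounds use only random variables of this form, products over single picks, because
    -- independence gives their means.
    W : (Fin Q → Fin k → Fin Q → ℚ) → Picks → ℚ
    W g ω = prod λ v → prod λ i → prod λ r → g v i (pick ω v i r)

    E-W : ∀ g → E picks (W g) ≡ prod λ v → prod λ i → prod {M} λ r → E (unif i) (g v i)
    E-W g = trans (E-product (λ v → product λ i → product {m = M} λ r → unif i) (λ v x → prod λ i → prod λ r → g v i (lookup (lookup x i) r)))
      (prod-cong-≗ λ v → trans (E-product (λ i → product {m = M} λ r → unif i) (λ i y → prod λ r → g v i (lookup y r)))
        (prod-cong-≗ λ i → E-product {m = M} (λ r → unif i) (λ r → g v i)))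

    E-unif-const : ∀ i c → E (unif i) (λ _ → c) ≡ c
    E-unif-const i = E-uniform-const (below (toℕ i)) (fromℕ< (n-pos k)) (pred (n (toℕ i))) (unif-total i)

    E-unif-mono : ∀ i {f g} → (∀ u → below (toℕ i) u ≡ true → f u ≤ g u) → E (unif i) f ≤ E (unif i) g
    E-unif-mono i = E-uniform-mono (below (toℕ i)) (fromℕ< (n-pos k)) (pred (n (toℕ i))) (unif-total i)

    E-W≤ : ∀ g x (f : Fin Q → Fin k → ℕ) → (∀ v i y → 0ℚ ≤ g v i y) → (∀ v i → E (unif i) (g v i) ≤ x ^ f v i) →
           E picks (W g) ≤ x ^ sumℕ (λ v → sumℕ λ i → M ℕ.* f v i)
    E-W≤ g x f 0≤g h = begin
      E picks (W g)                                             ≡⟨ E-W g ⟩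
      prod (λ v → prod λ i → prod {M} λ r → E (unif i) (g v i)) ≤⟨ prod-mono (λ v → 0≤prod λ i → 0≤prod {M} λ r → 0≤E v i)
                                                                     (λ v → prod-mono (λ i → 0≤prod {M} λ r → 0≤E v i) λ i → prod-mono {M} (λ r → 0≤E v i) (λ r → h v i)) ⟩
      prod (λ v → prod λ i → prod {M} λ r → x ^ f v i)          ≡⟨ prod-cong-≗ (λ v → trans (prod-cong-≗ λ i → trans (prod-^ {M} x (λ r → f v i)) (cong (x ^_) (sumℕ-const M (f v i))))
                                                                     (prod-^ x (λ i → M ℕ.* f v i))) ⟩
      prod (λ v → x ^ sumℕ λ i → M ℕ.* f v i)                   ≡⟨ prod-^ x (λ v → sumℕ λ i → M ℕ.* f v i) ⟩
      x ^ sumℕ (λ v → sumℕ λ i → M ℕ.* f v i)                   ∎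
      where
      0≤E : ∀ v i → 0ℚ ≤ E (unif i) (g v i)
      0≤E v i = subst (_≤ E (unif i) (g v i)) (E-unif-const i 0ℚ) (E-unif-mono i (λ u _ → 0≤g v i u))

    E-density : ∀ I i → E (unif i) (λ y → 𝟙 (I y ∧ below (toℕ i) y)) ≡ density I i
    E-density I i = cong (recip (pred (n (toℕ i))) *_) (trans
      (sum-cong-≗ (λ u → absorb (below (toℕ i) u) (I u))) (sym (ι-count (λ u → I u ∧ below (toℕ i) u))))
      where
      absorb : ∀ b c → 𝟙 b * 𝟙 (c ∧ b) ≡ 𝟙 (c ∧ b)
      absorb false false = refl
      absorb false true  = refl
      absorb true  c     = ℚ.*-identityˡ (𝟙 (c ∧ true))

    -- No arc-free set is heavy in two layers.

    module SpreadEvents (sep : ∀ i → k ℕ.* n i ℕ.≤ n (suc i)) where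

      k₁ : ℕ
      k₁ = pred k

      suc-k₁ : suc k₁ ≡ k
      suc-k₁ = ℕ.suc-pred k {{ℕ.>-nonZero k-pos}}

      recip-k : recip k₁ * ι k ≡ 1ℚ
      recip-k = trans (cong (λ z → recip k₁ * ι z) (sym suc-k₁)) (recip-ι k₁)

      -- Bounds the probability that a pick for a layer misses a set that is heavy there. The
      -- density is then at least 1/k, so that `k` misses have probability at most 1/2.
      η : ℚ
      η = 1ℚ - recip k₁

      η≡ : η ≡ ι k₁ * recip k₁
      η≡ = trans (cong (_- recip k₁) (sym (recip-ι k₁))) (trans (cong (λ z → recip k₁ * z - recip k₁) (ι-suc k₁))
        (solve 2 (λ r k → r :* (k :+ con 1ℚ) :- r := k :* r) refl (recip k₁) (ι k₁)))

      0≤η : 0ℚ ≤ η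
      0≤η = subst (0ℚ ≤_) (sym η≡) (0≤* (0≤ι k₁) (ℚ.<⇒≤ (0<recip k₁)))

      η≤1 : η ≤ 1ℚ
      η≤1 = subst (η ≤_) (ℚ.+-identityʳ 1ℚ) (ℚ.+-monoʳ-≤ 1ℚ (ℚ.neg-antimono-≤ (ℚ.<⇒≤ (0<recip k₁))))

      η^k≤½ : η ^ k ≤ ½
      η^k≤½ = begin
        η ^ k                              ≡⟨ cong (_^ k) η≡ ⟩
        (ι k₁ * recip k₁) ^ k              ≡⟨ ^-distrib-* (ι k₁) (recip k₁) k ⟩
        ι k₁ ^ k * recip k₁ ^ k            ≡⟨ solve 2 (λ a b → a :* b := con ½ :* ((con 1ℚ :+ con 1ℚ) :* a :* b)) refl (ι k₁ ^ k) (recip k₁ ^ k) ⟩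
        ½ * ((1ℚ + 1ℚ) * ι k₁ ^ k * recip k₁ ^ k) ≡⟨ cong₂ (λ a b → ½ * (a * b * recip k₁ ^ k)) (sym ι-2) (sym (ι-^ k₁ k)) ⟩
        ½ * (ι 2 * ι (k₁ ℕ.^ k) * recip k₁ ^ k) ≡⟨ cong (λ z → ½ * (z * recip k₁ ^ k)) (sym (ι-* 2 (k₁ ℕ.^ k))) ⟩
        ½ * (ι (2 ℕ.* k₁ ℕ.^ k) * recip k₁ ^ k) ≤⟨ *-monoˡ ½ 0≤½ (*-monoʳ (recip k₁ ^ k) (0≤^ (ℚ.<⇒≤ (0<recip k₁)) k) (ι-mono (subst (λ j → 2 ℕ.* k₁ ℕ.^ j ℕ.≤ j ℕ.^ j) suc-k₁ (2n^[1+n]≤[1+n]^[1+n] k₁)))) ⟩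
        ½ * (ι (k ℕ.^ k) * recip k₁ ^ k)   ≡⟨ cong (λ z → ½ * (z * recip k₁ ^ k)) (ι-^ k k) ⟩
        ½ * (ι k ^ k * recip k₁ ^ k)       ≡⟨ cong (½ *_) (sym (^-distrib-* (ι k) (recip k₁) k)) ⟩
        ½ * (ι k * recip k₁) ^ k           ≡⟨ cong (λ z → ½ * z ^ k) (trans (ℚ.*-comm (ι k) (recip k₁)) recip-k) ⟩
        ½ * 1ℚ ^ k                         ≡⟨ cong (½ *_) (1^n≡1 k) ⟩
        ½ * 1ℚ                             ≡⟨ ℚ.*-identityʳ ½ ⟩
        ½                                  ∎
        where
        0≤½ : 0ℚ ≤ ½
        0≤½ = ℚ.nonNegative⁻¹ ½

      outside-of : (Fin Q → Bool) → Fin k → Fin Q → Bool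
      outside-of I i v = I v ∧ not (below (toℕ i) v)

      active : Fin k → (Fin Q → Bool) → Fin Q → Fin k → Bool
      active i₀ I v i = does (i₀ Fin.≟ i) ∧ outside-of I i₀ v

      -- `W (g i₀ I)` is the indicator of the event that no vertex of `I` outside layer `i₀` has a
      -- pick for that layer which lies in `I` and in the layer.
      g : Fin k → (Fin Q → Bool) → Fin Q → Fin k → Fin Q → ℚ
      g i₀ I v i y = if active i₀ I v i then 𝟙 (not (I y ∧ below (toℕ i₀) y)) else 1ℚ

      0≤g : ∀ i₀ I v i y → 0ℚ ≤ g i₀ I v i y
      0≤g i₀ I v i y with active i₀ I v i
      ... | true  = 0≤𝟙 (not (I y ∧ below (toℕ i₀) y))
      ... | false = 0≤1

      heavy⇒recip≤density : ∀ I i → Heavy I i → recip k₁ ≤ density I i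
      heavy⇒recip≤density I i heavy = begin
        recip k₁                                  ≡⟨ sym (ℚ.*-identityʳ (recip k₁)) ⟩
        recip k₁ * 1ℚ                             ≡⟨ cong (recip k₁ *_) (sym (r-n i)) ⟩
        recip k₁ * (r i * ι (n (toℕ i)))          ≤⟨ *-monoˡ (recip k₁) (ℚ.<⇒≤ (0<recip k₁)) (*-monoˡ (r i) (0≤r i) (ι-mono
                                                       (ℕ.≤-trans (ℕ.m≤m+n (n (toℕ i)) (n (toℕ i) ℕ.+ 0)) heavy))) ⟩
        recip k₁ * (r i * ι (k ℕ.* c))            ≡⟨ cong (λ z → recip k₁ * (r i * z)) (ι-* k c) ⟩
        recip k₁ * (r i * (ι k * ι c))            ≡⟨ solve 4 (λ p r k c → p :* (r :* (k :* c)) := p :* k :* (r :* c)) refl (recip k₁) (r i) (ι k) (ι c) ⟩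
        recip k₁ * ι k * (r i * ι c)              ≡⟨ cong (_* (r i * ι c)) recip-k ⟩
        1ℚ * (r i * ι c)                          ≡⟨ ℚ.*-identityˡ (r i * ι c) ⟩
        density I i                               ∎
        where c = count (λ u → I u ∧ below (toℕ i) u)

      E-g≤ : ∀ i₀ I → Heavy I i₀ → ∀ v i → E (unif i) (g i₀ I v i) ≤ η ^ ♯ (active i₀ I v i)
      E-g≤ i₀ I heavy v i = cases (i₀ Fin.≟ i) (outside-of I i₀ v)
        where
        cases : (d : Dec (i₀ ≡ i)) (b : Bool) →
                E (unif i) (λ y → if does d ∧ b then 𝟙 (not (I y ∧ below (toℕ i₀) y)) else 1ℚ) ≤ η ^ ♯ (does d ∧ b)
        cases (no _)     b     = ℚ.≤-reflexive (E-unif-const i 1ℚ)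
        cases (yes _)    false = ℚ.≤-reflexive (E-unif-const i 1ℚ)
        cases (yes refl) true  = begin
          E (unif i) (λ y → 𝟙 (not (I y ∧ below (toℕ i) y)))         ≡⟨ E-cong (unif i) (λ y → complement (I y ∧ below (toℕ i) y)) ⟩
          E (unif i) (λ y → 1ℚ + - 1ℚ * 𝟙 (I y ∧ below (toℕ i) y))   ≡⟨ E-+ (unif i) (λ _ → 1ℚ) (λ y → - 1ℚ * 𝟙 (I y ∧ below (toℕ i) y)) ⟩
          E (unif i) (λ _ → 1ℚ) + E (unif i) (λ y → - 1ℚ * 𝟙 (I y ∧ below (toℕ i) y))
                                                                     ≡⟨ cong₂ _+_ (E-unif-const i 1ℚ) (trans (E-* (unif i) (- 1ℚ) (λ y → 𝟙 (I y ∧ below (toℕ i) y))) (cong (- 1ℚ *_) (E-density I i))) ⟩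
          1ℚ + - 1ℚ * density I i                                    ≡⟨ solve 1 (λ d → con 1ℚ :+ con (- 1ℚ) :* d := con 1ℚ :- d) refl (density I i) ⟩
          1ℚ - density I i                                           ≤⟨ ℚ.+-monoʳ-≤ 1ℚ (ℚ.neg-antimono-≤ (heavy⇒recip≤density I i heavy)) ⟩
          η                                                          ≡⟨ sym (ℚ.*-identityʳ η) ⟩
          η ^ 1                                                      ∎
          where
          complement : ∀ b → 𝟙 (not b) ≡ 1ℚ + - 1ℚ * 𝟙 b
          complement false = refl
          complement true  = refl

      -- This explains M = k · k · (m+1). At least n_j / k vertices of `I` lie outside layer `i`,
      -- which is one factor `k`; `k` misses are needed to halve the probability, which is the
      -- other; the rest is the exponent (m+1) n_j.
      E-W-g : ∀ i j I → toℕ i ℕ.< toℕ j → Heavy I i → Heavy I j → E picks (W (g i I)) ≤ ½ ^ (suc m ℕ.* n (toℕ j))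
      E-W-g i j I i<j heavyᵢ heavyⱼ = begin
        E picks (W (g i I))                                  ≤⟨ E-W≤ (g i I) η (λ v l → ♯ (active i I v l)) (0≤g i I) (E-g≤ i I heavyᵢ) ⟩
        η ^ sumℕ (λ v → sumℕ λ l → M ℕ.* ♯ (active i I v l)) ≡⟨ cong (η ^_) exponent ⟩
        η ^ (M ℕ.* c)                                        ≤⟨ ^-antimonoʳ 0≤η η≤1 M*c≥ ⟩
        η ^ (k ℕ.* (suc m ℕ.* n (toℕ j)))                   ≡⟨ sym (^-assocʳ η k (suc m ℕ.* n (toℕ j))) ⟩
        (η ^ k) ^ (suc m ℕ.* n (toℕ j))                     ≤⟨ ^-monoˡ (0≤^ 0≤η k) η^k≤½ (suc m ℕ.* n (toℕ j)) ⟩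
        ½ ^ (suc m ℕ.* n (toℕ j))                           ∎
        where
        c = count (outside-of I i)
        single : ∀ b → count (λ l → does (i Fin.≟ l) ∧ b) ≡ ♯ b
        single b = trans (sumℕ-cong (λ l → cong ♯ (Bool.∧-comm (does (i Fin.≟ l)) b))) (case b)
          where
          case : ∀ b → count (λ l → b ∧ does (i Fin.≟ l)) ≡ ♯ b
          case false = count-none k
          case true  = count-≡ i
        exponent : sumℕ (λ v → sumℕ λ l → M ℕ.* ♯ (active i I v l)) ≡ M ℕ.* c
        exponent = trans (sumℕ-cong (λ v → trans (sym (*-distribˡ-sumℕ M (λ l → ♯ (active i I v l)))) (cong (M ℕ.*_) (single (outside-of I i v)))))
          (sym (*-distribˡ-sumℕ M (λ v → ♯ (outside-of I i v))))
        -- Heaviness puts at least 2 n_j / k vertices of `I` into layer `j`, and at most n_i ≤ n_j /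
        -- k of them lie in layer `i`.
        n≤k*c : n (toℕ j) ℕ.≤ k ℕ.* c
        n≤k*c = ℕ.+-cancelˡ-≤ (n (toℕ j)) (n (toℕ j)) (k ℕ.* c) (ℕ.≤-Reasoning.begin
          n (toℕ j) ℕ.+ n (toℕ j)                               ℕ.≤-Reasoning.≡⟨ cong (n (toℕ j) ℕ.+_) (sym (ℕ.+-identityʳ (n (toℕ j)))) ⟩
          2 ℕ.* n (toℕ j)                                       ℕ.≤-Reasoning.≤⟨ heavyⱼ ⟩
          k ℕ.* count (λ u → I u ∧ below (toℕ j) u)             ℕ.≤-Reasoning.≤⟨ ℕ.*-monoʳ-≤ k (count-mono {R = I} λ u h → proj₁ (∧-true {I u} h)) ⟩
          k ℕ.* count I                                         ℕ.≤-Reasoning.≡⟨ trans (cong (k ℕ.*_) (count-split I (below (toℕ i)))) (ℕ.*-distribˡ-+ k _ c) ⟩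
          k ℕ.* count (λ u → I u ∧ below (toℕ i) u) ℕ.+ k ℕ.* c ℕ.≤-Reasoning.≤⟨ ℕ.+-monoˡ-≤ (k ℕ.* c) (ℕ.*-monoʳ-≤ k (ℕ.≤-trans
                                                                     (count-mono {R = below (toℕ i)} λ u h → proj₂ (∧-true {I u} h)) (count-below-≤ Q (n (toℕ i))))) ⟩
          k ℕ.* n (toℕ i) ℕ.+ k ℕ.* c                           ℕ.≤-Reasoning.≤⟨ ℕ.+-monoˡ-≤ (k ℕ.* c) (ℕ.≤-trans (sep (toℕ i)) (n-mono i<j)) ⟩
          n (toℕ j) ℕ.+ k ℕ.* c                                 ℕ.≤-Reasoning.∎)
        M*c≥ : k ℕ.* (suc m ℕ.* n (toℕ j)) ℕ.≤ M ℕ.* c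
        M*c≥ = ℕ.≤-trans (ℕ.*-monoʳ-≤ k (ℕ.*-monoʳ-≤ (suc m) n≤k*c)) (ℕ.≤-reflexive (trans (lemma k m c) (cong (ℕ._* c) (sym M≡))))
          where
          lemma : ∀ k m c → k ℕ.* (suc m ℕ.* (k ℕ.* c)) ≡ k ℕ.* (k ℕ.* suc m) ℕ.* c
          lemma = solve-∀

      condition? : ∀ i j I → Dec (toℕ i ℕ.< toℕ j × Heavy I i × Heavy I j)
      condition? i j I = (toℕ i ℕ.<? toℕ j) ×-dec heavy? I i ×-dec heavy? I j

      -- The product of the factors h j u restricts the union bound to the 2 ^ n j sets I inside the j-th set.
      h : Fin k → Fin Q → Bool → ℚ
      h j u b = if b then 𝟙 (below (toℕ j) u) else 1ℚ

      0≤h : ∀ j u b → 0ℚ ≤ h j u b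
      0≤h j u true  = 0≤𝟙 (below (toℕ j) u)
      0≤h j u false = 0≤1

      c : Fin k → Fin k → (Fin Q → Bool) → ℚ
      c i j I = 𝟙 (does (condition? i j I)) * prod (λ u → h j u (I u))

      0≤c : ∀ i j I → 0ℚ ≤ c i j I
      0≤c i j I = 0≤* (0≤𝟙 (does (condition? i j I))) (0≤prod (λ u → 0≤h j u (I u)))

      -- All factors are 0 or 1, so this counts the violations: pairs i < j with a set inside layer
      -- `j` that is heavy in both layers and is missed by all relevant picks. A value below 1
      -- excludes them all.
      bad : Picks → ℚ
      bad ω = sum λ i → sum λ j → ∑ (allSubsets Q) λ S → c i j (lookup S) * W (g i (lookup S)) ω

      E-bad : E picks bad ≡ sum λ i → sum λ j → ∑ (allSubsets Q) λ S → c i j (lookup S) * E picks (W (g i (lookup S)))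
      E-bad = trans (E-sum picks (λ i ω → sum λ j → ∑ (allSubsets Q) λ S → c i j (lookup S) * W (g i (lookup S)) ω)) (sum-cong-≗ λ i →
        trans (E-sum picks (λ j ω → ∑ (allSubsets Q) λ S → c i j (lookup S) * W (g i (lookup S)) ω)) (sum-cong-≗ λ j →
        trans (E-∑ picks (allSubsets Q) (λ S ω → c i j (lookup S) * W (g i (lookup S)) ω)) (∑-cong (allSubsets Q) λ S →
        E-* picks (c i j (lookup S)) (W (g i (lookup S))))))

      0≤½ : 0ℚ ≤ ½
      0≤½ = ℚ.nonNegative⁻¹ ½

      ½^*ι2^ : ∀ l → ½ ^ l * ι 2 ^ l ≡ 1ℚ
      ½^*ι2^ l = trans (sym (^-distrib-* ½ (ι 2) l)) (trans (cong (λ z → (½ * z) ^ l) ι-2) (1^n≡1 l))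

      term≤ : ∀ i j I → c i j I * E picks (W (g i I)) ≤ ½ ^ (suc m ℕ.* n (toℕ j)) * prod (λ u → h j u (I u))
      term≤ i j I = cases (condition? i j I)
        where
        P = prod (λ u → h j u (I u))
        ρ = ½ ^ (suc m ℕ.* n (toℕ j))
        0≤P : 0ℚ ≤ P
        0≤P = 0≤prod (λ u → 0≤h j u (I u))
        cases : (d : Dec (toℕ i ℕ.< toℕ j × Heavy I i × Heavy I j)) → 𝟙 (does d) * P * E picks (W (g i I)) ≤ ρ * P
        cases (no _) = subst (_≤ ρ * P) (solve 2 (λ p e → con 0ℚ := con 0ℚ :* p :* e) refl P (E picks (W (g i I))))
          (0≤* (0≤^ 0≤½ (suc m ℕ.* n (toℕ j))) 0≤P)
        cases (yes (i<j , heavyᵢ , heavyⱼ)) = begin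
          1ℚ * P * E picks (W (g i I))  ≡⟨ solve 2 (λ p e → con 1ℚ :* p :* e := e :* p) refl P (E picks (W (g i I))) ⟩
          E picks (W (g i I)) * P       ≤⟨ *-monoʳ P 0≤P (E-W-g i j I i<j heavyᵢ heavyⱼ) ⟩
          ρ * P                         ∎

      -- The 2^(n_j) sets inside layer `j` use up one n_j of the exponent (m+1) n_j, and n_j ≥ 1
      -- leaves at least `m`.
      level≤ : ∀ i j → ∑ (allSubsets Q) (λ S → c i j (lookup S) * E picks (W (g i (lookup S)))) ≤ ½ ^ m
      level≤ i j = begin
        ∑ (allSubsets Q) (λ S → c i j (lookup S) * E picks (W (g i (lookup S))))  ≤⟨ ∑-mono (allSubsets Q) (λ {S} _ → term≤ i j (lookup S)) ⟩
        ∑ (allSubsets Q) (λ S → ρ * prod (λ u → h j u (lookup S u)))              ≡⟨ ∑-distrib-* (allSubsets Q) ρ (λ S → prod (λ u → h j u (lookup S u))) ⟩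
        ρ * ∑ (allSubsets Q) (λ S → prod (λ u → h j u (lookup S u)))              ≡⟨ cong (ρ *_) (trans (∑-prod Q (h j)) (trans (prod-cong-≗ λ u → choices (below (toℕ j) u))
                                                                                       (prod-^ (ι 2) (λ u → ♯ (below (toℕ j) u))))) ⟩
        ρ * ι 2 ^ count (below (toℕ j))                                           ≡⟨ cong (λ l → ρ * ι 2 ^ l) (count-below (n-mono (Fin.toℕ≤n j))) ⟩
        ρ * ι 2 ^ n (toℕ j)                                                       ≡⟨ cong (_* ι 2 ^ n (toℕ j)) (^-homo-* ½ (n (toℕ j)) (m ℕ.* n (toℕ j))) ⟩
        ½ ^ n (toℕ j) * σ * ι 2 ^ n (toℕ j)                                       ≡⟨ solve 3 (λ a s b → a :* s :* b := a :* b :* s) refl (½ ^ n (toℕ j)) σ (ι 2 ^ n (toℕ j)) ⟩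
        ½ ^ n (toℕ j) * ι 2 ^ n (toℕ j) * σ                                       ≡⟨ trans (cong (_* σ) (½^*ι2^ (n (toℕ j)))) (ℚ.*-identityˡ σ) ⟩
        ½ ^ (m ℕ.* n (toℕ j))                                                     ≤⟨ ^-antimonoʳ 0≤½ (p≤p+q {½} {½} 0≤½) (ℕ.≤-trans (ℕ.≤-reflexive (sym (ℕ.*-identityʳ m))) (ℕ.*-monoʳ-≤ m (n-pos (toℕ j)))) ⟩
        ½ ^ m                                                                     ∎
        where
        ρ = ½ ^ (suc m ℕ.* n (toℕ j))
        σ = ½ ^ (m ℕ.* n (toℕ j))
        choices : ∀ b → 1ℚ + 𝟙 b ≡ ι 2 ^ ♯ b
        choices false = ℚ.+-identityʳ 1ℚ
        choices true  = trans (sym ι-2) (sym (ℚ.*-identityʳ (ι 2)))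

      -- A mean of at most 1/4 for each of the two union bounds keeps their sum below 1.
      4*E-bad≤1 : 4 ℕ.* (k ℕ.* k) ℕ.≤ 2 ℕ.^ m → ι 4 * E picks bad ≤ 1ℚ
      4*E-bad≤1 4k²≤2^m = begin
        ι 4 * E picks bad                   ≤⟨ *-monoˡ (ι 4) (0≤ι 4) (ℚ.≤-trans (ℚ.≤-reflexive E-bad) (sum-mono λ i → sum-mono λ j → level≤ i j)) ⟩
        ι 4 * sum {k} (λ _ → sum {k} λ _ → ½ ^ m) ≡⟨ cong (ι 4 *_) (trans (sum-cong-≗ {k} λ _ → sum-const k (½ ^ m)) (sum-const k (ι k * ½ ^ m))) ⟩
        ι 4 * (ι k * (ι k * ½ ^ m))         ≡⟨ solve 3 (λ f k x → f :* (k :* (k :* x)) := f :* (k :* k) :* x) refl (ι 4) (ι k) (½ ^ m) ⟩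
        ι 4 * (ι k * ι k) * ½ ^ m           ≡⟨ cong (_* ½ ^ m) (trans (cong (ι 4 *_) (sym (ι-* k k))) (sym (ι-* 4 (k ℕ.* k)))) ⟩
        ι (4 ℕ.* (k ℕ.* k)) * ½ ^ m         ≤⟨ *-monoʳ (½ ^ m) (0≤^ 0≤½ m) (ι-mono 4k²≤2^m) ⟩
        ι (2 ℕ.^ m) * ½ ^ m                 ≡⟨ trans (cong (_* ½ ^ m) (ι-^ 2 m)) (trans (ℚ.*-comm (ι 2 ^ m) (½ ^ m)) (½^*ι2^ m)) ⟩
        1ℚ                                  ∎

      0≤W : ∀ i I ω → 0ℚ ≤ W (g i I) ω
      0≤W i I ω = 0≤prod λ v → 0≤prod λ l → 0≤prod λ r → 0≤g i I v l (pick ω v l r)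

      0≤bad : ∀ ω → 0ℚ ≤ bad ω
      0≤bad ω = 0≤sum λ i → 0≤sum λ j → 0≤∑ (allSubsets Q) λ {S} _ → 0≤* (0≤c i j (lookup S)) (0≤W i (lookup S) ω)

      event≤bad : ∀ ω i j S → c i j (lookup S) * W (g i (lookup S)) ω ≤ bad ω
      event≤bad ω i j S = ℚ.≤-trans (term≤∑ {f = λ S → c i j (lookup S) * W (g i (lookup S)) ω}
          (λ {S} _ → 0≤* (0≤c i j (lookup S)) (0≤W i (lookup S) ω)) (∈-allSubsets S))
        (ℚ.≤-trans (term≤sum {f = λ j → ∑ (allSubsets Q) λ S → c i j (lookup S) * W (g i (lookup S)) ω}
          (λ j → 0≤∑ (allSubsets Q) λ {S} _ → 0≤* (0≤c i j (lookup S)) (0≤W i (lookup S) ω)) j)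
        (term≤sum {f = λ i → sum λ j → ∑ (allSubsets Q) λ S → c i j (lookup S) * W (g i (lookup S)) ω}
          (λ i → 0≤sum λ j → 0≤∑ (allSubsets Q) λ {S} _ → 0≤* (0≤c i j (lookup S)) (0≤W i (lookup S) ω)) i))

      spread : ∀ ω → bad ω < 1ℚ → Spread ω
      spread ω bad<1 i j i<j I free heavyᵢ heavyⱼ = ℚ.<-irrefl occurs (ℚ.≤-<-trans (event≤bad ω i j S) bad<1)
        where
        -- The union bound covers only sets inside layer `j`, so `I` is cut down to that layer. It
        -- stays arc-free, and its heaviness in layers `i` and `j` is unaffected because layer `i`
        -- is contained in layer `j`.
        J : Fin Q → Bool
        J u = I u ∧ below (toℕ j) u
        S : Subset Q
        S = tabulate J
        S≡J : ∀ u → lookup S u ≡ J u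
        S≡J = Vec.lookup∘tabulate J
        heavy : ∀ l → toℕ l ℕ.≤ toℕ j → Heavy I l → Heavy (lookup S) l
        heavy l l≤j hl = ℕ.≤-trans hl (ℕ.*-monoʳ-≤ k (count-mono λ u hu → let (Iu , bu) = ∧-true {I u} hu in
          ∧-intro (trans (S≡J u) (∧-intro Iu (<⇒<ᵇ≡true (ℕ.<-≤-trans (<ᵇ≡true⇒< (toℕ u) (n (toℕ l)) bu) (n-mono l≤j))))) bu))
        h≡1 : ∀ u → h j u (lookup S u) ≡ 1ℚ
        h≡1 u = trans (cong (h j u) (S≡J u)) (restricted (I u) (below (toℕ j) u) refl)
          where
          restricted : ∀ a b → b ≡ below (toℕ j) u → h j u (a ∧ b) ≡ 1ℚ
          restricted false b     _ = refl
          restricted true  false _ = refl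
          restricted true  true  e = cong 𝟙 (sym e)
        g≡1 : ∀ v l r → g i (lookup S) v l (pick ω v l r) ≡ 1ℚ
        g≡1 v l r with active i (lookup S) v l in act | lookup S (pick ω v l r) ∧ below (toℕ i) (pick ω v l r) in hitₛ
        ... | false | _     = refl
        ... | true  | false = refl
        ... | true  | true  =
          let y         = pick ω v l r
              (i≡l , o) = ∧-true {does (i Fin.≟ l)} act
              (Sv , v≥) = ∧-true {lookup S v} o
              (Sy , y<) = ∧-true {lookup S y} hitₛ
          in contradiction (l , r , subst (λ z → toℕ y ℕ.< n (toℕ z)) (does-true (i Fin.≟ l) i≡l) (<ᵇ≡true⇒< (toℕ y) (n (toℕ i)) y<)
                            , subst (λ z → n (toℕ z) ℕ.≤ toℕ v) (does-true (i Fin.≟ l) i≡l) (not<ᵇ⇒≥ (toℕ v) (n (toℕ i)) v≥) , refl)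
               (free y v (proj₁ (∧-true {I y} (trans (sym (S≡J y)) Sy))) (proj₁ (∧-true {I v} (trans (sym (S≡J v)) Sv))))
        occurs : c i j (lookup S) * W (g i (lookup S)) ω ≡ 1ℚ
        occurs = begin-equality
          c i j (lookup S) * W (g i (lookup S)) ω  ≡⟨ cong₂ _*_ (cong₂ _*_
                                                        (cong 𝟙 (dec-true (condition? i j (lookup S)) (i<j , heavy i (ℕ.<⇒≤ i<j) heavyᵢ , heavy j ℕ.≤-refl heavyⱼ)))
                                                        (trans (prod-cong-≗ h≡1) (prod-1 Q)))
                                                      (trans (prod-cong-≗ λ v → trans (prod-cong-≗ λ l → trans (prod-cong-≗ λ r → g≡1 v l r) (prod-1 M)) (prod-1 k)) (prod-1 Q)) ⟩
          1ℚ * 1ℚ * 1ℚ                             ≡⟨ trans (ℚ.*-identityʳ (1ℚ * 1ℚ)) (ℚ.*-identityʳ 1ℚ) ⟩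
          1ℚ                                       ∎

    -- Small sets outside a layer have few picks into themselves.

    module SparseEvents (4n≤n : ∀ q → 4 ℕ.* n q ℕ.≤ n (suc q)) (b : ℕ) (b-pos : 0 ℕ.< b)
      (growth : ∀ q → b ℕ.* (16 ℕ.* (n q ℕ.* Q ℕ.* 2 ℕ.^ (k ℕ.* M))) ℕ.≤ n (suc q) ℕ.* n (suc q)) where

      R : ℕ → ℚ
      R q = recip (pred (n (suc q)))

      0≤R : ∀ q → 0ℚ ≤ R q
      0≤R q = ℚ.<⇒≤ (0<recip (pred (n (suc q))))

      R*n : ∀ q → R q * ι (n (suc q)) ≡ 1ℚ
      R*n q = trans (cong (λ z → R q * ι z) (sym (suc-pred-n (suc q)))) (recip-ι (pred (n (suc q))))

      recip*ι : ∀ {t} → 0 ℕ.< t → recip (pred t) * ι t ≡ 1ℚ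
      recip*ι {suc t} _ = recip-ι t

      -- The base of an exponential moment, as in Chernoff's bound: n_{q+1} / t and its inverse. It
      -- is as large as possible with the mean of `Λ` to the hits of one pick still at most 2.
      Λ Λ⁻¹ : ℕ → ℕ → ℚ
      Λ   q t = ι (n (suc q)) * recip (pred t)
      Λ⁻¹ q t = ι t * R q

      0≤Λ : ∀ q t → 0ℚ ≤ Λ q t
      0≤Λ q t = 0≤* (0≤ι (n (suc q))) (ℚ.<⇒≤ (0<recip (pred t)))

      0≤Λ⁻¹ : ∀ q t → 0ℚ ≤ Λ⁻¹ q t
      0≤Λ⁻¹ q t = 0≤* (0≤ι t) (0≤R q)

      Λ⁻¹*Λ : ∀ q {t} → 0 ℕ.< t → Λ⁻¹ q t * Λ q t ≡ 1ℚ
      Λ⁻¹*Λ q {t} 0<t = begin-equality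
        ι t * R q * (ι (n (suc q)) * recip (pred t))   ≡⟨ solve 4 (λ t r n p → t :* r :* (n :* p) := (r :* n) :* (p :* t)) refl (ι t) (R q) (ι (n (suc q))) (recip (pred t)) ⟩
        R q * ι (n (suc q)) * (recip (pred t) * ι t)   ≡⟨ cong₂ _*_ (R*n q) (recip*ι 0<t) ⟩
        1ℚ * 1ℚ                                        ≡⟨ ℚ.*-identityˡ 1ℚ ⟩
        1ℚ                                             ∎

      1≤Λ : ∀ q {t} → 0 ℕ.< t → t ℕ.≤ n (suc q) → 1ℚ ≤ Λ q t
      1≤Λ q {t} 0<t t≤n = subst (_≤ Λ q t) (trans (ℚ.*-comm (ι t) (recip (pred t))) (recip*ι 0<t))
        (*-monoʳ (recip (pred t)) (ℚ.<⇒≤ (0<recip (pred t))) (ι-mono t≤n))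

      g : ℚ → (Fin Q → Bool) → Fin Q → Fin k → Fin Q → ℚ
      g x T v i y = x ^ ♯ (T v ∧ (not (below (toℕ i) v) ∧ (below (toℕ i) y ∧ T y)))

      W-g : ∀ x T ω → W (g x T) ω ≡ x ^ hits ω T
      W-g x T ω = trans (prod-cong-≗ λ v → trans (prod-cong-≗ λ i → prod-^ x (λ r → ♯ (hit ω T v i r)))
        (prod-^ x (λ i → sumℕ λ r → ♯ (hit ω T v i r)))) (prod-^ x (degree ω T))

      Admissible : ℕ → (Fin Q → Bool) → Set
      Admissible q T = (∀ u → T u ≡ true → n q ℕ.≤ toℕ u) × 0 ℕ.< count T × count T ℕ.< 4 ℕ.* n q

      admissible? : ∀ q T → Dec (Admissible q T)
      admissible? q T = Fin.all? (λ u → (T u Bool.≟ true) →-dec (n q ℕ.≤? toℕ u)) ×-dec (0 ℕ.<? count T) ×-dec (count T ℕ.<? 4 ℕ.* n q)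

      -- Layers up to `q` do not meet `T`, and the later ones have at least n_{q+1} vertices.
      Λ*density≤1 : ∀ q T i → (∀ u → T u ≡ true → n q ℕ.≤ toℕ u) → 0 ℕ.< count T → Λ q (count T) * density T i ≤ 1ℚ
      Λ*density≤1 q T i above 0<t = cases (toℕ i ℕ.≤? q)
        where
        t d : ℕ
        t = count T
        d = count (λ u → T u ∧ below (toℕ i) u)
        cases : Dec (toℕ i ℕ.≤ q) → Λ q t * density T i ≤ 1ℚ
        cases (yes i≤q) = subst (_≤ 1ℚ) (sym (trans (cong (λ z → Λ q t * (r i * ι z)) d≡0) (trans (cong (λ z → Λ q t * (r i * z)) ι-0)
          (solve 2 (λ l r → l :* (r :* con 0ℚ) := con 0ℚ) refl (Λ q t) (r i))))) 0≤1
          where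
          d≡0 : d ≡ 0
          d≡0 = trans (sumℕ-cong λ u → empty u (T u) refl) (count-none Q)
            where
            empty : ∀ u a → a ≡ T u → ♯ (a ∧ below (toℕ i) u) ≡ 0
            empty u false _ = refl
            empty u true  e = cong ♯ (Bool.not-injective {below (toℕ i) u} {false} (≥⇒not<ᵇ {toℕ u} (ℕ.≤-trans (n-mono i≤q) (above u (sym e)))))
        cases (no i≰q) = begin
          Λ q t * (r i * ι d)                              ≤⟨ *-monoˡ (Λ q t) (0≤Λ q t) (*-monoˡ (r i) (0≤r i) (ι-mono (count-mono {R = T} λ u h → proj₁ (∧-true {T u} h)))) ⟩
          ι (n (suc q)) * recip (pred t) * (r i * ι t)     ≡⟨ solve 4 (λ n p r t → n :* p :* (r :* t) := (p :* t) :* (r :* n)) refl (ι (n (suc q))) (recip (pred t)) (r i) (ι t) ⟩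
          recip (pred t) * ι t * (r i * ι (n (suc q)))     ≡⟨ trans (cong (_* (r i * ι (n (suc q)))) (recip*ι 0<t)) (ℚ.*-identityˡ (r i * ι (n (suc q)))) ⟩
          r i * ι (n (suc q))                              ≤⟨ *-monoˡ (r i) (0≤r i) (ι-mono (n-mono (ℕ.≰⇒> i≰q))) ⟩
          r i * ι (n (toℕ i))                              ≡⟨ r-n i ⟩
          1ℚ                                               ∎

      -- A pick by a vertex of `T` contributes `Λ` with probability at most 1/Λ and 1 otherwise, so
      -- its mean is at most 2; picks by other vertices contribute exactly 1.
      E-g≤ : ∀ q T → (∀ u → T u ≡ true → n q ℕ.≤ toℕ u) → 0 ℕ.< count T →
             ∀ v i → E (unif i) (g (Λ q (count T)) T v i) ≤ ι 2 ^ ♯ (T v)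
      E-g≤ q T above 0<t v i = cases (T v)
        where
        x : ℚ
        x = Λ q (count T)
        0≤x : 0ℚ ≤ x
        0≤x = 0≤Λ q (count T)
        pointwise : ∀ a b c → x ^ ♯ (a ∧ (b ∧ c)) ≤ 1ℚ + x * 𝟙 (c ∧ b)
        pointwise true  true  true  = subst (_≤ 1ℚ + x * 1ℚ) (ℚ.+-identityˡ (x * 1ℚ)) (ℚ.+-monoˡ-≤ (x * 1ℚ) 0≤1)
        pointwise false b     c     = p≤p+q (0≤* 0≤x (0≤𝟙 (c ∧ b)))
        pointwise true  false c     = p≤p+q (0≤* 0≤x (0≤𝟙 (c ∧ false)))
        pointwise true  true  false = p≤p+q (0≤* 0≤x (0≤𝟙 false))
        cases : ∀ a → E (unif i) (λ y → x ^ ♯ (a ∧ (not (below (toℕ i) v) ∧ (below (toℕ i) y ∧ T y)))) ≤ ι 2 ^ ♯ a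
        cases false = ℚ.≤-reflexive (E-unif-const i 1ℚ)
        cases true  = begin
          E (unif i) (λ y → x ^ ♯ (not (below (toℕ i) v) ∧ (below (toℕ i) y ∧ T y)))
            ≤⟨ E-unif-mono i (λ y _ → pointwise (not (below (toℕ i) v)) (below (toℕ i) y) (T y)) ⟩
          E (unif i) (λ y → 1ℚ + x * 𝟙 (T y ∧ below (toℕ i) y))
            ≡⟨ E-+ (unif i) (λ _ → 1ℚ) (λ y → x * 𝟙 (T y ∧ below (toℕ i) y)) ⟩
          E (unif i) (λ _ → 1ℚ) + E (unif i) (λ y → x * 𝟙 (T y ∧ below (toℕ i) y))
            ≡⟨ cong₂ _+_ (E-unif-const i 1ℚ) (trans (E-* (unif i) x (λ y → 𝟙 (T y ∧ below (toℕ i) y))) (cong (x *_) (E-density T i))) ⟩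
          1ℚ + x * density T i
            ≤⟨ ℚ.+-monoʳ-≤ 1ℚ (Λ*density≤1 q T i above 0<t) ⟩
          1ℚ + 1ℚ
            ≡⟨ trans (sym ι-2) (sym (ℚ.*-identityʳ (ι 2))) ⟩
          ι 2 ^ 1 ∎

      E-W-g : ∀ q T → (∀ u → T u ≡ true → n q ℕ.≤ toℕ u) → 0 ℕ.< count T →
              E picks (W (g (Λ q (count T)) T)) ≤ ι 2 ^ (k ℕ.* M ℕ.* count T)
      E-W-g q T above 0<t = begin
        E picks (W (g (Λ q (count T)) T))                ≤⟨ E-W≤ (g (Λ q (count T)) T) (ι 2) (λ v _ → ♯ (T v)) (λ v i y → 0≤^ (0≤Λ q (count T)) (♯ (T v ∧ (not (below (toℕ i) v) ∧ (below (toℕ i) y ∧ T y))))) (E-g≤ q T above 0<t) ⟩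
        ι 2 ^ sumℕ (λ v → sumℕ {k} λ _ → M ℕ.* ♯ (T v))  ≡⟨ cong (ι 2 ^_) exponent ⟩
        ι 2 ^ (k ℕ.* M ℕ.* count T)                      ∎
        where
        exponent : sumℕ (λ v → sumℕ {k} λ _ → M ℕ.* ♯ (T v)) ≡ k ℕ.* M ℕ.* count T
        exponent = trans (sumℕ-cong λ v → trans (sumℕ-const k (M ℕ.* ♯ (T v))) (sym (ℕ.*-assoc k M (♯ (T v)))))
          (sym (*-distribˡ-sumℕ (k ℕ.* M) (λ v → ♯ (T v))))

      -- The factor is that of Markov's inequality for the event that `Λ ^ hits` reaches Λ^(2t).
      c : ℕ → (Fin Q → Bool) → ℚ
      c q T = 𝟙 (does (admissible? q T)) * Λ⁻¹ q (count T) ^ (2 ℕ.* count T)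

      bad : Picks → ℚ
      bad ω = sum {k} λ q → ∑ (allSubsets Q) λ S → c (toℕ q) (lookup S) * W (g (Λ (toℕ q) (count (lookup S))) (lookup S)) ω

      E-bad : E picks bad ≡ sum {k} λ q → ∑ (allSubsets Q) λ S → c (toℕ q) (lookup S) * E picks (W (g (Λ (toℕ q) (count (lookup S))) (lookup S)))
      E-bad = trans (E-sum picks (λ (q : Fin k) ω → ∑ (allSubsets Q) λ S → c (toℕ q) (lookup S) * W (g (Λ (toℕ q) (count (lookup S))) (lookup S)) ω)) (sum-cong-≗ {k} λ q →
        trans (E-∑ picks (allSubsets Q) (λ S ω → c (toℕ q) (lookup S) * W (g (Λ (toℕ q) (count (lookup S))) (lookup S)) ω)) (∑-cong (allSubsets Q) λ S →
        E-* picks (c (toℕ q) (lookup S)) (W (g (Λ (toℕ q) (count (lookup S))) (lookup S)))))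

      sized? : ∀ q t → Dec (0 ℕ.< t × t ℕ.< 4 ℕ.* n q)
      sized? q t = (0 ℕ.<? t) ×-dec (t ℕ.<? 4 ℕ.* n q)

      -- Depends on the set only through its size, so the sum over subsets becomes a sum of binomial
      -- terms.
      w : ℕ → ℕ → ℚ
      w q t = 𝟙 (does (sized? q t)) * (Λ⁻¹ q t ^ (2 ℕ.* t) * ι 2 ^ (k ℕ.* M ℕ.* t))

      term≤ : ∀ q T → c q T * E picks (W (g (Λ q (count T)) T)) ≤ w q (count T)
      term≤ q T = cases (admissible? q T) (sized? q (count T))
        where
        x e z : ℚ
        x = Λ⁻¹ q (count T) ^ (2 ℕ.* count T)
        e = E picks (W (g (Λ q (count T)) T))
        z = ι 2 ^ (k ℕ.* M ℕ.* count T)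
        0≤x : 0ℚ ≤ x
        0≤x = 0≤^ (0≤Λ⁻¹ q (count T)) (2 ℕ.* count T)
        cases : (d : Dec (Admissible q T)) (s : Dec (0 ℕ.< count T × count T ℕ.< 4 ℕ.* n q)) → 𝟙 (does d) * x * e ≤ 𝟙 (does s) * (x * z)
        cases (no _) s = subst (_≤ 𝟙 (does s) * (x * z)) (solve 2 (λ x e → con 0ℚ := con 0ℚ :* x :* e) refl x e)
          (0≤* (0≤𝟙 (does s)) (0≤* 0≤x (0≤^ (0≤ι 2) (k ℕ.* M ℕ.* count T))))
        cases (yes (_ , sized)) (no ¬sized) = contradiction sized ¬sized
        cases (yes (above , 0<t , _)) (yes _) = subst (_≤ 1ℚ * (x * z)) (solve 2 (λ x e → con 1ℚ :* (x :* e) := con 1ℚ :* x :* e) refl x e)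
          (*-monoˡ 1ℚ 0≤1 (*-monoˡ x 0≤x (E-W-g q T above 0<t)))

      δ : ℚ
      δ = recip (pred b)

      0≤δ : 0ℚ ≤ δ
      0≤δ = ℚ.<⇒≤ (0<recip (pred b))

      -- The growth condition enters here: t < 4 n_q turns 4Qt into at most 16 n_q Q, the product
      -- that the condition compares with n_{q+1}². The result is the ratio of a geometric series in
      -- the size `t`.
      density-δ : ∀ q t → t ℕ.< 4 ℕ.* n q → ι (4 ℕ.* Q ℕ.* t ℕ.* 2 ℕ.^ (k ℕ.* M)) * (R q * R q) ≤ δ
      density-δ q t t<4n = begin
        ι A * (R q * R q)                            ≡⟨ solve 2 (λ a r → a :* r := con 1ℚ :* (a :* r)) refl (ι A) (R q * R q) ⟩
        1ℚ * (ι A * (R q * R q))                     ≡⟨ cong (_* (ι A * (R q * R q))) (sym (recip*ι b-pos)) ⟩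
        δ * ι b * (ι A * (R q * R q))                ≡⟨ solve 4 (λ d b a r → d :* b :* (a :* r) := d :* (b :* a :* r)) refl δ (ι b) (ι A) (R q * R q) ⟩
        δ * (ι b * ι A * (R q * R q))                ≡⟨ cong (λ z → δ * (z * (R q * R q))) (sym (ι-* b A)) ⟩
        δ * (ι (b ℕ.* A) * (R q * R q))              ≤⟨ *-monoˡ δ 0≤δ (*-monoʳ (R q * R q) (0≤* (0≤R q) (0≤R q)) (ι-mono (ℕ.≤-trans (ℕ.*-monoʳ-≤ b A≤) (growth q)))) ⟩
        δ * (ι (N ℕ.* N) * (R q * R q))              ≡⟨ cong (λ z → δ * (z * (R q * R q))) (ι-* N N) ⟩
        δ * (ι N * ι N * (R q * R q))                ≡⟨ solve 3 (λ d n r → d :* (n :* n :* (r :* r)) := d :* ((r :* n) :* (r :* n))) refl δ (ι N) (R q) ⟩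
        δ * (R q * ι N * (R q * ι N))                ≡⟨ cong (λ z → δ * (z * z)) (R*n q) ⟩
        δ * (1ℚ * 1ℚ)                                ≡⟨ trans (cong (δ *_) (ℚ.*-identityˡ 1ℚ)) (ℚ.*-identityʳ δ) ⟩
        δ                                            ∎
        where
        N A : ℕ
        N = n (suc q)
        A = 4 ℕ.* Q ℕ.* t ℕ.* 2 ℕ.^ (k ℕ.* M)
        A≤ : A ℕ.≤ 16 ℕ.* (n q ℕ.* Q ℕ.* 2 ℕ.^ (k ℕ.* M))
        A≤ = ℕ.≤-trans (ℕ.*-monoˡ-≤ (2 ℕ.^ (k ℕ.* M)) (ℕ.*-monoʳ-≤ (4 ℕ.* Q) (ℕ.<⇒≤ t<4n)))
          (ℕ.≤-reflexive (lemma Q (n q) (2 ℕ.^ (k ℕ.* M))))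
          where
          lemma : ∀ Q n x → 4 ℕ.* Q ℕ.* (4 ℕ.* n) ℕ.* x ≡ 16 ℕ.* (n ℕ.* Q ℕ.* x)
          lemma = solve-∀

      -- Subsets of size t contribute (Q C t) (t/n)^(2t) 2^(kMt) ≤ (4Qt 2^(kM)/n²)^t, because (Q C t) t^t ≤ (4Q)^t.
      size≤ : ∀ q t → ι (Q C t) * w q t ≤ 𝟙 (does (0 ℕ.<? t)) * δ ^ t
      size≤ q t = cases (0 ℕ.<? t) (sized? q t)
        where
        x z : ℚ
        x = Λ⁻¹ q t ^ (2 ℕ.* t)
        z = ι 2 ^ (k ℕ.* M ℕ.* t)
        y : ℚ
        y = R q * R q
        0≤y : 0ℚ ≤ y
        0≤y = 0≤* (0≤R q) (0≤R q)
        K : ℕ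
        K = 2 ℕ.^ (k ℕ.* M)
        x≡ : x ≡ ι t ^ t * (ι t * y) ^ t
        x≡ = begin-equality
          Λ⁻¹ q t ^ (t ℕ.+ (t ℕ.+ 0))          ≡⟨ cong (λ s → Λ⁻¹ q t ^ (t ℕ.+ s)) (ℕ.+-identityʳ t) ⟩
          Λ⁻¹ q t ^ (t ℕ.+ t)                  ≡⟨ ^-homo-* (Λ⁻¹ q t) t t ⟩
          Λ⁻¹ q t ^ t * Λ⁻¹ q t ^ t            ≡⟨ sym (^-distrib-* (Λ⁻¹ q t) (Λ⁻¹ q t) t) ⟩
          (ι t * R q * (ι t * R q)) ^ t        ≡⟨ cong (_^ t) (solve 2 (λ t r → t :* r :* (t :* r) := t :* (t :* (r :* r))) refl (ι t) (R q)) ⟩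
          (ι t * (ι t * y)) ^ t                ≡⟨ ^-distrib-* (ι t) (ι t * y) t ⟩
          ι t ^ t * (ι t * y) ^ t              ∎
        z≡ : z ≡ ι K ^ t
        z≡ = trans (sym (^-assocʳ (ι 2) (k ℕ.* M) t)) (cong (_^ t) (sym (ι-^ 2 (k ℕ.* M))))
        bound : t ℕ.< 4 ℕ.* n q → ι (Q C t) * (1ℚ * (x * z)) ≤ 1ℚ * δ ^ t
        bound t<4n = begin
          ι (Q C t) * (1ℚ * (x * z))                        ≡⟨ cong₂ (λ a b → ι (Q C t) * (1ℚ * (a * b))) x≡ z≡ ⟩
          ι (Q C t) * (1ℚ * (ι t ^ t * (ι t * y) ^ t * ι K ^ t))
                                                            ≡⟨ solve 4 (λ c a b d → c :* (con 1ℚ :* (a :* b :* d)) := (c :* a) :* (b :* d)) refl (ι (Q C t)) (ι t ^ t) ((ι t * y) ^ t) (ι K ^ t) ⟩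
          ι (Q C t) * ι t ^ t * ((ι t * y) ^ t * ι K ^ t)   ≡⟨ cong₂ _*_ (trans (cong (ι (Q C t) *_) (sym (ι-^ t t))) (sym (ι-* (Q C t) (t ℕ.^ t)))) (sym (^-distrib-* (ι t * y) (ι K) t)) ⟩
          ι ((Q C t) ℕ.* t ℕ.^ t) * (ι t * y * ι K) ^ t     ≤⟨ *-monoʳ ((ι t * y * ι K) ^ t) (0≤^ (0≤* (0≤* (0≤ι t) 0≤y) (0≤ι K)) t) (ι-mono (C*t^t≤4^t*n^t Q t)) ⟩
          ι (4 ℕ.^ t ℕ.* Q ℕ.^ t) * (ι t * y * ι K) ^ t     ≡⟨ cong (_* (ι t * y * ι K) ^ t) (trans (ι-* (4 ℕ.^ t) (Q ℕ.^ t)) (cong₂ _*_ (ι-^ 4 t) (ι-^ Q t))) ⟩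
          ι 4 ^ t * ι Q ^ t * (ι t * y * ι K) ^ t           ≡⟨ trans (cong (_* (ι t * y * ι K) ^ t) (sym (^-distrib-* (ι 4) (ι Q) t))) (sym (^-distrib-* (ι 4 * ι Q) (ι t * y * ι K) t)) ⟩
          (ι 4 * ι Q * (ι t * y * ι K)) ^ t                 ≡⟨ cong (_^ t) (solve 5 (λ f q t y k → f :* q :* (t :* y :* k) := f :* q :* t :* k :* y) refl (ι 4) (ι Q) (ι t) y (ι K)) ⟩
          (ι 4 * ι Q * ι t * ι K * y) ^ t                   ≡⟨ cong (λ a → (a * y) ^ t) (sym (trans (ι-* (4 ℕ.* Q ℕ.* t) K) (cong (_* ι K) (trans (ι-* (4 ℕ.* Q) t) (cong (_* ι t) (ι-* 4 Q)))))) ⟩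
          (ι (4 ℕ.* Q ℕ.* t ℕ.* K) * y) ^ t                 ≤⟨ ^-monoˡ (0≤* (0≤ι (4 ℕ.* Q ℕ.* t ℕ.* K)) 0≤y) (density-δ q t t<4n) t ⟩
          δ ^ t                                             ≡⟨ sym (ℚ.*-identityˡ (δ ^ t)) ⟩
          1ℚ * δ ^ t                                        ∎
        cases : (d : Dec (0 ℕ.< t)) (s : Dec (0 ℕ.< t × t ℕ.< 4 ℕ.* n q)) → ι (Q C t) * (𝟙 (does s) * (x * z)) ≤ 𝟙 (does d) * δ ^ t
        cases (yes _)  (yes (_ , t<4n)) = bound t<4n
        cases (no ¬0<t) (yes (0<t , _)) = contradiction 0<t ¬0<t
        cases d        (no _)           = subst (_≤ 𝟙 (does d) * δ ^ t) (solve 2 (λ c a → con 0ℚ := c :* (con 0ℚ :* a)) refl (ι (Q C t)) (x * z))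
          (0≤* (0≤𝟙 (does d)) (0≤^ 0≤δ t))

      level≤ : δ + δ ≤ 1ℚ → ∀ q → ∑ (allSubsets Q) (λ S → c q (lookup S) * E picks (W (g (Λ q (count (lookup S))) (lookup S)))) ≤ δ + δ
      level≤ 2δ≤1 q = begin
        ∑ (allSubsets Q) (λ S → c q (lookup S) * E picks (W (g (Λ q (count (lookup S))) (lookup S))))  ≤⟨ ∑-mono (allSubsets Q) (λ {S} _ → term≤ q (lookup S)) ⟩
        ∑ (allSubsets Q) (λ S → w q (count (lookup S)))               ≡⟨ ∑-cong (allSubsets Q) (λ S → cong (w q) (sym (∣∣≡count S))) ⟩
        ∑ (allSubsets Q) (λ S → w q ∣ S ∣)                            ≡⟨ ∑-by-size Q (suc Q) (w q) (ℕ.n<1+n Q) ⟩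
        sum {suc Q} (λ t → ι (Q C toℕ t) * w q (toℕ t))               ≤⟨ sum-mono {suc Q} (λ t → size≤ q (toℕ t)) ⟩
        -- Empty sets are not admissible, so the series starts with `δ` and not with 1.
        0ℚ * δ ^ 0 + sum {Q} (λ t → 1ℚ * δ ^ suc (toℕ t))             ≡⟨ trans (cong₂ _+_ (ℚ.*-zeroˡ (δ ^ 0)) (sum-cong-≗ {Q} λ t → ℚ.*-identityˡ (δ ^ suc (toℕ t)))) (ℚ.+-identityˡ (sum {Q} λ t → δ ^ suc (toℕ t))) ⟩
        sum {Q} (λ t → δ ^ suc (toℕ t))                               ≤⟨ geometric 0≤δ 2δ≤1 Q ⟩
        δ + δ                                                         ∎

      -- Each of the `k` levels contributes at most 2/b, so b = 8k makes the total 1/4.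
      4*E-bad≤1 : 8 ℕ.* k ≡ b → ι 4 * E picks bad ≤ 1ℚ
      4*E-bad≤1 8k≡b = begin
        ι 4 * E picks bad              ≤⟨ *-monoˡ (ι 4) (0≤ι 4) (ℚ.≤-trans (ℚ.≤-reflexive E-bad) (sum-mono {k} λ q → level≤ 2δ≤1 (toℕ q))) ⟩
        ι 4 * sum {k} (λ _ → δ + δ)    ≡⟨ cong (ι 4 *_) (sum-const k (δ + δ)) ⟩
        ι 4 * (ι k * (δ + δ))          ≡⟨ solve 3 (λ f k d → f :* (k :* (d :+ d)) := d :* ((f :+ f) :* k)) refl (ι 4) (ι k) δ ⟩
        δ * ((ι 4 + ι 4) * ι k)        ≡⟨ cong (δ *_) (trans (cong (_* ι k) (sym (ι-+ 4 4))) (trans (sym (ι-* 8 k)) (cong ι 8k≡b))) ⟩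
        δ * ι b                        ≡⟨ recip*ι b-pos ⟩
        1ℚ                             ∎
        where
        2≤b : 2 ℕ.≤ b
        2≤b = subst (2 ℕ.≤_) 8k≡b (ℕ.≤-trans (ℕ.m≤m+n 2 6) (ℕ.*-monoʳ-≤ 8 k-pos))
        2δ≤1 : δ + δ ≤ 1ℚ
        2δ≤1 = begin
          δ + δ          ≡⟨ solve 1 (λ d → d :+ d := d :* (con 1ℚ :+ con 1ℚ)) refl δ ⟩
          δ * (1ℚ + 1ℚ)  ≡⟨ cong (δ *_) (sym ι-2) ⟩
          δ * ι 2        ≤⟨ *-monoˡ δ 0≤δ (ι-mono 2≤b) ⟩
          δ * ι b        ≡⟨ recip*ι b-pos ⟩
          1ℚ             ∎

      0≤term : ∀ q ω S → 0ℚ ≤ c q (lookup S) * W (g (Λ q (count (lookup S))) (lookup S)) ω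
      0≤term q ω S = 0≤* (0≤* (0≤𝟙 (does (admissible? q (lookup S)))) (0≤^ (0≤Λ⁻¹ q (count (lookup S))) (2 ℕ.* count (lookup S))))
        (subst (0ℚ ≤_) (sym (W-g (Λ q (count (lookup S))) (lookup S) ω)) (0≤^ (0≤Λ q (count (lookup S))) (hits ω (lookup S))))

      0≤bad : ∀ ω → 0ℚ ≤ bad ω
      0≤bad ω = 0≤sum {k} λ q → 0≤∑ (allSubsets Q) λ {S} _ → 0≤term (toℕ q) ω S

      event≤bad : ∀ ω (q : Fin k) S → c (toℕ q) (lookup S) * W (g (Λ (toℕ q) (count (lookup S))) (lookup S)) ω ≤ bad ω
      event≤bad ω q S = ℚ.≤-trans (term≤∑ {f = λ S → c (toℕ q) (lookup S) * W (g (Λ (toℕ q) (count (lookup S))) (lookup S)) ω}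
          (λ {S} _ → 0≤term (toℕ q) ω S) (∈-allSubsets S))
        (term≤sum {k} {f = λ q → ∑ (allSubsets Q) λ S → c (toℕ q) (lookup S) * W (g (Λ (toℕ q) (count (lookup S))) (lookup S)) ω}
          (λ q → 0≤∑ (allSubsets Q) λ {S} _ → 0≤term (toℕ q) ω S) q)

      -- Markov's inequality for a single outcome: with 2t hits the summand of `S` alone would be at
      -- least 1. This uses Λ ≥ 1, which follows from t < 4 n_q ≤ n_{q+1}.
      few-hits : ∀ ω → bad ω < 1ℚ → ∀ (q : Fin k) S → Admissible (toℕ q) (lookup S) → hits ω (lookup S) ℕ.< 2 ℕ.* count (lookup S)
      few-hits ω bad<1 q S adm@(_ , 0<t , t<4n) = ℕ.≰⇒> λ 2t≤hits → ℚ.<-irrefl refl (begin-strict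
        1ℚ                                                      ≡⟨ sym (1^n≡1 (2 ℕ.* t)) ⟩
        1ℚ ^ (2 ℕ.* t)                                          ≡⟨ cong (_^ (2 ℕ.* t)) (sym (Λ⁻¹*Λ (toℕ q) 0<t)) ⟩
        (Λ⁻¹ (toℕ q) t * Λ (toℕ q) t) ^ (2 ℕ.* t)               ≡⟨ ^-distrib-* (Λ⁻¹ (toℕ q) t) (Λ (toℕ q) t) (2 ℕ.* t) ⟩
        Λ⁻¹ (toℕ q) t ^ (2 ℕ.* t) * Λ (toℕ q) t ^ (2 ℕ.* t)     ≤⟨ *-monoˡ (Λ⁻¹ (toℕ q) t ^ (2 ℕ.* t)) (0≤^ (0≤Λ⁻¹ (toℕ q) t) (2 ℕ.* t))
                                                                     (^-monoʳ (1≤Λ (toℕ q) 0<t (ℕ.≤-trans (ℕ.<⇒≤ t<4n) (4n≤n (toℕ q)))) 2t≤hits) ⟩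
        Λ⁻¹ (toℕ q) t ^ (2 ℕ.* t) * Λ (toℕ q) t ^ hits ω T      ≡⟨ cong₂ _*_ (sym (ℚ.*-identityˡ (Λ⁻¹ (toℕ q) t ^ (2 ℕ.* t)))) (sym (W-g (Λ (toℕ q) t) T ω)) ⟩
        1ℚ * Λ⁻¹ (toℕ q) t ^ (2 ℕ.* t) * W (g (Λ (toℕ q) t) T) ω ≡⟨ cong (λ a → 𝟙 a * Λ⁻¹ (toℕ q) t ^ (2 ℕ.* t) * W (g (Λ (toℕ q) t) T) ω) (sym (dec-true (admissible? (toℕ q) T) adm)) ⟩
        c (toℕ q) T * W (g (Λ (toℕ q) t) T) ω                   ≤⟨ event≤bad ω q S ⟩
        bad ω                                                   <⟨ bad<1 ⟩
        1ℚ                                                      ∎)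
        where
        T : Fin Q → Bool
        T = lookup S
        t : ℕ
        t = count T

      sparse : ∀ ω → bad ω < 1ℚ → Sparse ω
      sparse ω bad<1 q q<k T above 0<t t<4n = subst₂ (λ h t → h ℕ.< 2 ℕ.* t) hits≡ count≡
        (few-hits ω bad<1 (fromℕ< q<k) S (subst (λ z → Admissible z (lookup S)) (sym (Fin.toℕ-fromℕ< q<k))
          ((λ u Su → above u (trans (sym (S≡T u)) Su)) , subst (0 ℕ.<_) (sym count≡) 0<t , subst (ℕ._< 4 ℕ.* n q) (sym count≡) t<4n)))
        where
        S : Subset Q
        S = tabulate T
        S≡T : ∀ u → lookup S u ≡ T u
        S≡T = Vec.lookup∘tabulate T
        count≡ : count (lookup S) ≡ count T
        count≡ = sumℕ-cong λ u → cong ♯ (S≡T u)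
        hits≡ : hits ω (lookup S) ≡ hits ω T
        hits≡ = sumℕ-cong λ v → sumℕ-cong λ i → sumℕ-cong λ r →
          cong₂ (λ a b → ♯ (a ∧ (not (below (toℕ i) v) ∧ (below (toℕ i) (pick ω v i r) ∧ b)))) (S≡T v) (S≡T (pick ω v i r))

-- Choice of the parameters and of the picks.

module Construction where
  open RationalLemmas
  open import Data.Fin.Subset using (∣_∣)
  open import Data.Integer.Base using (+_)
  open import Data.Rational.Base hiding (∣_∣)
  open Counting
  open NaturalPowers
  open RationalPowers
  open LayeredGraphs
  open HallRatios
  open LowerBounds
  open Averages
  open Randomness

  module Instance (k M m b c : ℕ) (4≤k : 4 ℕ.≤ k) (M≡ : M ≡ k ℕ.* (k ℕ.* suc m)) (4k²≤2^m : 4 ℕ.* (k ℕ.* k) ℕ.≤ 2 ℕ.^ m)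
    (8k≡b : 8 ℕ.* k ≡ b) (c≡ : c ≡ b ℕ.* (16 ℕ.* 2 ℕ.^ (k ℕ.* M))) where

    open Exponents k

    k-pos : 0 ℕ.< k
    k-pos = ℕ.≤-trans (ℕ.s≤s ℕ.z≤n) 4≤k

    k≤b : k ℕ.≤ b
    k≤b = subst (k ℕ.≤_) 8k≡b (ℕ.m≤m+n k (7 ℕ.* k))

    b≤c : b ℕ.≤ c
    b≤c = subst (b ℕ.≤_) (sym c≡) (ℕ.≤-trans (ℕ.≤-reflexive (sym (ℕ.*-identityʳ b)))
      (ℕ.*-monoʳ-≤ b (ℕ.≤-trans (ℕ.m^n>0 2 (k ℕ.* M)) (ℕ.m≤n*m (2 ℕ.^ (k ℕ.* M)) 16))))

    k≤c : k ℕ.≤ c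
    k≤c = ℕ.≤-trans k≤b b≤c

    instance
      c≢0 : ℕ.NonZero c
      c≢0 = ℕ.>-nonZero (ℕ.≤-trans k-pos k≤c)

    -- As all sizes are powers of one base, the growth condition becomes an inequality of exponents
    -- with a gap of 1; `c` is exactly the constant b · 16 · 2^(kM) that this gap has to absorb.
    n : ℕ → ℕ
    n i = c ℕ.^ exponent i

    n-mono : ∀ {i j} → i ℕ.≤ j → n i ℕ.≤ n j
    n-mono i≤j = ℕ.^-monoʳ-≤ c (exponent-mono i≤j)

    n-pos : ∀ i → 0 ℕ.< n i
    n-pos i = ℕ.m^n>0 c (exponent i)

    sep : ∀ i → k ℕ.* n i ℕ.≤ n (suc i)
    sep i = ℕ.≤-trans (ℕ.*-monoˡ-≤ (n i) k≤c) (ℕ.^-monoʳ-≤ c (1+exponent≤ i))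

    4n≤n : ∀ q → 4 ℕ.* n q ℕ.≤ n (suc q)
    4n≤n q = ℕ.≤-trans (ℕ.*-monoˡ-≤ (n q) 4≤k) (sep q)

    growth : ∀ q → b ℕ.* (16 ℕ.* (n q ℕ.* n k ℕ.* 2 ℕ.^ (k ℕ.* M))) ℕ.≤ n (suc q) ℕ.* n (suc q)
    growth q = begin
      b ℕ.* (16 ℕ.* (n q ℕ.* n k ℕ.* 2 ℕ.^ (k ℕ.* M)))     ≡⟨ rearrange b (n q ℕ.* n k) (2 ℕ.^ (k ℕ.* M)) ⟩
      b ℕ.* (16 ℕ.* 2 ℕ.^ (k ℕ.* M)) ℕ.* (n q ℕ.* n k)     ≡⟨ cong (ℕ._* (n q ℕ.* n k)) (sym c≡) ⟩
      c ℕ.* (n q ℕ.* n k)                                  ≡⟨ cong (c ℕ.*_) (sym (ℕ.^-distribˡ-+-* c (exponent q) (exponent k))) ⟩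
      c ℕ.^ suc (exponent q ℕ.+ exponent k)                ≤⟨ ℕ.^-monoʳ-≤ c (exponent-growth q) ⟩
      c ℕ.^ (exponent (suc q) ℕ.+ exponent (suc q))        ≡⟨ ℕ.^-distribˡ-+-* c (exponent (suc q)) (exponent (suc q)) ⟩
      n (suc q) ℕ.* n (suc q)                              ∎
      where
      open ℕ.≤-Reasoning
      rearrange : ∀ b x y → b ℕ.* (16 ℕ.* (x ℕ.* y)) ≡ b ℕ.* (16 ℕ.* y) ℕ.* x
      rearrange = solve-∀

    open Layers k M n n-mono
    open LayersLowerBound k M n n-mono n-pos
    open Sampling k M m k-pos M≡ n n-mono n-pos
    module A = SpreadEvents sep
    module B = SparseEvents 4n≤n b (ℕ.≤-trans k-pos k≤b) growth

    good : ∃[ ω ] Spread ω × Sparse ω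
    good = ω , A.spread ω (small (p≤p+q (B.0≤bad ω)))
             , B.sparse ω (small (subst (_≤ A.bad ω + B.bad ω) (ℚ.+-identityˡ (B.bad ω)) (ℚ.+-monoˡ-≤ (B.bad ω) (A.0≤bad ω))))
      where
      open Average picks
      open ℚ.≤-Reasoning
      -- Both quantities are nonnegative, so one outcome that makes their sum less than 1 makes each
      -- of them less than 1.
      found = attain (λ ω → A.bad ω + B.bad ω)
      ω = proj₁ found
      small : ∀ {x} → x ≤ A.bad ω + B.bad ω → x < 1ℚ
      small {x} x≤ = ℚ.*-cancelˡ-<-nonNeg (ι 4) {{nonNegative (0≤ι 4)}} (begin-strict
        ι 4 * x                              ≤⟨ *-monoˡ (ι 4) (0≤ι 4) (ℚ.≤-trans x≤ (proj₂ found)) ⟩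
        ι 4 * E (λ ω → A.bad ω + B.bad ω)    ≡⟨ trans (cong (ι 4 *_) (E-+ A.bad B.bad)) (ℚ.*-distribˡ-+ (ι 4) (E A.bad) (E B.bad)) ⟩
        ι 4 * E A.bad + ι 4 * E B.bad        ≤⟨ ℚ.+-mono-≤ (A.4*E-bad≤1 4k²≤2^m) (B.4*E-bad≤1 8k≡b) ⟩
        1ℚ + 1ℚ                              ≡⟨ sym ι-2 ⟩
        ι 2                                  <⟨ ℚ.<-≤-trans (subst (_< ι 2 + 1ℚ) (ℚ.+-identityʳ (ι 2)) (ℚ.+-monoʳ-< (ι 2) (ℚ.positive⁻¹ 1ℚ)))
                                                  (ℚ.≤-trans (ℚ.≤-reflexive (sym (ι-suc 2))) (ι-mono (ℕ.n≤1+n 3))) ⟩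
        ι 4                                  ≡⟨ sym (ℚ.*-identityʳ (ι 4)) ⟩
        ι 4 * 1ℚ                             ∎)

    large : ∀ ω → Sparse ω → ∀ S → Nonempty S →
            ∃[ I ] I ⊆ S × Independent (Graph.adj (graph ω)) I × 0 ℕ.< ∣ I ∣ × ∣ S ∣ ℕ.≤ 16 ℕ.* ∣ I ∣
    large ω sparse S (u , u∈S) =
      let (I , I⊆S , free , s≤16I) = large-arcFree ω sparse (lookup S) 0<S
          ∣I∣ = trans (∣∣≡count (tabulate I)) (sumℕ-cong λ u → cong ♯ (Vec.lookup∘tabulate I u))
      in tabulate I
       , (λ {v} v∈ → Vec.lookup⇒[]= v S (I⊆S v (trans (sym (Vec.lookup∘tabulate I v)) (Vec.[]=⇒lookup v∈))))
       , arcFree⇒independent {ω} free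
       , subst (0 ℕ.<_) (sym ∣I∣) (positive-count (count I) s≤16I)
       , subst₂ (λ s t → s ℕ.≤ 16 ℕ.* t) (sym (∣∣≡count S)) (sym ∣I∣) s≤16I
      where
      0<S : 0 ℕ.< count (lookup S)
      0<S = subst (λ b → ♯ b ℕ.≤ count (lookup S)) (Vec.[]=⇒lookup u∈S) (term≤sumℕ (λ v → ♯ (lookup S v)) u)
      positive-count : ∀ t → count (lookup S) ℕ.≤ 16 ℕ.* t → 0 ℕ.< t
      positive-count zero    s≤0 = contradiction (ℕ.<-≤-trans 0<S s≤0) (ℕ.<-irrefl refl)
      positive-count (suc t) _   = ℕ.s≤s ℕ.z≤n

    bounded-ratio : Σ[ G ∈ Graph ] (∃[ ρ ] IsHallRatio G ρ × ρ ≤ + 16 / 1) ×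
                    (∃[ χ ] IsFractionalChromaticNumber G (fromℚ χ) × ι k ≤ ι 3 * χ)
    bounded-ratio = let (ω , spread , sparse) = good in
      graph ω , hallRatio (graph ω) 16 (fromℕ< (n-pos k)) (large ω sparse) , k≤3χ ω spread k-pos

  unbounded-χ : ∀ B → Σ[ G ∈ Graph ] (∃[ ρ ] IsHallRatio G ρ × ρ ≤ + 16 / 1) ×
                (∃[ χ ] IsFractionalChromaticNumber G (fromℚ χ) × ι B ≤ χ)
  unbounded-χ B = let (G , hall , χ , isχ , k≤3χ) = Instance.bounded-ratio k (k ℕ.* (k ℕ.* suc m)) m (8 ℕ.* k) _ 4≤k refl 4k²≤2^m refl refl
    in G , hall , χ , isχ , ℚ.*-cancelˡ-≤-pos (ι 3) {{positive (0<ι-suc 2)}}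
         (ℚ.≤-trans (ℚ.≤-reflexive (sym (ι-* 3 B))) (ℚ.≤-trans (ι-mono (ℕ.*-monoʳ-≤ 3 (ℕ.m≤n+m B 2))) k≤3χ))
    where
    k m : ℕ
    -- The factor 3 cancels the one in `ι k ≤ ι 3 * χ`, and the summand 2 ensures 4 ≤ k. The value
    -- of `m` comes from 4k² ≤ 4 · 2^k · 2^k.
    k = 3 ℕ.* (2 ℕ.+ B)
    m = 2 ℕ.+ (k ℕ.+ k)
    4≤k : 4 ℕ.≤ k
    4≤k = ℕ.≤-trans (ℕ.m≤m+n 4 2) (ℕ.*-monoʳ-≤ 3 (ℕ.m≤m+n 2 B))
    4k²≤2^m : 4 ℕ.* (k ℕ.* k) ℕ.≤ 2 ℕ.^ m
    4k²≤2^m = ℕ.≤-trans (ℕ.*-monoʳ-≤ 4 (ℕ.*-mono-≤ (n≤2^n k) (n≤2^n k)))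
      (ℕ.≤-reflexive (trans (cong (4 ℕ.*_) (sym (ℕ.^-distribˡ-+-* 2 k k))) (sym (ℕ.^-distribˡ-+-* 2 2 (k ℕ.+ k)))))

-- From rational bounds to the statement over the reals.

open import Data.Integer.Base using (+_)
open Construction using (unbounded-χ)
open RationalLemmas using (p≤∣p∣; p≤p+q)
open RealLemmas using (bounded)

theorem4 : Σ[ P₀ ∈ ℝ ]
    ((P lnP : ℝ) → P₀ ≤ᴿ P → lnP IsLnOf P →
    Σ[ G ∈ Graph ]
    (Σ[ ρ ∈ ℚ ] (IsHallRatio G ρ × fromℚ ρ ≤ᴿ P)) ×
    (Σ[ χ ∈ ℝ ] (IsFractionalChromaticNumber G χ ×
    exp (fromℚ (+ 1 / 5) *ᴿ (lnP *ᴿ lnP)) ≤ᴿ χ)))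
theorem4 = fromℚ (+ 16 / 1) , λ P lnP P₀≤P _ →
  let bound               = exp (fromℚ (+ 1 / 5) *ᴿ (lnP *ᴿ lnP))
      -- A Cauchy sequence is eventually bounded by a natural number, so it suffices to reach `B`.
      (B , N , bound≤B)   = bounded bound
      (G , (ρ , isρ , ρ≤16) , χ , isχ , B≤χ) = unbounded-χ B
  in G
   , (ρ , isρ , λ ε 0<ε → let (N , h) = P₀≤P ε 0<ε in N , λ n N≤n → ℚ.≤-trans ρ≤16 (h n N≤n))
   , fromℚ χ , isχ , λ ε 0<ε → N , λ n N≤n →
       ℚ.≤-trans (p≤∣p∣ (seq bound n)) (ℚ.≤-trans (bound≤B n N≤n) (ℚ.≤-trans B≤χ (p≤p+q (ℚ.<⇒≤ 0<ε))))
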